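{- Let $\ell\in\{2,3,5,7,11,13,23\}$, let $a,b,c,d,g,K\in\mathbb{Q}[x]$ be the polynomials listed for $\ell$ below, and let $F_\ell$ and $F_1$ be the power series defined in the context. Put $$y^+=\frac{2x^\ell}{c+d\sqrt g},\qquad y^-=\frac{2x^\ell}{c-d\sqrt g}.$$ Then in a neighborhood of $x=0$ $$y^+=x^\ell+O(x^{\ell+1}),\qquad y^-=x+O(x^2),$$ and $$F_\ell(x)=\frac{\ell}{(a+b\sqrt g)^{1/2}}\,F_1(y^+)=\frac{1}{(a-b\sqrt g)^{1/2}}\,F_1(y^-).$$ Moreover, $$\frac{c^2-d^2g}{4x^{\ell-1}}=\left(\frac{a^2-b^2g}{\ell^2}\right)^3=K^3 .$$ The polynomials are: $\ell=2$: $a=5/2$, $b=3/2$, $c=1-207x+3456x^2$, $d=1-81x$, $g=1-256x$, $K=1+144x$. $\ell=3$: $a=5$, $b=4$, $c=1-126x+2944x^2$, $d=(1-8x)(1-64x)$, $g=1-108x$, $K=1+192x$. $\ell=5$: $a=13-36x$, $b=12$, $c=1-80x+1890x^2-12600x^3+7776x^4+3456x^5$, $d=(1-4x)(1-18x)(1-36x)$, $g=1-44x-16x^2$, $K=1+216x+144x^2$. $\ell=7$: $a=25-80x$, $b=24$, $c=(1-21x+8x^2)(1-42x+454x^2-1008x^3-1280x^4)$, $d=(1-2x)(1-8x)(1-24x)(1-16x-8x^2)$, $g=(1+x)(1-27x)$, $K=1+224x+448x^2$. $\ell=11$: $a=61-368x+352x^2$, $b=60$, $c=1-66x+1793x^2-26048x^3+221056x^4-1132670x^5+3535840x^6-6683072x^7+7418752x^8-4460544x^9+1183744x^{10}-65536x^{11}$,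 $d=(1-x)(1-2x)(1-4x)(1-7x)(1-16x)(1-12x+16x^2)(1-14x+4x^2)$, $g=1-20x+56x^2-44x^3$, $K=1+224x-192x^2-832x^3+1024x^4$. $\ell=13$: $a=85-135x-280x^2$, $b=84+48x$, $c=1-39x+546x^2-2938x^3+117x^4+42861x^5-36998x^6-255294x^7+15366x^8+519610x^9+342576x^{10}-14976x^{11}-35840x^{12}$, $d=(1+2x)(1+x)(1-x)(1-3x)(1-8x)(1-11x-8x^2)(1-4x-8x^2)(1-10x-2x^2)$, $g=1-10x-27x^2$, $K=1+234x+1417x^2+1872x^3+832x^4$. $\ell=23$: $a=265-940x+310x^2-60x^3-135x^4$, $b=264-120x$, $c=1-46x+920x^2-10465x^3+74221x^4-336927x^5+953856x^6-1470068x^7+336674x^8+3209696x^9-6447728x^{10}+5423124x^{11}+302266x^{12}-6612454x^{13}+8362616x^{14}-4877702x^{15}-116403x^{16}+2732814x^{17}-2492280x^{18}+1115109x^{19}-170775x^{20}-83835x^{21}+48600x^{22}-6750x^{23}$, $d=(1+x)(1-x)(1-2x)(1-3x)(1-5x)(1-8x+3x^2)(1-6x-9x^2)(1-7x+3x^2-5x^3)(1-7x+7x^2-3x^3)(1-4x-x^4)$, $g=(1-x^2+x^3)(1-8x+3x^2-7x^3)$, $K=1+232x+732x^2-968x^3+1894x^4-2280x^5+2268x^6-1080x^7+225x^8$.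
   Context: Here $q=e^{2\pi i\tau}$ with $\operatorname{Im}\tau>0$, $\eta_m=q^{m/24}\prod_{j\ge1}(1-q^{mj})$, and $Q(q)=1+240\sum_{j\ge1}\frac{j^3q^j}{1-q^j}$. Sums over $j,k$ below run over all integers. All roots are taken with the branch equal to $1$ (respectively, with the positive value) at $x=0$, and fractional powers of $q$-series are taken with leading coefficient $1$. For $\ell\in\{1,2,3,5,7,11,13,23\}$ define $q$-series $X_\ell=q+O(q^2)$ and $Z_\ell=1+O(q)$ by: $X_1=\eta_1^{24}/Q(q)^3$, $Z_1=Q(q)^{1/2}$; $X_2=w/(1+64w)^2$ with $w=\eta_2^{24}/\eta_1^{24}$, $Z_2=\eta_1^2\eta_2^2/X_2^{1/4}$; $X_3=w/(1+27w)^2$ with $w=\eta_3^{12}/\eta_1^{12}$, $Z_3=\eta_1^2\eta_3^2/X_3^{1/3}$; $X_5=w/(1+22w+125w^2)$ with $w=\eta_5^6/\eta_1^6$, $Z_5=\eta_1^2\eta_5^2/X_5^{1/2}$; $X_7=w/(1+13w+49w^2)$ with $w=\eta_7^4/\eta_1^4$, $Z_7=\eta_1^2\eta_7^2/X_7^{2/3}$; $X_{11}=(\eta_1\eta_{11}/\sigma)^2$ with $\sigma=\sum_{j,k}q^{j^2+jk+3k^2}$, $Z_{11}=\eta_1^2\eta_{11}^2/X_{11}$; $X_{13}=w/(1+5w+13w^2)$ with $w=\eta_{13}^2/\eta_1^2$, $Z_{13}=\eta_1^2\eta_{13}^2/X_{13}^{7/6}$; $X_{23}=2\eta_1\eta_{23}/(\sigma_A+\sigma_B)$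 with $\sigma_A=\sum_{j,k}q^{j^2+jk+6k^2}$, $\sigma_B=\sum_{j,k}q^{2j^2+jk+3k^2}$, $Z_{23}=\eta_1^2\eta_{23}^2/X_{23}^2$. The coefficients $T_\ell(n)$ are defined by the expansion $Z_\ell=\sum_{n\ge0}T_\ell(n)X_\ell^n$ near $q=0$, and $F_\ell(x)=\sum_{n\ge0}T_\ell(n)x^n$. In particular $F_1(x)=\sum_{n\ge0}\binom{6n}{3n}\binom{3n}{n}\binom{2n}{n}x^n$. Equivalently, $T_\ell(0)=1$ and, for $n\ge 0$, $(n+1)^3T_\ell(n+1)=\sum_{j\ge1}(n+1-\tfrac j2)\{h_j-(n+1)(n+1-j)g_j\}T_\ell(n+1-j)$ (with $T_\ell(m)=0$ for $m<0$), where $g_j,h_j$ are the coefficients of $x^j$ in $G_\ell,H_\ell$: $G_1=1-1728x$, $H_1=240x$; $G_2=1-256x$, $H_2=48x$; $G_3=1-108x$, $H_3=24x$; $G_5=1-44x-16x^2$, $H_5=12x(1+x)$; $G_7=(1+x)(1-27x)$, $H_7=8x(1+3x)$; $G_{11}=1-20x+56x^2-44x^3$, $H_{11}=8x(1-8x+11x^2)$; $G_{13}=(1+x)(1-10x-27x^2)$, $H_{13}=\frac x4(12+175x+231x^2)$; $G_{23}=(1-x^2+x^3)(1-8x+3x^2-7x^3)$, $H_{23}=4x(1-x-x^2+12x^3-15x^4+14x^5)$. (So $g=G_\ell$ in the claim, except for $\ell=13$.) -}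

module Defs where

open import Agda.Builtin.FromNat using (Number; fromNat)
open import Agda.Builtin.FromNeg using (Negative; fromNeg)
open import Data.Fin.Base as Fin using (Fin)
open import Data.Integer.Base as ℤ using (+_)
open import Data.List.Base as List using (List; []; _∷_)
open import Data.Nat.Base as ℕ using (ℕ; zero; suc)
open import Data.Nat.Combinatorics using (_C_)
import Data.Nat.Literals as ℕLit
import Data.Nat.Properties as ℕₚ
open import Data.Product.Base using (_×_; ∃-syntax)
open import Data.Rational.Base as ℚ using (ℚ; 0ℚ; 1ℚ)
import Data.Rational.Literals as ℚLit
import Data.Rational.Properties as ℚₚ
open import Data.Unit.Base using (tt)
open import Data.Vec.Base as Vec using (Vec; []; _∷_)
open import Relation.Binary.PropositionalEquality
  using (_≡_; _≢_; refl; cong; module ≡-Reasoning)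

open import Algebra.Properties.CommutativeMonoid.Sum ℚₚ.+-0-commutativeMonoid
  using (sum-syntax; sum-cong-≋)

instance
  ℕ-literals : Number ℕ
  ℕ-literals = ℕLit.number

  ℚ-literals : Number ℚ
  ℚ-literals = ℚLit.number

  ℚ-negative-literals : Negative ℚ
  ℚ-negative-literals = ℚLit.negative

ℕ→ℚ : ℕ → ℚ
ℕ→ℚ n = ℚLit.fromℤ (+ n)

------------------------------------------------------------------------
-- Formal power series over ℚ

Series : Set
Series = ℕ → ℚ

infix  4 _≈_ _≈_mod-x^_ _≈√_ _≈_÷_
infixl 6 _⊕_ _⊖_
infixr 7 _•_
infixl 8 _⊛_
infixr 9 _^_ _∘_
infix  10 x^_

_≈_ : Series → Series → Set
f ≈ h = ∀ n → f n ≡ h n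

-- f = h + O(x^N)
_≈_mod-x^_ : Series → Series → ℕ → Set
f ≈ h mod-x^ N = ∀ n → n ℕ.< N → f n ≡ h n

-- the polynomial with the given coefficients, constant term first
⟦_⟧ : List ℚ → Series
⟦ []     ⟧ _       = 0ℚ
⟦ p ∷ _  ⟧ zero    = p
⟦ _ ∷ ps ⟧ (suc n) = ⟦ ps ⟧ n

x^_ : ℕ → Series
(x^ zero)  zero    = 1ℚ
(x^ zero)  (suc _) = 0ℚ
(x^ suc k) zero    = 0ℚ
(x^ suc k) (suc n) = (x^ k) n

_⊕_ _⊖_ _⊛_ : Series → Series → Series
(f ⊕ h) n = f n ℚ.+ h n
(f ⊖ h) n = f n ℚ.- h n
(f ⊛ h) n = ∑[ i < suc n ] (f (Fin.toℕ i) ℚ.* h (n ℕ.∸ Fin.toℕ i))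

_•_ : ℚ → Series → Series
(p • f) n = p ℚ.* f n

_^_ : Series → ℕ → Series
f ^ zero  = x^ 0
f ^ suc k = f ⊛ f ^ k

-- f(y(x)).  Meaningful only if y has zero constant term: then yᵏ = O(xᵏ),
-- so terms with k > n do not contribute to the coefficient of xⁿ.
_∘_ : Series → Series → Series
(f ∘ y) n = ∑[ k < suc n ] (f (Fin.toℕ k) ℚ.* (y ^ Fin.toℕ k) n)

-- s is the square root of f whose value at x = 0 is positive
_≈√_ : Series → Series → Set
s ≈√ f = 0ℚ ℚ.< s 0 × s ⊛ s ≈ f

-- s = f / h.  As ℚ[[x]] is a domain, s is unique if it exists; h need not
-- be a unit.
_≈_÷_ : Series → Series → Series → Set
s ≈ f ÷ h = (∃[ n ] h n ≢ 0ℚ) × s ⊛ h ≈ f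

-- Positive radius of convergence: |fₙ| ≤ C Rⁿ for all n.  A formal identity
-- between sums, products and composites (with inner constant term zero) of
-- such series holds for their values at all x in a neighbourhood of 0.
Convergent : Series → Set
Convergent f = ∃[ C ] ∃[ R ] ∀ n → ℚ.∣ f n ∣ ℚ.≤ ℕ→ℚ (C ℕ.* R ℕ.^ n)

------------------------------------------------------------------------
-- The series Σ T(n) xⁿ attached to a pair (G , H) by T(0) = 1 and
--
--   (n+1)³ T(n+1) = Σ_{j ≥ 1} (n+1-j/2) (hⱼ - (n+1)(n+1-j) gⱼ) T(n+1-j),
--
-- where T(m) = 0 for m < 0.

module Recurrence (G H : Series) where

  coefficient : ℕ → ℕ → ℚ
  coefficient n j =
    (ℕ→ℚ (suc n) ℚ.- (+ j) ℚ./ 2) ℚ.*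
    (H j ℚ.- ℕ→ℚ (suc n) ℚ.* ℕ→ℚ (suc n ℕ.∸ j) ℚ.* G j)

  cube : ℕ → ℕ
  cube n = suc n ℕ.* suc n ℕ.* suc n

  -- T(n) , T(n-1) , … , T(0);  below, i stands for j - 1
  history : ∀ n → Vec ℚ (suc n)
  history zero    = 1ℚ ∷ []
  history (suc n) =
    (ℚ.1/ ℕ→ℚ (cube n) ℚ.*
      (∑[ i < suc n ] (coefficient n (suc (Fin.toℕ i)) ℚ.* Vec.lookup (history n) i)))
    ∷ history n

  T : Series
  T n = Vec.head (history n)

  lookup-history : ∀ n (i : Fin (suc n)) →
                   Vec.lookup (history n) i ≡ T (n ℕ.∸ Fin.toℕ i)
  lookup-history zero    Fin.zero    = refl
  lookup-history (suc n) Fin.zero    = refl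
  lookup-history (suc n) (Fin.suc i) = lookup-history n i

  T-zero : T 0 ≡ 1ℚ
  T-zero = refl

  T-suc : ∀ n → ℕ→ℚ (cube n) ℚ.* T (suc n) ≡
          ∑[ i < suc n ] (coefficient n (suc (Fin.toℕ i)) ℚ.* T (n ℕ.∸ Fin.toℕ i))
  T-suc n = begin
    k ℚ.* (ℚ.1/ k ℚ.* S)   ≡⟨ ℚₚ.*-assoc k (ℚ.1/ k) S ⟨
    k ℚ.* ℚ.1/ k ℚ.* S     ≡⟨ cong (ℚ._* S) (ℚₚ.*-inverseʳ k) ⟩
    1ℚ ℚ.* S               ≡⟨ ℚₚ.*-identityˡ S ⟩
    S                      ≡⟨ sum-cong-≋ {suc n} (λ i →
                                cong (coefficient n (suc (Fin.toℕ i)) ℚ.*_)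
                                     (lookup-history n i)) ⟩
    ∑[ i < suc n ] (coefficient n (suc (Fin.toℕ i)) ℚ.* T (n ℕ.∸ Fin.toℕ i)) ∎
    where
    open ≡-Reasoning
    k S : ℚ
    k = ℕ→ℚ (cube n)
    S = ∑[ i < suc n ] (coefficient n (suc (Fin.toℕ i)) ℚ.* Vec.lookup (history n) i)

-- F₁ = Σ (6n choose 3n) (3n choose n) (2n choose n) xⁿ
F₁ : Series
F₁ = Recurrence.T ⟦ 1 ∷ -1728 ∷ [] ⟧ ⟦ 0 ∷ 240 ∷ [] ⟧

private
  F₁-check : List.map F₁ (List.upTo 6) ≡
    List.map (λ n → ℕ→ℚ (((6 ℕ.* n) C (3 ℕ.* n)) ℕ.* ((3 ℕ.* n) C n) ℕ.* ((2 ℕ.* n) C n)))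
             (List.upTo 6)
  F₁-check = refl

------------------------------------------------------------------------
-- The levels and their polynomials

data Level : Set where
  ℓ₂ ℓ₃ ℓ₅ ℓ₇ ℓ₁₁ ℓ₁₃ ℓ₂₃ : Level

toℕ : Level → ℕ
toℕ ℓ₂  = 2
toℕ ℓ₃  = 3
toℕ ℓ₅  = 5
toℕ ℓ₇  = 7
toℕ ℓ₁₁ = 11
toℕ ℓ₁₃ = 13
toℕ ℓ₂₃ = 23

G H : Level → Series
G ℓ₂  = ⟦ 1 ∷ -256 ∷ [] ⟧
G ℓ₃  = ⟦ 1 ∷ -108 ∷ [] ⟧
G ℓ₅  = ⟦ 1 ∷ -44 ∷ -16 ∷ [] ⟧
G ℓ₇  = ⟦ 1 ∷ 1 ∷ [] ⟧ ⊛ ⟦ 1 ∷ -27 ∷ [] ⟧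
G ℓ₁₁ = ⟦ 1 ∷ -20 ∷ 56 ∷ -44 ∷ [] ⟧
G ℓ₁₃ = ⟦ 1 ∷ 1 ∷ [] ⟧ ⊛ ⟦ 1 ∷ -10 ∷ -27 ∷ [] ⟧
G ℓ₂₃ = ⟦ 1 ∷ 0 ∷ -1 ∷ 1 ∷ [] ⟧ ⊛ ⟦ 1 ∷ -8 ∷ 3 ∷ -7 ∷ [] ⟧
H ℓ₂  = ⟦ 0 ∷ 48 ∷ [] ⟧
H ℓ₃  = ⟦ 0 ∷ 24 ∷ [] ⟧
H ℓ₅  = 12 • x^ 1 ⊛ ⟦ 1 ∷ 1 ∷ [] ⟧
H ℓ₇  = 8 • x^ 1 ⊛ ⟦ 1 ∷ 3 ∷ [] ⟧
H ℓ₁₁ = 8 • x^ 1 ⊛ ⟦ 1 ∷ -8 ∷ 11 ∷ [] ⟧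
H ℓ₁₃ = ((+ 1) ℚ./ 4) • x^ 1 ⊛ ⟦ 12 ∷ 175 ∷ 231 ∷ [] ⟧
H ℓ₂₃ = 4 • x^ 1 ⊛ ⟦ 1 ∷ -1 ∷ -1 ∷ 12 ∷ -15 ∷ 14 ∷ [] ⟧

-- Equivalently, the expansion of the weight-two modular form Z_ℓ in powers of
-- the level-ℓ modular function X_ℓ.
F : Level → Series
F ℓ = Recurrence.T (G ℓ) (H ℓ)

record Polynomials : Set where
  field
    a b c d g K : Series

polynomials : Level → Polynomials
polynomials ℓ₂ = record
  { a = ⟦ (+ 5) ℚ./ 2 ∷ [] ⟧
  ; b = ⟦ (+ 3) ℚ./ 2 ∷ [] ⟧
  ; c = ⟦ 1 ∷ -207 ∷ 3456 ∷ [] ⟧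
  ; d = ⟦ 1 ∷ -81 ∷ [] ⟧
  ; g = ⟦ 1 ∷ -256 ∷ [] ⟧
  ; K = ⟦ 1 ∷ 144 ∷ [] ⟧
  }
polynomials ℓ₃ = record
  { a = ⟦ 5 ∷ [] ⟧
  ; b = ⟦ 4 ∷ [] ⟧
  ; c = ⟦ 1 ∷ -126 ∷ 2944 ∷ [] ⟧
  ; d = ⟦ 1 ∷ -8 ∷ [] ⟧ ⊛ ⟦ 1 ∷ -64 ∷ [] ⟧
  ; g = ⟦ 1 ∷ -108 ∷ [] ⟧
  ; K = ⟦ 1 ∷ 192 ∷ [] ⟧
  }
polynomials ℓ₅ = record
  { a = ⟦ 13 ∷ -36 ∷ [] ⟧
  ; b = ⟦ 12 ∷ [] ⟧
  ; c = ⟦ 1 ∷ -80 ∷ 1890 ∷ -12600 ∷ 7776 ∷ 3456 ∷ [] ⟧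
  ; d = ⟦ 1 ∷ -4 ∷ [] ⟧ ⊛ ⟦ 1 ∷ -18 ∷ [] ⟧ ⊛ ⟦ 1 ∷ -36 ∷ [] ⟧
  ; g = ⟦ 1 ∷ -44 ∷ -16 ∷ [] ⟧
  ; K = ⟦ 1 ∷ 216 ∷ 144 ∷ [] ⟧
  }
polynomials ℓ₇ = record
  { a = ⟦ 25 ∷ -80 ∷ [] ⟧
  ; b = ⟦ 24 ∷ [] ⟧
  ; c = ⟦ 1 ∷ -21 ∷ 8 ∷ [] ⟧ ⊛ ⟦ 1 ∷ -42 ∷ 454 ∷ -1008 ∷ -1280 ∷ [] ⟧
  ; d = ⟦ 1 ∷ -2 ∷ [] ⟧ ⊛ ⟦ 1 ∷ -8 ∷ [] ⟧ ⊛ ⟦ 1 ∷ -24 ∷ [] ⟧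
      ⊛ ⟦ 1 ∷ -16 ∷ -8 ∷ [] ⟧
  ; g = ⟦ 1 ∷ 1 ∷ [] ⟧ ⊛ ⟦ 1 ∷ -27 ∷ [] ⟧
  ; K = ⟦ 1 ∷ 224 ∷ 448 ∷ [] ⟧
  }
polynomials ℓ₁₁ = record
  { a = ⟦ 61 ∷ -368 ∷ 352 ∷ [] ⟧
  ; b = ⟦ 60 ∷ [] ⟧
  ; c = ⟦ 1 ∷ -66 ∷ 1793 ∷ -26048 ∷ 221056 ∷ -1132670 ∷ 3535840 ∷ -6683072
        ∷ 7418752 ∷ -4460544 ∷ 1183744 ∷ -65536 ∷ [] ⟧
  ; d = ⟦ 1 ∷ -1 ∷ [] ⟧ ⊛ ⟦ 1 ∷ -2 ∷ [] ⟧ ⊛ ⟦ 1 ∷ -4 ∷ [] ⟧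
      ⊛ ⟦ 1 ∷ -7 ∷ [] ⟧ ⊛ ⟦ 1 ∷ -16 ∷ [] ⟧
      ⊛ ⟦ 1 ∷ -12 ∷ 16 ∷ [] ⟧ ⊛ ⟦ 1 ∷ -14 ∷ 4 ∷ [] ⟧
  ; g = ⟦ 1 ∷ -20 ∷ 56 ∷ -44 ∷ [] ⟧
  ; K = ⟦ 1 ∷ 224 ∷ -192 ∷ -832 ∷ 1024 ∷ [] ⟧
  }
polynomials ℓ₁₃ = record
  { a = ⟦ 85 ∷ -135 ∷ -280 ∷ [] ⟧
  ; b = ⟦ 84 ∷ 48 ∷ [] ⟧
  ; c = ⟦ 1 ∷ -39 ∷ 546 ∷ -2938 ∷ 117 ∷ 42861 ∷ -36998 ∷ -255294 ∷ 15366
        ∷ 519610 ∷ 342576 ∷ -14976 ∷ -35840 ∷ [] ⟧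
  ; d = ⟦ 1 ∷ 2 ∷ [] ⟧ ⊛ ⟦ 1 ∷ 1 ∷ [] ⟧ ⊛ ⟦ 1 ∷ -1 ∷ [] ⟧
      ⊛ ⟦ 1 ∷ -3 ∷ [] ⟧ ⊛ ⟦ 1 ∷ -8 ∷ [] ⟧ ⊛ ⟦ 1 ∷ -11 ∷ -8 ∷ [] ⟧
      ⊛ ⟦ 1 ∷ -4 ∷ -8 ∷ [] ⟧ ⊛ ⟦ 1 ∷ -10 ∷ -2 ∷ [] ⟧
  ; g = ⟦ 1 ∷ -10 ∷ -27 ∷ [] ⟧
  ; K = ⟦ 1 ∷ 234 ∷ 1417 ∷ 1872 ∷ 832 ∷ [] ⟧
  }
polynomials ℓ₂₃ = record
  { a = ⟦ 265 ∷ -940 ∷ 310 ∷ -60 ∷ -135 ∷ [] ⟧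
  ; b = ⟦ 264 ∷ -120 ∷ [] ⟧
  ; c = ⟦ 1 ∷ -46 ∷ 920 ∷ -10465 ∷ 74221 ∷ -336927 ∷ 953856 ∷ -1470068
        ∷ 336674 ∷ 3209696 ∷ -6447728 ∷ 5423124 ∷ 302266 ∷ -6612454
        ∷ 8362616 ∷ -4877702 ∷ -116403 ∷ 2732814 ∷ -2492280 ∷ 1115109
        ∷ -170775 ∷ -83835 ∷ 48600 ∷ -6750 ∷ [] ⟧
  ; d = ⟦ 1 ∷ 1 ∷ [] ⟧ ⊛ ⟦ 1 ∷ -1 ∷ [] ⟧ ⊛ ⟦ 1 ∷ -2 ∷ [] ⟧
      ⊛ ⟦ 1 ∷ -3 ∷ [] ⟧ ⊛ ⟦ 1 ∷ -5 ∷ [] ⟧ ⊛ ⟦ 1 ∷ -8 ∷ 3 ∷ [] ⟧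
      ⊛ ⟦ 1 ∷ -6 ∷ -9 ∷ [] ⟧ ⊛ ⟦ 1 ∷ -7 ∷ 3 ∷ -5 ∷ [] ⟧
      ⊛ ⟦ 1 ∷ -7 ∷ 7 ∷ -3 ∷ [] ⟧ ⊛ ⟦ 1 ∷ -4 ∷ 0 ∷ 0 ∷ -1 ∷ [] ⟧
  ; g = ⟦ 1 ∷ 0 ∷ -1 ∷ 1 ∷ [] ⟧ ⊛ ⟦ 1 ∷ -8 ∷ 3 ∷ -7 ∷ [] ⟧
  ; K = ⟦ 1 ∷ 232 ∷ 732 ∷ -968 ∷ 1894 ∷ -2280 ∷ 2268 ∷ -1080 ∷ 225 ∷ [] ⟧
  }

1/ℓ² : Level → ℚ
1/ℓ² ℓ = (+ 1) ℚ./ (toℕ ℓ ℕ.* toℕ ℓ)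
  where
  toℕ-nonZero : ∀ k → ℕ.NonZero (toℕ k)
  toℕ-nonZero ℓ₂  = _
  toℕ-nonZero ℓ₃  = _
  toℕ-nonZero ℓ₅  = _
  toℕ-nonZero ℓ₇  = _
  toℕ-nonZero ℓ₁₁ = _
  toℕ-nonZero ℓ₁₃ = _
  toℕ-nonZero ℓ₂₃ = _
  instance
    ℓ²-nonZero : ℕ.NonZero (toℕ ℓ ℕ.* toℕ ℓ)
    ℓ²-nonZero = ℕₚ.m*n≢0 (toℕ ℓ) (toℕ ℓ) {{toℕ-nonZero ℓ}} {{toℕ-nonZero ℓ}}

-- The five series are uniquely determined by their specifications.  The
-- denominator of y⁻ is not a unit: it turns out to be O(x^(ℓ-1)).
record Branches (ℓ : Level) : Set where
  open Polynomials (polynomials ℓ)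
  field
    √g y⁺ y⁻ √[a+b√g] √[a-b√g] : Series
    √g-spec       : √g ≈√ g
    y⁺-spec       : y⁺ ≈ 2 • x^ toℕ ℓ ÷ (c ⊕ d ⊛ √g)
    y⁻-spec       : y⁻ ≈ 2 • x^ toℕ ℓ ÷ (c ⊖ d ⊛ √g)
    √[a+b√g]-spec : √[a+b√g] ≈√ a ⊕ b ⊛ √g
    √[a-b√g]-spec : √[a-b√g] ≈√ a ⊖ b ⊛ √g

{-# OPTIONS --safe #-}
module Submission where

-- With D = √G θ, θ = x d/dx, the recurrence for T is D³F = H DF + ½ (DH) F, the symmetric square of a
-- second order equation.  It has the first integral 2 F D²F - (DF)² - H F², which vanishes for the
-- solution with T(0) = 1, so conversely F is the only solution of 2 F D²F - (DF)² = H F² with F(0) = 1.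
-- Put s = ± √g, M = a - b s, N = c + d s and y = 2 xˡ / (c - d s) = x N / (2 K³).  Then F₁(y) / √M solves
-- the equation of level ℓ because of two algebraic identities:
--
--   G (θy)² = M y² (1 - 1728 y),
--   H M² + G M θ²M - 5/4 G (θM)² + ½ (θG) M θM = 240 y M³.
--
-- The first says that D acts on functions of y as √M times the operator D of level 1; the second that
-- division by √M turns H₁(y) = 240 y into H.  After multiplication by powers of 2, g and K both are
-- identities in ℤ[x][s] with s² = g, verified for each level by computation.

open import Defs
open import Data.Nat using (suc; _∸_)
open import Data.Product using (_×_)

open import Algebra.Bundles using (CommutativeRing)
open import Algebra.Structures using (IsCommutativeRing)
import Algebra.Construct.Pointwise as Pointwise
import Algebra.Properties.Ring as RingProperties
import Algebra.Solver.Ring as RingSolver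
open import Algebra.Solver.Ring.AlmostCommutativeRing
  using (fromCommutativeRing; _-Raw-AlmostCommutative⟶_)
open import Data.Bool.Base using (Bool; true; false; _∧_)
open import Data.Fin.Base as Fin using (Fin)
import Data.Fin.Properties as Finₚ
open import Data.Integer.Base as ℤ using (ℤ; +_)
import Data.Integer.Properties as ℤₚ
open import Data.List.Base as List using (List; []; _∷_)
open import Data.Maybe.Base using (Maybe; just; nothing)
open import Data.Nat.Base as ℕ using (ℕ; zero; z≤n; s≤s)
import Data.Nat.Properties as ℕₚ
import Data.Nat.Solver as ℕSolvers
open import Data.Product.Base using (_,_; proj₁; proj₂; ∃-syntax)
open import Data.Rational.Base as ℚ using (ℚ; 0ℚ; 1ℚ)
import Data.Rational.Literals as ℚLit
import Data.Rational.Properties as ℚₚ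
import Data.Rational.Solver as ℚSolvers
import Data.Rational.Unnormalised.Base as ℚᵘ
import Data.Rational.Unnormalised.Properties as ℚᵘₚ
open import Data.Sum.Base using (inj₁; inj₂)
open import Function.Base using (case_of_)
open import Level using (0ℓ)
open import Relation.Binary.PropositionalEquality
  using (_≡_; _≢_; refl; sym; trans; cong; cong₂; subst; module ≡-Reasoning)
open import Relation.Nullary using (yes; no; contradiction)

open import Algebra.Properties.Semiring.Sum
  (CommutativeRing.semiring ℚₚ.+-*-commutativeRing)
  using (sum-syntax; sum-cong-≗; ∑-distrib-+; *-distribˡ-sum)

-- The root of `G` is never formed. At `ℓ₁₃` one has G = (1 + x) g, so √G does not lie in ℚ(x)(√g);
-- only D² and products of two first derivatives occur, and these are rational in `G`. The quadratic
-- equation is also of lower order: substituting F₁(y) / √M into the third-order equation would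
-- bring in the third derivative of `M`, whereas the two identities stop at θy and θ²M. Both signs
-- of `s` are covered by one computation, because only s² = g enters it. The sign matters again for
-- constant terms, which decide the order of `y` at 0 and the factor in front of F₁. The series y,
-- θy and the denominator of y⁻ are not units. Equations are kept multiplied by such factors, which
-- are cancelled at the end because ℚ[[x]] is a domain. Formal identities say nothing about
-- convergence; it is obtained separately, from linear recursions whose coefficients are bounded
-- geometrically.

private
  module ℚSolver = ℚSolvers.+-*-Solver
  module ℕSolver = ℕSolvers.+-*-Solver

*-cancelˡ-≢0 : ∀ {p q r} → p ≢ 0ℚ → p ℚ.* q ≡ p ℚ.* r → q ≡ r
*-cancelˡ-≢0 {p} {q} {r} p≢0 eq = begin
  q                    ≡⟨ undo q ⟨
  ℚ.1/ p ℚ.* (p ℚ.* q) ≡⟨ cong (ℚ.1/ p ℚ.*_) eq ⟩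
  ℚ.1/ p ℚ.* (p ℚ.* r) ≡⟨ undo r ⟩
  r                    ∎
  where
  open ≡-Reasoning
  instance
    p-nonZero : ℚ.NonZero p
    p-nonZero = ℚ.≢-nonZero p≢0
  undo : ∀ s → ℚ.1/ p ℚ.* (p ℚ.* s) ≡ s
  undo s = trans (sym (ℚₚ.*-assoc (ℚ.1/ p) p s)) (trans (cong (ℚ._* s) (ℚₚ.*-inverseˡ p)) (ℚₚ.*-identityˡ s))

-- The ring of formal power series

tail : Series → Series
tail f n = f (suc n)

neg : Series → Series
neg f n = ℚ.- f n

𝟘 𝟙 : Series
𝟘 _ = 0ℚ
𝟙 = x^ 0

module _ where
  open ≡-Reasoning
  open ℚSolver

  -- Coefficients with index above `n` do not enter. Strong inductions on the index can therefore
  -- rewrite inside a product.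
  ⊛-cong-≤ : ∀ n {f f′ h h′} → (∀ k → k ℕ.≤ n → f k ≡ f′ k) →
             (∀ k → k ℕ.≤ n → h k ≡ h′ k) → (f ⊛ h) n ≡ (f′ ⊛ h′) n
  ⊛-cong-≤ n p q = sum-cong-≗ {suc n} λ i →
    cong₂ ℚ._*_ (p (Fin.toℕ i) (ℕₚ.≤-pred (Finₚ.toℕ<n i))) (q (n ∸ Fin.toℕ i) (ℕₚ.m∸n≤m n (Fin.toℕ i)))

  ⊛-cong : ∀ {f f′ h h′} → f ≈ f′ → h ≈ h′ → f ⊛ h ≈ f′ ⊛ h′
  ⊛-cong p q n = ⊛-cong-≤ n (λ k _ → p k) (λ k _ → q k)

  -- Splitting off the first summand, `(f ⊛ h) (suc n)` is by definition
  -- `f 0 ℚ.* h (suc n) ℚ.+ (tail f ⊛ h) n`. This and most ring laws below are inductions on the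
  -- index that pass from `f` to `tail f`.
  ⊛-distribʳ : ∀ h f g → (f ⊕ g) ⊛ h ≈ f ⊛ h ⊕ g ⊛ h
  ⊛-distribʳ h f g zero =
    solve 3 (λ a b c → (b :+ c) :* a :+ con 0ℚ := (b :* a :+ con 0ℚ) :+ (c :* a :+ con 0ℚ))
      refl (h 0) (f 0) (g 0)
  ⊛-distribʳ h f g (suc n) = begin
    (f 0 ℚ.+ g 0) ℚ.* h (suc n) ℚ.+ ((tail f ⊕ tail g) ⊛ h) n
      ≡⟨ cong ((f 0 ℚ.+ g 0) ℚ.* h (suc n) ℚ.+_) (⊛-distribʳ h (tail f) (tail g) n) ⟩
    (f 0 ℚ.+ g 0) ℚ.* h (suc n) ℚ.+ ((tail f ⊛ h) n ℚ.+ (tail g ⊛ h) n)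
      ≡⟨ solve 5 (λ a b c u v → (b :+ c) :* a :+ (u :+ v) := (b :* a :+ u) :+ (c :* a :+ v))
           refl (h (suc n)) (f 0) (g 0) _ _ ⟩
    (f ⊛ h) (suc n) ℚ.+ (g ⊛ h) (suc n) ∎

  •-⊛ : ∀ p f h → (p • f) ⊛ h ≈ p • (f ⊛ h)
  •-⊛ p f h zero = solve 3 (λ p a b → (p :* a) :* b :+ con 0ℚ := p :* (a :* b :+ con 0ℚ)) refl p (f 0) (h 0)
  •-⊛ p f h (suc n) = begin
    p ℚ.* f 0 ℚ.* h (suc n) ℚ.+ ((p • tail f) ⊛ h) n
      ≡⟨ cong (p ℚ.* f 0 ℚ.* h (suc n) ℚ.+_) (•-⊛ p (tail f) h n) ⟩
    p ℚ.* f 0 ℚ.* h (suc n) ℚ.+ p ℚ.* (tail f ⊛ h) n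
      ≡⟨ solve 4 (λ p a b u → (p :* a) :* b :+ p :* u := p :* (a :* b :+ u)) refl p (f 0) (h (suc n)) _ ⟩
    p ℚ.* (f ⊛ h) (suc n) ∎

  -- Peels off the last summand, where the definition peels off the first. Commutativity has to
  -- exchange the two ends.
  ⊛-suc : ∀ f h n → (f ⊛ h) (suc n) ≡ (f ⊛ tail h) n ℚ.+ f (suc n) ℚ.* h 0
  ⊛-suc f h zero =
    solve 4 (λ a b c d → a :* d :+ (b :* c :+ con 0ℚ) := (a :* d :+ con 0ℚ) :+ b :* c)
      refl (f 0) (f 1) (h 0) (h 1)
  ⊛-suc f h (suc n) = begin
    f 0 ℚ.* h (suc (suc n)) ℚ.+ (tail f ⊛ h) (suc n)
      ≡⟨ cong (f 0 ℚ.* h (suc (suc n)) ℚ.+_) (⊛-suc (tail f) h n) ⟩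
    f 0 ℚ.* h (suc (suc n)) ℚ.+ ((tail f ⊛ tail h) n ℚ.+ f (suc (suc n)) ℚ.* h 0)
      ≡⟨ ℚₚ.+-assoc (f 0 ℚ.* h (suc (suc n))) _ _ ⟨
    (f ⊛ tail h) (suc n) ℚ.+ f (suc (suc n)) ℚ.* h 0 ∎

  ⊛-comm : ∀ f h → f ⊛ h ≈ h ⊛ f
  ⊛-comm f h zero = cong (ℚ._+ 0ℚ) (ℚₚ.*-comm (f 0) (h 0))
  ⊛-comm f h (suc n) = begin
    f 0 ℚ.* h (suc n) ℚ.+ (tail f ⊛ h) n
      ≡⟨ cong (f 0 ℚ.* h (suc n) ℚ.+_) (⊛-comm (tail f) h n) ⟩
    f 0 ℚ.* h (suc n) ℚ.+ (h ⊛ tail f) n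
      ≡⟨ solve 3 (λ a b c → a :* b :+ c := c :+ b :* a) refl (f 0) (h (suc n)) _ ⟩
    (h ⊛ tail f) n ℚ.+ h (suc n) ℚ.* f 0
      ≡⟨ ⊛-suc h f n ⟨
    (h ⊛ f) (suc n) ∎

  ⊛-assoc : ∀ f g h → (f ⊛ g) ⊛ h ≈ f ⊛ (g ⊛ h)
  ⊛-assoc f g h zero =
    solve 3 (λ a b c → (a :* b :+ con 0ℚ) :* c :+ con 0ℚ := a :* (b :* c :+ con 0ℚ) :+ con 0ℚ)
      refl (f 0) (g 0) (h 0)
  ⊛-assoc f g h (suc n) = begin
    -- By definition `tail (f ⊛ g)` is `f 0 • tail g ⊕ tail f ⊛ g`.
    (f ⊛ g) 0 ℚ.* h (suc n) ℚ.+ ((f 0 • tail g ⊕ tail f ⊛ g) ⊛ h) n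
      ≡⟨ cong ((f ⊛ g) 0 ℚ.* h (suc n) ℚ.+_) (trans (⊛-distribʳ h (f 0 • tail g) (tail f ⊛ g) n)
           (cong₂ ℚ._+_ (•-⊛ (f 0) (tail g) h n) (⊛-assoc (tail f) g h n))) ⟩
    (f ⊛ g) 0 ℚ.* h (suc n) ℚ.+ (f 0 ℚ.* (tail g ⊛ h) n ℚ.+ (tail f ⊛ (g ⊛ h)) n)
      ≡⟨ solve 5 (λ a b c u v → (a :* b :+ con 0ℚ) :* c :+ (a :* u :+ v) := a :* (b :* c :+ u) :+ v)
           refl (f 0) (g 0) (h (suc n)) ((tail g ⊛ h) n) ((tail f ⊛ (g ⊛ h)) n) ⟩
    (f ⊛ (g ⊛ h)) (suc n) ∎

  ⊛-zeroˡ : ∀ f → 𝟘 ⊛ f ≈ 𝟘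
  ⊛-zeroˡ f zero    = solve 1 (λ a → con 0ℚ :* a :+ con 0ℚ := con 0ℚ) refl (f 0)
  ⊛-zeroˡ f (suc n) = trans (cong (0ℚ ℚ.* f (suc n) ℚ.+_) (⊛-zeroˡ f n))
    (solve 1 (λ a → con 0ℚ :* a :+ con 0ℚ := con 0ℚ) refl (f (suc n)))

  ⊛-identityˡ : ∀ f → 𝟙 ⊛ f ≈ f
  ⊛-identityˡ f zero    = solve 1 (λ a → con 1ℚ :* a :+ con 0ℚ := a) refl (f 0)
  ⊛-identityˡ f (suc n) = trans (cong (1ℚ ℚ.* f (suc n) ℚ.+_) (⊛-zeroˡ f n))
    (solve 1 (λ a → con 1ℚ :* a :+ con 0ℚ := a) refl (f (suc n)))

series-isCommutativeRing : IsCommutativeRing _≈_ _⊕_ _⊛_ neg 𝟘 𝟙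
series-isCommutativeRing = record
  { isRing = record
    { +-isAbelianGroup = Pointwise.isAbelianGroup ℕ ℚₚ.+-0-isAbelianGroup
    ; *-cong = ⊛-cong
    ; *-assoc = ⊛-assoc
    ; *-identity = ⊛-identityˡ , λ f n → trans (⊛-comm f 𝟙 n) (⊛-identityˡ f n)
    ; distrib = (λ h f g n → trans (⊛-comm h (f ⊕ g) n) (trans (⊛-distribʳ h f g n)
                  (cong₂ ℚ._+_ (⊛-comm f h n) (⊛-comm g h n))))
              , ⊛-distribʳ
    }
  ; *-comm = ⊛-comm
  }

seriesRing : CommutativeRing 0ℓ 0ℓ
seriesRing = record { isCommutativeRing = series-isCommutativeRing }

module S = CommutativeRing seriesRing

const : ℚ → Series
const p = p • 𝟙

const-⊛ : ∀ p f → const p ⊛ f ≈ p • f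
const-⊛ p f n = trans (•-⊛ p 𝟙 f n) (cong (p ℚ.*_) (⊛-identityˡ f n))

const-* : ∀ p q → const (p ℚ.* q) ≈ const p ⊛ const q
const-* p q n = trans (ℚₚ.*-assoc p q (𝟙 n)) (sym (const-⊛ p (const q) n))

const-+ : ∀ p q → const (p ℚ.+ q) ≈ const p ⊕ const q
const-+ p q n = ℚₚ.*-distribʳ-+ (𝟙 n) p q

const-neg : ∀ p → const (ℚ.- p) ≈ neg (const p)
const-neg p n = sym (ℚₚ.neg-distribˡ-* p (𝟙 n))

-- θ = x d/dx
θ : Series → Series
θ f n = ℕ→ℚ n ℚ.* f n

fromℤ-+ : ∀ i j → ℚLit.fromℤ (i ℤ.+ j) ≡ ℚLit.fromℤ i ℚ.+ ℚLit.fromℤ j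
fromℤ-+ i j = ℚₚ.toℚᵘ-injective (ℚᵘₚ.≃-trans
  (ℚᵘ.*≡* (cong (ℤ._* + 1) (sym (cong₂ ℤ._+_ (ℤₚ.*-identityʳ i) (ℤₚ.*-identityʳ j)))))
  (ℚᵘₚ.≃-sym (ℚₚ.toℚᵘ-homo-+ (ℚLit.fromℤ i) (ℚLit.fromℤ j))))

fromℤ-* : ∀ i j → ℚLit.fromℤ (i ℤ.* j) ≡ ℚLit.fromℤ i ℚ.* ℚLit.fromℤ j
fromℤ-* i j = ℚₚ.toℚᵘ-injective (ℚᵘₚ.≃-trans (ℚᵘ.*≡* refl)
  (ℚᵘₚ.≃-sym (ℚₚ.toℚᵘ-homo-* (ℚLit.fromℤ i) (ℚLit.fromℤ j))))

ℕ→ℚ-+ : ∀ m n → ℕ→ℚ (m ℕ.+ n) ≡ ℕ→ℚ m ℚ.+ ℕ→ℚ n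
ℕ→ℚ-+ m n = fromℤ-+ (+ m) (+ n)

ℕ→ℚ-suc : ∀ n → ℕ→ℚ (suc n) ≡ 1ℚ ℚ.+ ℕ→ℚ n
ℕ→ℚ-suc = ℕ→ℚ-+ 1

θ-cong : ∀ {f h} → f ≈ h → θ f ≈ θ h
θ-cong p n = cong (ℕ→ℚ n ℚ.*_) (p n)

θ-⊕ : ∀ f h → θ (f ⊕ h) ≈ θ f ⊕ θ h
θ-⊕ f h n = ℚₚ.*-distribˡ-+ (ℕ→ℚ n) (f n) (h n)

θ-neg : ∀ f → θ (neg f) ≈ neg (θ f)
θ-neg f n = sym (ℚₚ.neg-distribʳ-* (ℕ→ℚ n) (f n))

θ-const : ∀ p → θ (const p) ≈ 𝟘
θ-const p zero    = ℚₚ.*-zeroˡ (const p 0)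
θ-const p (suc n) = trans (cong (ℕ→ℚ (suc n) ℚ.*_) (ℚₚ.*-zeroʳ p)) (ℚₚ.*-zeroʳ (ℕ→ℚ (suc n)))

module _ where
  open ≡-Reasoning
  open ℚSolver

  tail-θ : ∀ f → tail (θ f) ≈ tail f ⊕ θ (tail f)
  tail-θ f n = trans (cong (ℚ._* f (suc n)) (ℕ→ℚ-suc n))
    (solve 2 (λ m a → (con 1ℚ :+ m) :* a := a :+ m :* a) refl (ℕ→ℚ n) (f (suc n)))

  θ-⊛ : ∀ f h → θ (f ⊛ h) ≈ θ f ⊛ h ⊕ f ⊛ θ h
  θ-⊛ f h zero =
    solve 2 (λ a b → con 0ℚ :* (a :* b :+ con 0ℚ) :=
      ((con 0ℚ :* a) :* b :+ con 0ℚ) :+ (a :* (con 0ℚ :* b) :+ con 0ℚ)) refl (f 0) (h 0)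
  θ-⊛ f h (suc n) = begin
    ℕ→ℚ (suc n) ℚ.* (f 0 ℚ.* h (suc n) ℚ.+ (tail f ⊛ h) n)
      ≡⟨ solve 4 (λ m a b u → m :* (a :* b :+ u) := a :* (m :* b) :+ m :* u) refl (ℕ→ℚ (suc n)) (f 0) (h (suc n)) _ ⟩
    f 0 ℚ.* θ h (suc n) ℚ.+ ℕ→ℚ (suc n) ℚ.* (tail f ⊛ h) n
      ≡⟨ cong (f 0 ℚ.* θ h (suc n) ℚ.+_) (begin
           ℕ→ℚ (suc n) ℚ.* (tail f ⊛ h) n
             -- The anonymous series is x times `tail f ⊛ h`, so its coefficient at `suc n` carries
             -- the factor `suc n` and its tail is `tail f ⊛ h`.
             ≡⟨ tail-θ (λ { zero → 0ℚ ; (suc k) → (tail f ⊛ h) k }) n ⟩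
           (tail f ⊛ h) n ℚ.+ θ (tail f ⊛ h) n
             ≡⟨ cong ((tail f ⊛ h) n ℚ.+_) (θ-⊛ (tail f) h n) ⟩
           (tail f ⊛ h) n ℚ.+ ((θ (tail f) ⊛ h) n ℚ.+ (tail f ⊛ θ h) n)
             ≡⟨ ℚₚ.+-assoc ((tail f ⊛ h) n) _ _ ⟨
           (tail f ⊛ h) n ℚ.+ (θ (tail f) ⊛ h) n ℚ.+ (tail f ⊛ θ h) n
             ≡⟨ cong (ℚ._+ (tail f ⊛ θ h) n) (⊛-distribʳ h (tail f) (θ (tail f)) n) ⟨
           ((tail f ⊕ θ (tail f)) ⊛ h) n ℚ.+ (tail f ⊛ θ h) n
             ≡⟨ cong (ℚ._+ (tail f ⊛ θ h) n) (⊛-cong {h = h} (tail-θ f) (λ _ → refl) n) ⟨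
           (tail (θ f) ⊛ h) n ℚ.+ (tail f ⊛ θ h) n ∎) ⟩
    f 0 ℚ.* θ h (suc n) ℚ.+ ((tail (θ f) ⊛ h) n ℚ.+ (tail f ⊛ θ h) n)
      ≡⟨ solve 5 (λ a b c u v → a :* c :+ (u :+ v) := ((con 0ℚ :* a) :* b :+ u) :+ (a :* c :+ v))
           refl (f 0) (h (suc n)) (θ h (suc n)) _ _ ⟩
    (θ f ⊛ h ⊕ f ⊛ θ h) (suc n) ∎

  -- ℚ[[x]] is a domain; a nonzero coefficient of h is found at or before index n.
  ⊛-cancel-zero : ∀ n h f → h n ≢ 0ℚ → h ⊛ f ≈ 𝟘 → f ≈ 𝟘
  ⊛-cancel-zero n h f hn≢0 hf≈0 with h 0 ℚₚ.≟ 0ℚ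
  ⊛-cancel-zero zero h f hn≢0 hf≈0 | yes h0≡0 = contradiction h0≡0 hn≢0
  ⊛-cancel-zero (suc n) h f hn≢0 hf≈0 | yes h0≡0 = ⊛-cancel-zero n (tail h) f hn≢0 λ m → begin
    (tail h ⊛ f) m                               ≡⟨ ℚₚ.+-identityˡ ((tail h ⊛ f) m) ⟨
    0ℚ ℚ.+ (tail h ⊛ f) m                        ≡⟨ cong (ℚ._+ (tail h ⊛ f) m) (trans (cong (ℚ._* f (suc m)) h0≡0) (ℚₚ.*-zeroˡ (f (suc m)))) ⟨
    (h ⊛ f) (suc m)                              ≡⟨ hf≈0 (suc m) ⟩
    0ℚ                                           ∎
  ⊛-cancel-zero _ h f _ hf≈0 | no h0≢0 = λ n → upTo n n ℕₚ.≤-refl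
    where
    unit : ∀ {p} → h 0 ℚ.* p ≡ 0ℚ → p ≡ 0ℚ
    unit eq = *-cancelˡ-≢0 h0≢0 (trans eq (sym (ℚₚ.*-zeroʳ (h 0))))
    upTo : ∀ n m → m ℕ.≤ n → f m ≡ 0ℚ
    upTo n zero _ = unit (trans (sym (ℚₚ.+-identityʳ (h 0 ℚ.* f 0))) (hf≈0 0))
    upTo (suc n) (suc m) (s≤s m≤n) = unit (begin
      h 0 ℚ.* f (suc m)                              ≡⟨ ℚₚ.+-identityʳ (h 0 ℚ.* f (suc m)) ⟨
      h 0 ℚ.* f (suc m) ℚ.+ 0ℚ                       ≡⟨ cong (h 0 ℚ.* f (suc m) ℚ.+_) (begin
        (tail h ⊛ f) m  ≡⟨ ⊛-cong-≤ m {tail h} (λ _ _ → refl) (λ k k≤m → upTo n k (ℕₚ.≤-trans k≤m m≤n)) ⟩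
        (tail h ⊛ 𝟘) m  ≡⟨ ⊛-comm (tail h) 𝟘 m ⟩
        (𝟘 ⊛ tail h) m  ≡⟨ ⊛-zeroˡ (tail h) m ⟩
        0ℚ              ∎) ⟨
      (h ⊛ f) (suc m)                                ≡⟨ hf≈0 (suc m) ⟩
      0ℚ ∎)

-- Differential ℚ-algebras

-- The differential identities are formal consequences of these axioms. Over an abstract carrier the
-- solver sees sums and products as opaque operations and not as convolution sums; `seriesAlgebra`
-- is the instance to which they are applied.
record DifferentialAlgebra : Set₁ where
  field
    ring : CommutativeRing 0ℓ 0ℓ
  open CommutativeRing ring hiding (ring) renaming (_≈_ to _≋_) public
  field
    ι     : ℚ → Carrier
    ι-+   : ∀ p q → ι (p ℚ.+ q) ≋ ι p + ι q
    ι-*   : ∀ p q → ι (p ℚ.* q) ≋ ι p * ι q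
    ι-neg : ∀ p → ι (ℚ.- p) ≋ - ι p
    ι-0   : ι 0ℚ ≋ 0#
    ι-1   : ι 1ℚ ≋ 1#
    ∂     : Carrier → Carrier
    ∂-cong : ∀ {f h} → f ≋ h → ∂ f ≋ ∂ h
    ∂-+   : ∀ f h → ∂ (f + h) ≋ ∂ f + ∂ h
    ∂-*   : ∀ f h → ∂ (f * h) ≋ ∂ f * h + f * ∂ h
    ∂-neg : ∀ f → ∂ (- f) ≋ - ∂ f
    -- The right side is `ι 0ℚ` and not `0#`, to match `con 0ℚ` in the solver.
    ∂-ι   : ∀ p → ∂ (ι p) ≋ ι 0ℚ

module Calculus (A : DifferentialAlgebra) where
  open DifferentialAlgebra A renaming (refl to ≋-refl; sym to ≋-sym; trans to ≋-trans)
  open RingProperties (CommutativeRing.ring ring) using (x≈y⇒x∙y⁻¹≈ε; x∙y⁻¹≈ε⇒x≈y)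

  private
    morphism : CommutativeRing.rawRing ℚₚ.+-*-commutativeRing
               -Raw-AlmostCommutative⟶ fromCommutativeRing ring
    morphism = record
      { ⟦_⟧ = ι ; +-homo = ι-+ ; *-homo = ι-* ; -‿homo = ι-neg ; 0-homo = ι-0 ; 1-homo = ι-1 }

    ι-≟ : ∀ p q → Maybe (ι p ≋ ι q)
    ι-≟ p q with p ℚₚ.≟ q
    ... | yes refl = just ≋-refl
    ... | no  _    = nothing

  module Solver = RingSolver (CommutativeRing.rawRing ℚₚ.+-*-commutativeRing)
    (fromCommutativeRing ring) morphism ι-≟
  open Solver
  open import Relation.Binary.Reasoning.Setoid setoid

  num : ∀ {n} → ℕ → Polynomial n
  num k = con (ℕ→ℚ k)

  -- Differentiation by shape: a proof term built like the expression itself yields its derivative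
  -- by the sum and product rules, with `d` at the subterms that are left as `∂ f`.
  ∂[_+_] : ∀ {f h f′ h′} → ∂ f ≋ f′ → ∂ h ≋ h′ → ∂ (f + h) ≋ f′ + h′
  ∂[ p + q ] = ≋-trans (∂-+ _ _) (+-cong p q)

  ∂[_-_] : ∀ {f h f′ h′} → ∂ f ≋ f′ → ∂ h ≋ h′ → ∂ (f - h) ≋ f′ - h′
  ∂[ p - q ] = ∂[ p + ≋-trans (∂-neg _) (-‿cong q) ]

  ∂[_*_] : ∀ {f h f′ h′} → ∂ f ≋ f′ → ∂ h ≋ h′ → ∂ (f * h) ≋ f′ * h + f * h′
  ∂[ p * q ] = ≋-trans (∂-* _ _) (+-cong (*-congʳ p) (*-congˡ q))

  private
    d : ∀ {f} → ∂ f ≋ ∂ f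
    d = ≋-refl

  difference : ∀ {f h} → f ≋ h → f - h ≋ 0#
  difference = x≈y⇒x∙y⁻¹≈ε

  fromDifference : ∀ {f h} → f - h ≋ 0# → f ≋ h
  fromDifference = x∙y⁻¹≈ε⇒x≈y _ _

  -- Used in one pattern throughout: the difference of two sides is written as a combination of
  -- relations known to vanish, the solver checks that identity, and `multiple` and `_⊞_` dispose of
  -- the summands.
  multiple : ∀ f {z} → z ≋ 0# → f * z ≋ 0#
  multiple f p = ≋-trans (*-congˡ p) (zeroʳ f)

  infixl 5 _⊞_
  _⊞_ : ∀ {f h} → f ≋ 0# → h ≋ 0# → f + h ≋ 0#
  p ⊞ q = ≋-trans (+-cong p q) (+-identityˡ 0#)

  ∂-zero : ∀ {f} → f ≋ 0# → ∂ f ≋ 0#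
  ∂-zero p = ≋-trans (∂-cong (≋-trans p (≋-sym ι-0))) (≋-trans (∂-ι 0ℚ) ι-0)

  -- For D = √G ∂ these are D²F, (D³F - H DF - ½ (DH) F) / √G and 2 F D²F - (DF)² - H F².
  principal : Carrier → Carrier → Carrier
  principal G F = G * ∂ (∂ F) + ι ℚ.½ * ∂ G * ∂ F

  linear quadratic : Carrier → Carrier → Carrier → Carrier
  linear G H F = ∂ (principal G F) - H * ∂ F - ι ℚ.½ * ∂ H * F
  quadratic G H F = ι (ℕ→ℚ 2) * F * principal G F - G * (∂ F * ∂ F) - H * (F * F)

  -- The derivative of `G * (∂ F * ∂ F)` is `2 ∂F` times `principal G F`, which cancels the term
  -- where `∂` falls on the factor `F`. What is left has the common factor `2 F`.
  ∂-quadratic : ∀ G H F → ∂ (quadratic G H F) ≋ ι (ℕ→ℚ 2) * F * linear G H F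
  ∂-quadratic G H F = begin
    ∂ (quadratic G H F)
      ≈⟨ ∂[ ∂[ ∂[ ∂[ ∂-ι (ℕ→ℚ 2) * d ] * d ] - ∂[ d * ∂[ d * d ] ] ] - ∂[ d * ∂[ d * d ] ] ] ⟩
    _ ≈⟨ solve 8 (λ G G′ H H′ F F′ F″ P′ →
           ((con 0ℚ :* F :+ num 2 :* F′) :* (G :* F″ :+ con ℚ.½ :* G′ :* F′) :+ num 2 :* F :* P′)
             :- (G′ :* (F′ :* F′) :+ G :* (F″ :* F′ :+ F′ :* F″))
             :- (H′ :* (F :* F) :+ H :* (F′ :* F :+ F :* F′))
           := num 2 :* F :* (P′ :- H :* F′ :- con ℚ.½ :* H′ :* F))
           ≋-refl G (∂ G) H (∂ H) F (∂ F) (∂ (∂ F)) (∂ (principal G F)) ⟩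
    ι (ℕ→ℚ 2) * F * linear G H F ∎

  -- Pulling back the equation of level 1 along `y`

  discriminant : Carrier → Carrier
  discriminant y = ι 1ℚ - ι (ℕ→ℚ 1728) * y

  -- This is `principal` of level 1 after substitution of `y`: for G₁ = 1 - 1728 x one has ½ θG₁ = -
  -- 864 x.
  principal₁ : Carrier → Carrier → Carrier → Carrier
  principal₁ y φ₁ φ₂ = discriminant y * φ₂ - ι (ℕ→ℚ 864) * y * φ₁

  -- f, φ₁, φ₂ play the roles of F₁, θF₁, θ²F₁ composed with y.
  module Hypergeometric
    {y f φ₁ φ₂ : Carrier}
    (y∂f  : y * ∂ f ≋ ∂ y * φ₁)
    (y∂φ₁ : y * ∂ φ₁ ≋ ∂ y * φ₂)
    (y∂p  : y * ∂ (principal₁ y φ₁ φ₂) ≋ ∂ y * (y * (ι (ℕ→ℚ 240) * φ₁ + ι (ℕ→ℚ 120) * f)))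
    where

    private
      g₁ p : Carrier
      g₁ = discriminant y
      p  = principal₁ y φ₁ φ₂

    firstIntegral : Carrier
    firstIntegral = ι (ℕ→ℚ 2) * f * p - g₁ * (φ₁ * φ₁) - ι (ℕ→ℚ 240) * y * (f * f)

    -- The computation of `∂-quadratic`, carried through the chain rule. The hypotheses know the
    -- derivatives only after multiplication by `y`, so the conclusion has that factor too.
    ∂-firstIntegral : y * ∂ firstIntegral ≋ 0#
    ∂-firstIntegral = begin
      y * ∂ firstIntegral
        ≈⟨ *-congˡ ∂[ ∂[ ∂[ ∂[ ∂-ι (ℕ→ℚ 2) * d ] * d ]
                       - ∂[ ∂[ ∂-ι 1ℚ - ∂[ ∂-ι (ℕ→ℚ 1728) * d ] ] * ∂[ d * d ] ] ]
                    - ∂[ ∂[ ∂-ι (ℕ→ℚ 240) * d ] * ∂[ d * d ] ] ] ⟩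
      _ ≈⟨ solve 9 (λ y y′ f f′ φ₁ φ₁′ φ₂ p p′ →
             let g₁ = con 1ℚ :- num 1728 :* y in
             y :* ((con 0ℚ :* f :+ num 2 :* f′) :* p :+ num 2 :* f :* p′
                   :- ((con 0ℚ :- (con 0ℚ :* y :+ num 1728 :* y′)) :* (φ₁ :* φ₁)
                       :+ g₁ :* (φ₁′ :* φ₁ :+ φ₁ :* φ₁′))
                   :- ((con 0ℚ :* y :+ num 240 :* y′) :* (f :* f)
                       :+ num 240 :* y :* (f′ :* f :+ f :* f′)))
             := (num 2 :* p :- num 480 :* y :* f) :* (y :* f′ :- y′ :* φ₁)
                :+ (:- num 2 :* g₁ :* φ₁) :* (y :* φ₁′ :- y′ :* φ₂)
                :+ num 2 :* f :* (y :* p′ :- y′ :* (y :* (num 240 :* φ₁ :+ num 120 :* f)))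
                -- The solver takes `p` and `∂ p` as variables; this summand restores the definition
                -- of `p`.
                :+ num 2 :* y′ :* φ₁ :* (p :- (g₁ :* φ₂ :- num 864 :* y :* φ₁)))
             ≋-refl y (∂ y) f (∂ f) φ₁ (∂ φ₁) φ₂ p (∂ p) ⟩
      _ ≈⟨ multiple _ (difference y∂f) ⊞ multiple _ (difference y∂φ₁)
             ⊞ multiple _ (difference y∂p) ⊞ multiple _ (-‿inverseʳ p) ⟩
      0# ∎

    module Modular
      {G M : Carrier}
      (G∂y² : G * (∂ y * ∂ y) ≋ M * (y * y) * g₁)
      where

      -- The square of Df = √M (D₁F₁)(y), with D₁ the operator `D` of level 1. Squaring removes √G,
      -- √M and the root of `g₁` together.
      ∂f² : (y * y) * (G * (∂ f * ∂ f)) ≋ (y * y) * (M * g₁ * (φ₁ * φ₁))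
      ∂f² = fromDifference (begin
        (y * y) * (G * (∂ f * ∂ f)) - (y * y) * (M * g₁ * (φ₁ * φ₁))
          ≈⟨ solve 7 (λ y y′ f′ φ₁ G M g₁ →
               (y :* y) :* (G :* (f′ :* f′)) :- (y :* y) :* (M :* g₁ :* (φ₁ :* φ₁))
               := G :* (y :* f′ :+ y′ :* φ₁) :* (y :* f′ :- y′ :* φ₁)
                  :+ φ₁ :* φ₁ :* (G :* (y′ :* y′) :- M :* (y :* y) :* g₁))
               ≋-refl y (∂ y) (∂ f) φ₁ G M g₁ ⟩
        _ ≈⟨ multiple _ (difference y∂f) ⊞ multiple _ (difference G∂y²) ⟩
        0# ∎)

      -- Applying D to Df = √M (D₁F₁)(y) gives D²f = M p + G ∂M ∂f / (2 M), where the last term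
      -- comes from the derivative of √M. This is that equation multiplied by `M`.
      principalRelation : Carrier
      principalRelation = M * (G * ∂ (∂ f) + ι ℚ.½ * ∂ G * ∂ f) - M * M * p - ι ℚ.½ * ∂ M * G * ∂ f

      -- The certificate also uses the derivatives of `y∂f` and `G∂y²`. The factor `∂ y` is there
      -- because the derivative of `G∂y²` controls the second derivative of `y` only through the
      -- product `G * (∂ y * ∂ (∂ y))`.
      principalRelation-zero : (y * y * ∂ y) * principalRelation ≋ 0#
      principalRelation-zero = begin
        (y * y * ∂ y) * principalRelation
          ≈⟨ solve 12 (λ y y′ y″ f′ f″ φ₁ φ₁′ φ₂ G G′ M M′ →
               let g₁ = con 1ℚ :- num 1728 :* y
                   ½ = con ℚ.½ in
               (y :* y :* y′) :* (M :* (G :* f″ :+ ½ :* G′ :* f′)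
                  :- M :* M :* (g₁ :* φ₂ :- num 864 :* y :* φ₁) :- ½ :* M′ :* G :* f′)
               := (½ :* y :* y′ :* M :* G′ :- M :* G :* y′ :* y′ :- ½ :* M′ :* G :* y :* y′)
                     :* (y :* f′ :- y′ :* φ₁)
                  :+ (M :* G :* y′ :* y) :* ((y′ :* f′ :+ y :* f″) :- (y″ :* φ₁ :+ y′ :* φ₁′))
                  :+ (M :* G :* y′ :* y′) :* (y :* φ₁′ :- y′ :* φ₂)
                  :+ (M :* y′ :* (φ₂ :- φ₁) :- ½ :* M′ :* y :* φ₁)
                     :* (G :* (y′ :* y′) :- M :* (y :* y) :* g₁)
                  :+ (½ :* M :* y :* φ₁)
                     :* ((G′ :* (y′ :* y′) :+ G :* (y″ :* y′ :+ y′ :* y″))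
                         :- ((M′ :* (y :* y) :+ M :* (y′ :* y :+ y :* y′)) :* g₁
                             :+ M :* (y :* y) :* (con 0ℚ :- (con 0ℚ :* y :+ num 1728 :* y′)))))
               ≋-refl y (∂ y) (∂ (∂ y)) (∂ f) (∂ (∂ f)) φ₁ (∂ φ₁) φ₂ G (∂ G) M (∂ M) ⟩
        _ ≈⟨ multiple _ (difference y∂f)
             ⊞ multiple _ (difference (≋-trans (≋-sym ∂[ d * d ]) (≋-trans (∂-cong y∂f) ∂[ d * d ])))
             ⊞ multiple _ (difference y∂φ₁)
             ⊞ multiple _ (difference G∂y²)
             ⊞ multiple _ (difference (≋-trans (≋-sym ∂[ d * ∂[ d * d ] ]) (≋-trans (∂-cong G∂y²)
                 ∂[ ∂[ d * ∂[ d * d ] ] * ∂[ ∂-ι 1ℚ - ∂[ ∂-ι (ℕ→ℚ 1728) * d ] ] ]))) ⟩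
        0# ∎

      module Quotient
        {m F H : Carrier}
        (m² : m * m ≋ M)
        (mF : m * F ≋ f)
        (∂f²′ : G * (∂ f * ∂ f) ≋ M * g₁ * (φ₁ * φ₁))
        (E≋0 : firstIntegral ≋ 0#)
        (P≋0 : principalRelation ≋ 0#)
        (HM² : H * (M * M) + G * M * ∂ (∂ M) - ι (ℕ→ℚ 5) * ι ℚ.½ * ι ℚ.½ * G * (∂ M * ∂ M)
               + ι ℚ.½ * ∂ G * M * ∂ M ≋ ι (ℕ→ℚ 240) * y * (M * M * M))
        where

        private
          2mm′ : ∂ m * m + m * ∂ m ≋ ∂ M
          2mm′ = ≋-trans (≋-sym ∂[ d * d ]) (∂-cong m²)

          m′F : ∂ m * F + m * ∂ F ≋ ∂ f
          m′F = ≋-trans (≋-sym ∂[ d * d ]) (∂-cong mF)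

          -- From m′ = M′ / (2 m) follows m′ F = M′ f / (2 M), so the derivative of `m` can be
          -- eliminated from (m F)′ = f′.
          mF′ : ι (ℕ→ℚ 2) * M * (m * ∂ F) ≋ ι (ℕ→ℚ 2) * M * ∂ f - ∂ M * f
          mF′ = fromDifference (begin
            ι (ℕ→ℚ 2) * M * (m * ∂ F) - (ι (ℕ→ℚ 2) * M * ∂ f - ∂ M * f)
              ≈⟨ solve 8 (λ m m′ M M′ F F′ f f′ →
                   num 2 :* M :* (m :* F′) :- (num 2 :* M :* f′ :- M′ :* f)
                   := num 2 :* M :* (m′ :* F :+ m :* F′ :- f′)
                      :+ (:- M′) :* (m :* F :- f)
                      :+ num 2 :* m′ :* F :* (m :* m :- M)
                      :+ (:- (m :* F)) :* (m′ :* m :+ m :* m′ :- M′))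
                   ≋-refl m (∂ m) M (∂ M) F (∂ F) f (∂ f) ⟩
            _ ≈⟨ multiple _ (difference m′F) ⊞ multiple _ (difference mF)
                 ⊞ multiple _ (difference m²) ⊞ multiple _ (difference 2mm′) ⟩
            0# ∎)

          -- The second derivative of f M^(-½), multiplied by 4 M² m; the coefficients 3 and -2 are
          -- four times those of (M^(-½))″.
          mF″ : ι (ℕ→ℚ 4) * M * M * (m * ∂ (∂ F)) ≋
                ι (ℕ→ℚ 4) * M * M * ∂ (∂ f) - ι (ℕ→ℚ 4) * M * ∂ M * ∂ f
                - ι (ℕ→ℚ 2) * M * ∂ (∂ M) * f + ι (ℕ→ℚ 3) * ∂ M * ∂ M * f
          mF″ = fromDifference (begin
            _ ≈⟨ solve 10 (λ m m′ M M′ M″ F′ F″ f f′ f″ →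
                   num 4 :* M :* M :* (m :* F″)
                     :- (num 4 :* M :* M :* f″ :- num 4 :* M :* M′ :* f′
                         :- num 2 :* M :* M″ :* f :+ num 3 :* M′ :* M′ :* f)
                   := num 2 :* M :* ((con 0ℚ :* M :+ num 2 :* M′) :* (m :* F′)
                                     :+ num 2 :* M :* (m′ :* F′ :+ m :* F″)
                                     :- ((con 0ℚ :* M :+ num 2 :* M′) :* f′ :+ num 2 :* M :* f″
                                         :- (M″ :* f :+ M′ :* f′)))
                      :+ (:- num 3 :* M′) :* (num 2 :* M :* (m :* F′) :- (num 2 :* M :* f′ :- M′ :* f))
                      :+ (:- num 2 :* M :* F′ :* m) :* (m′ :* m :+ m :* m′ :- M′)
                      :+ num 4 :* M :* F′ :* m′ :* (m :* m :- M))
                   ≋-refl m (∂ m) M (∂ M) (∂ (∂ M)) (∂ F) (∂ (∂ F)) f (∂ f) (∂ (∂ f)) ⟩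
            _ ≈⟨ multiple _ (difference (≋-trans (≋-sym ∂[ ∂[ ∂-ι (ℕ→ℚ 2) * d ] * ∂[ d * d ] ])
                     (≋-trans (∂-cong mF′) ∂[ ∂[ ∂[ ∂-ι (ℕ→ℚ 2) * d ] * d ] - ∂[ d * d ] ])))
                 ⊞ multiple _ (difference mF′) ⊞ multiple _ (difference 2mm′)
                 ⊞ multiple _ (difference m²) ⟩
            0# ∎)

        -- Once F is replaced by f / m, the terms in f² without derivatives of f are -4 f² times the
        -- left side of `HM²`. Its 5/4 arises as 6 - 1 over 4, the 6 from F F″ and the 1 from F′².
        -- The right side 240 y M³ is absorbed by `firstIntegral`.
        quadratic-zero : ι (ℕ→ℚ 4) * (M * M) * (m * m) * quadratic G H F ≋ 0#
        quadratic-zero = begin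
          ι (ℕ→ℚ 4) * (M * M) * (m * m) * quadratic G H F
            ≈⟨ solve 8 (λ m M F F′ F″ G G′ H →
                 num 4 :* (M :* M) :* (m :* m)
                   :* (num 2 :* F :* (G :* F″ :+ con ℚ.½ :* G′ :* F′) :- G :* (F′ :* F′) :- H :* (F :* F))
                 := num 2 :* (m :* F) :* (G :* (num 4 :* M :* M :* (m :* F″))
                                          :+ G′ :* M :* (num 2 :* M :* (m :* F′)))
                    :- G :* ((num 2 :* M :* (m :* F′)) :* (num 2 :* M :* (m :* F′)))
                    :- num 4 :* M :* M :* H :* ((m :* F) :* (m :* F)))
                 ≋-refl m M F (∂ F) (∂ (∂ F)) G (∂ G) H ⟩
          _ ≈⟨ +-cong (+-cong (*-cong (*-congˡ mF) (+-cong (*-congˡ mF″) (*-congˡ mF′)))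
                              (-‿cong (*-congˡ (*-cong mF′ mF′))))
                      (-‿cong (*-congˡ (*-cong mF mF))) ⟩
          _ ≈⟨ solve 12 (λ y f f′ f″ φ₁ p G G′ H M M′ M″ →
                 let g₁ = con 1ℚ :- num 1728 :* y
                     ½ = con ℚ.½ in
                 num 2 :* f :* (G :* (num 4 :* M :* M :* f″ :- num 4 :* M :* M′ :* f′
                                      :- num 2 :* M :* M″ :* f :+ num 3 :* M′ :* M′ :* f)
                                :+ G′ :* M :* (num 2 :* M :* f′ :- M′ :* f))
                   :- G :* ((num 2 :* M :* f′ :- M′ :* f) :* (num 2 :* M :* f′ :- M′ :* f))
                   :- num 4 :* M :* M :* H :* (f :* f)
                 := num 8 :* M :* f
                      :* (M :* (G :* f″ :+ ½ :* G′ :* f′) :- M :* M :* p :- ½ :* M′ :* G :* f′)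
                    :+ (:- num 4 :* f :* f)
                      :* (H :* (M :* M) :+ G :* M :* M″ :- num 5 :* ½ :* ½ :* G :* (M′ :* M′)
                          :+ ½ :* G′ :* M :* M′ :- num 240 :* y :* (M :* M :* M))
                    :+ num 4 :* M :* M :* M
                      :* (num 2 :* f :* p :- g₁ :* (φ₁ :* φ₁) :- num 240 :* y :* (f :* f))
                    :+ (:- num 4 :* M :* M) :* (G :* (f′ :* f′) :- M :* g₁ :* (φ₁ :* φ₁)))
                 ≋-refl y f (∂ f) (∂ (∂ f)) φ₁ p G (∂ G) H M (∂ M) (∂ (∂ M)) ⟩
          _ ≈⟨ multiple _ P≋0 ⊞ multiple _ (difference HM²) ⊞ multiple _ E≋0
               ⊞ multiple _ (difference ∂f²′) ⟩
          0# ∎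

  -- Clearing denominators in the two identities

  private
    n : ℕ → Carrier
    n k = ι (ℕ→ℚ k)

  -- The denominators are 2 K³ in `y`, 2 g in the derivative of a square root of `g`, 2 in `M` and 4
  -- in `H`; every hypothesis is an equation with its denominator cleared. `M₁` and `M₂′` come from
  -- applying 2 g ∂ once and twice to `M′`, and `M₂` corrects for the derivative of the inner factor
  -- g.
  module Parametrisation
    {X N K K′ g g′ G G′ H M′ N₁ M₁ M₂′ H₄ y : Carrier}
    (∂X : ∂ X ≋ X) (∂K : ∂ K ≋ K′) (∂g : ∂ g ≋ g′)
    (2K³y : n 2 * (K * K * K) * y ≋ X * N)
    (∂N : n 2 * g * ∂ N ≋ N₁)
    (∂M′ : n 2 * g * ∂ M′ ≋ M₁)
    (∂M₁ : n 2 * g * ∂ M₁ ≋ M₂′)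
    (H₄≋ : n 4 * H ≋ H₄)
    where

    private
      L₂ M₂ M g₁ : Carrier
      L₂ = n 2 * g * (K * N - n 3 * K′ * N) + K * N₁
      M₂ = M₂′ - n 2 * g′ * M₁
      M = ι ℚ.½ * M′
      g₁ = discriminant y

      -- Logarithmic differentiation: ∂y / y = 1 + ∂N / N - 3 K′ / K.
      ∂y : n 4 * g * (K * K * K * K) * ∂ y ≋ X * L₂
      ∂y = fromDifference (begin
        _ ≈⟨ solve 9 (λ X N N′ N₁ K K′ g y y′ →
               num 4 :* g :* (K :* K :* K :* K) :* y′
                 :- X :* (num 2 :* g :* (K :* N :- num 3 :* K′ :* N) :+ K :* N₁)
               := num 2 :* g :* K :*
                    (((con 0ℚ :* (K :* K :* K) :+ num 2 :* ((K′ :* K :+ K :* K′) :* K :+ K :* K :* K′)) :* y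
                      :+ num 2 :* (K :* K :* K) :* y′) :- (X :* N :+ X :* N′))
                  :+ (:- num 6 :* g :* K′) :* (num 2 :* (K :* K :* K) :* y :- X :* N)
                  :+ K :* X :* (num 2 :* g :* N′ :- N₁))
               ≋-refl X N (∂ N) N₁ K K′ g y (∂ y) ⟩
        _ ≈⟨ multiple _ (difference (≋-trans
                 (≋-sym ∂[ ∂[ ∂-ι (ℕ→ℚ 2) * ∂[ ∂[ ∂K * ∂K ] * ∂K ] ] * d ])
                 (≋-trans (∂-cong 2K³y) ∂[ ∂X * d ])))
             ⊞ multiple _ (difference 2K³y) ⊞ multiple _ (difference ∂N) ⟩
        0# ∎)

      ∂M : ∂ M ≋ ι 0ℚ * M′ + ι ℚ.½ * ∂ M′
      ∂M = ∂[ ∂-ι ℚ.½ * d ]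

      ∂²M : ∂ (∂ M) ≋ ι 0ℚ * M′ + ι 0ℚ * ∂ M′ + (ι 0ℚ * ∂ M′ + ι ℚ.½ * ∂ (∂ M′))
      ∂²M = ≋-trans (∂-cong ∂M) ∂[ ∂[ ∂-ι 0ℚ * d ] + ∂[ ∂-ι ℚ.½ * d ] ]

      ∂²M′ : n 4 * (g * g) * ∂ (∂ M′) ≋ M₂
      ∂²M′ = fromDifference (begin
        _ ≈⟨ solve 7 (λ g g′ M′ M″ M₁ M₁′ M₂′ →
               num 4 :* (g :* g) :* M″ :- (M₂′ :- num 2 :* g′ :* M₁)
               := num 2 :* g :* ((con 0ℚ :* g :+ num 2 :* g′) :* M′ :+ num 2 :* g :* M″ :- M₁′)
                  :+ (num 2 :* g :* M₁′ :- M₂′)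
                  :+ (:- num 2 :* g′) :* (num 2 :* g :* M′ :- M₁))
               ≋-refl g g′ (∂ M′) (∂ (∂ M′)) M₁ (∂ M₁) M₂′ ⟩
        _ ≈⟨ multiple _ (difference (≋-trans (≋-sym ∂[ ∂[ ∂-ι (ℕ→ℚ 2) * ∂g ] * d ]) (∂-cong ∂M′)))
             ⊞ difference ∂M₁ ⊞ multiple _ (difference ∂M′) ⟩
        0# ∎)

    -- By `∂y`, 16 g² K⁸ clears (∂y)²; one more K is required since y² (1 - 1728 y) has K⁹ in the
    -- denominator. The constant 864 is 1728 / 2, from 2 K³ y = X N. After substitution X² is a
    -- common factor, and `relation` is what remains.
    G∂y²-multiple :
      n 2 * G * K * L₂ * L₂
        - n 4 * g * g * M′ * (N * N) * (K * K * K - n 864 * (X * N)) ≋ 0# →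
      n 32 * (g * g) * (K * K * K * K * K * K * K * K * K)
        * (G * (∂ y * ∂ y) - M * (y * y) * g₁) ≋ 0#
    G∂y²-multiple relation = begin
      _ ≈⟨ solve 6 (λ K g G M′ y y′ →
             num 32 :* (g :* g) :* (K :* K :* K :* K :* K :* K :* K :* K :* K)
               :* (G :* (y′ :* y′) :- con ℚ.½ :* M′ :* (y :* y) :* (con 1ℚ :- num 1728 :* y))
             := num 2 :* G :* K :* ((num 4 :* g :* (K :* K :* K :* K) :* y′) :* (num 4 :* g :* (K :* K :* K :* K) :* y′))
                :- num 4 :* g :* g :* M′ :* ((num 2 :* (K :* K :* K) :* y) :* (num 2 :* (K :* K :* K) :* y))
                   :* (K :* K :* K :- num 864 :* (num 2 :* (K :* K :* K) :* y)))
             ≋-refl K g G M′ y (∂ y) ⟩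
      _ ≈⟨ +-cong (*-congˡ (*-cong ∂y ∂y))
             (-‿cong (*-cong (*-congˡ (*-cong 2K³y 2K³y)) (+-congˡ (-‿cong (*-congˡ 2K³y))))) ⟩
      _ ≈⟨ solve 7 (λ X N K g G M′ L →
             num 2 :* G :* K :* (X :* L :* (X :* L))
               :- num 4 :* g :* g :* M′ :* (X :* N :* (X :* N)) :* (K :* K :* K :- num 864 :* (X :* N))
             := X :* X :* (num 2 :* G :* K :* L :* L
                 :- num 4 :* g :* g :* M′ :* (N :* N) :* (K :* K :* K :- num 864 :* (X :* N))))
             ≋-refl X N K g G M′ L₂ ⟩
      _ ≈⟨ multiple _ relation ⟩
      0# ∎

    -- Here g² pays for two derivatives of the root and K³ for `y`. The constant 960 is 64 · 240 /
    -- (2 · 8), with 8 from M³ = M′³ / 8 and 2 from 2 K³ y = X N.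
    HM²-multiple :
      K * K * K * (n 4 * g * g * H₄ * (M′ * M′) + n 4 * G * M′ * M₂ - n 5 * G * (M₁ * M₁)
                   + n 4 * G′ * g * M′ * M₁)
        - n 960 * g * g * (X * N) * (M′ * M′ * M′) ≋ 0# →
      n 64 * (g * g) * (K * K * K)
        * (H * (M * M) + G * M * ∂ (∂ M) - n 5 * ι ℚ.½ * ι ℚ.½ * G * (∂ M * ∂ M)
           + ι ℚ.½ * G′ * M * ∂ M - n 240 * y * (M * M * M)) ≋ 0#
    HM²-multiple relation = begin
      _ ≈⟨ *-congˡ (+-congʳ (+-cong (+-cong (+-congˡ (*-congˡ ∂²M)) (-‿cong (*-congˡ (*-cong ∂M ∂M)))) (*-congˡ ∂M))) ⟩
      _ ≈⟨ solve 9 (λ K g G G′ H M M′ M″ y →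
             let ½ = con ℚ.½ in
             num 64 :* (g :* g) :* (K :* K :* K)
               :* (H :* (½ :* M :* (½ :* M))
                   :+ G :* (½ :* M) :* (con 0ℚ :* M :+ con 0ℚ :* M′ :+ (con 0ℚ :* M′ :+ ½ :* M″))
                   :- num 5 :* ½ :* ½ :* G :* ((con 0ℚ :* M :+ ½ :* M′) :* (con 0ℚ :* M :+ ½ :* M′))
                   :+ ½ :* G′ :* (½ :* M) :* (con 0ℚ :* M :+ ½ :* M′)
                   :- num 240 :* y :* (½ :* M :* (½ :* M) :* (½ :* M)))
             := K :* K :* K :* (num 4 :* g :* g :* (num 4 :* H) :* (M :* M)
                   :+ num 4 :* G :* M :* (num 4 :* (g :* g) :* M″)
                   :- num 5 :* G :* ((num 2 :* g :* M′) :* (num 2 :* g :* M′))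
                   :+ num 4 :* G′ :* g :* M :* (num 2 :* g :* M′))
                :- num 960 :* g :* g :* (num 2 :* (K :* K :* K) :* y) :* (M :* M :* M))
             ≋-refl K g G G′ H M′ (∂ M′) (∂ (∂ M′)) y ⟩
      _ ≈⟨ +-cong (*-congˡ (+-cong (+-cong (+-cong (*-congʳ (*-congˡ H₄≋)) (*-congˡ ∂²M′))
                                            (-‿cong (*-congˡ (*-cong ∂M′ ∂M′)))) (*-congˡ ∂M′)))
                  (-‿cong (*-congʳ (*-congˡ 2K³y))) ⟩
      _ ≈⟨ relation ⟩
      0# ∎

const-zero : const 0ℚ ≈ 𝟘
const-zero n = ℚₚ.*-zeroˡ (𝟙 n)

const-one : const 1ℚ ≈ 𝟙
const-one n = ℚₚ.*-identityˡ (𝟙 n)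

seriesAlgebra : DifferentialAlgebra
seriesAlgebra = record
  { ring = seriesRing ; ι = const ; ι-+ = const-+ ; ι-* = const-* ; ι-neg = const-neg
  ; ι-0 = const-zero ; ι-1 = const-one
  ; ∂ = θ ; ∂-cong = θ-cong ; ∂-+ = θ-⊕ ; ∂-* = θ-⊛ ; ∂-neg = θ-neg
  ; ∂-ι = λ p n → trans (θ-const p n) (sym (const-zero n)) }

open Calculus seriesAlgebra

module SeriesReasoning where
  open import Relation.Binary.Reasoning.Setoid S.setoid public
  open Solver public using (_:=_; _:+_; _:*_; _:-_; :-_; con) renaming (solve to ⊛-solve)

*-zero₁ : ∀ {p} q → p ≡ 0ℚ → p ℚ.* q ≡ 0ℚ
*-zero₁ q refl = ℚₚ.*-zeroˡ q

⊛-vanish : ∀ {f} h n → (∀ k → k ℕ.≤ n → f k ≡ 0ℚ) → (h ⊛ f) n ≡ 0ℚ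
⊛-vanish {f} h n f≡0 = trans (⊛-cong-≤ n {h} (λ _ _ → refl) f≡0) (S.zeroʳ h n)

⊛-tail : ∀ y f → y 0 ≡ 0ℚ → ∀ n → (y ⊛ f) (suc n) ≡ (tail y ⊛ f) n
⊛-tail y f y₀ n = trans (cong (ℚ._+ (tail y ⊛ f) n) (*-zero₁ (f (suc n)) y₀)) (ℚₚ.+-identityˡ ((tail y ⊛ f) n))

⊛-head : ∀ f h → (f ⊛ h) 0 ≡ f 0 ℚ.* h 0
⊛-head f h = ℚₚ.+-identityʳ (f 0 ℚ.* h 0)

⊛-cancelˡ : ∀ n h {f f′} → h n ≢ 0ℚ → h ⊛ f ≈ h ⊛ f′ → f ≈ f′
⊛-cancelˡ n h {f} {f′} hn≢0 eq = fromDifference (⊛-cancel-zero n h (f ⊖ f′) hn≢0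
  (S.trans (⊛-solve 3 (λ h f f′ → h :* (f :- f′) := h :* f :- h :* f′) S.refl h f f′) (difference eq)))
  where open SeriesReasoning

-- Composition

-- The sum defining `_∘_` is cut off at a depth that varies with the coefficient. With a fixed depth
-- `N`, substitution becomes a recursion on the outer series.
horner : ℕ → Series → Series → Series
horner zero    f y = 𝟘
horner (suc N) f y = const (f 0) ⊕ y ⊛ horner N (tail f) y

⊛-sum : ∀ N y (c : ℕ → ℚ) (z : ℕ → Series) n →
        (y ⊛ (λ m → ∑[ k < N ] (c (Fin.toℕ k) ℚ.* z (Fin.toℕ k) m))) n ≡
        ∑[ k < N ] (c (Fin.toℕ k) ℚ.* (y ⊛ z (Fin.toℕ k)) n)
⊛-sum zero    y c z n = S.zeroʳ y n
⊛-sum (suc N) y c z n = begin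
  (y ⊛ (c 0 • z 0 ⊕ rest)) n                ≡⟨ S.distribˡ y (c 0 • z 0) rest n ⟩
  (y ⊛ (c 0 • z 0)) n ℚ.+ (y ⊛ rest) n      ≡⟨ cong₂ ℚ._+_ head (⊛-sum N y (λ k → c (suc k)) (λ k → z (suc k)) n) ⟩
  c 0 ℚ.* (y ⊛ z 0) n ℚ.+ ∑[ k < N ] (c (suc (Fin.toℕ k)) ℚ.* (y ⊛ z (suc (Fin.toℕ k))) n) ∎
  where
  open ≡-Reasoning
  rest : Series
  rest m = ∑[ k < N ] (c (suc (Fin.toℕ k)) ℚ.* z (suc (Fin.toℕ k)) m)
  head : (y ⊛ (c 0 • z 0)) n ≡ c 0 ℚ.* (y ⊛ z 0) n
  head = trans (⊛-comm y (c 0 • z 0) n) (trans (•-⊛ (c 0) (z 0) y n) (cong (c 0 ℚ.*_) (⊛-comm (z 0) y n)))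

sum-horner : ∀ N f y n → ∑[ k < N ] (f (Fin.toℕ k) ℚ.* (y ^ Fin.toℕ k) n) ≡ horner N f y n
sum-horner zero    f y n = refl
sum-horner (suc N) f y n = cong (f 0 ℚ.* 𝟙 n ℚ.+_) (trans
  (sym (⊛-sum N y (tail f) (y ^_) n))
  (⊛-cong {y} (λ _ → refl) (sum-horner N (tail f) y) n))

module _ (y : Series) (y₀ : y 0 ≡ 0ℚ) where

  -- Each level of nesting contributes a factor `y`, hence a power of x, so levels beyond `n` do not
  -- reach the coefficient of index `n`.
  horner-stable : ∀ N N′ f n → n ℕ.< N → n ℕ.< N′ → horner N f y n ≡ horner N′ f y n
  horner-stable (suc N) (suc N′) f zero _ _ =
    cong (const (f 0) 0 ℚ.+_) (trans (head N) (sym (head N′)))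
    where
    head : ∀ M → (y ⊛ horner M (tail f) y) 0 ≡ 0ℚ
    head M = trans (⊛-head y (horner M (tail f) y)) (*-zero₁ (horner M (tail f) y 0) y₀)
  horner-stable (suc N) (suc N′) f (suc n) (s≤s n<N) (s≤s n<N′) =
    cong (const (f 0) (suc n) ℚ.+_) (trans (⊛-tail y (horner N (tail f) y) y₀ n)
      (trans (⊛-cong-≤ n {tail y} (λ _ _ → refl) (λ k k≤n → horner-stable N N′ (tail f) k
               (ℕₚ.≤-<-trans k≤n n<N) (ℕₚ.≤-<-trans k≤n n<N′)))
             (sym (⊛-tail y (horner N′ (tail f) y) y₀ n))))

  -- Horner's rule without truncation. Combined with `contraction` it yields multiplicativity of
  -- composition and the chain rule.
  ∘-unfold : ∀ f → f ∘ y ≈ const (f 0) ⊕ y ⊛ (tail f ∘ y)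
  ∘-unfold f n = begin
    (f ∘ y) n                ≡⟨ sum-horner (suc n) f y n ⟩
    horner (suc n) f y n     ≡⟨ horner-stable (suc n) (suc (suc n)) f n ℕₚ.≤-refl (ℕₚ.n≤1+n (suc n)) ⟩
    const (f 0) n ℚ.+ (y ⊛ horner (suc n) (tail f) y) n
      ≡⟨ cong (const (f 0) n ℚ.+_) (⊛-cong-≤ n {y} (λ _ _ → refl) (λ k k≤n →
           trans (horner-stable (suc n) (suc k) (tail f) k (s≤s k≤n) ℕₚ.≤-refl)
                 (sym (sum-horner (suc k) (tail f) y k)))) ⟩
    const (f 0) n ℚ.+ (y ⊛ (tail f ∘ y)) n ∎
    where open ≡-Reasoning

  -- A defect that gains a factor y when f loses its constant term vanishes.
  contraction : (δ : Series → Series) → (∀ f → δ f ≈ y ⊛ δ (tail f)) → ∀ f → δ f ≈ 𝟘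
  contraction δ step f n = below (suc n) f n ℕₚ.≤-refl
    where
    below : ∀ N f n → n ℕ.< N → δ f n ≡ 0ℚ
    below (suc N) f zero    _         = trans (step f 0) (trans (⊛-head y (δ (tail f))) (*-zero₁ (δ (tail f) 0) y₀))
    below (suc N) f (suc n) (s≤s n<N) = trans (step f (suc n)) (trans (⊛-tail y (δ (tail f)) y₀ n)
      (⊛-vanish (tail y) n (λ k k≤n → below N (tail f) k (ℕₚ.≤-<-trans k≤n n<N))))

∘-cong : ∀ {f h} y → f ≈ h → f ∘ y ≈ h ∘ y
∘-cong y p n = sum-cong-≗ {suc n} λ k → cong (ℚ._* (y ^ Fin.toℕ k) n) (p (Fin.toℕ k))

∘-⊕ : ∀ f h y → (f ⊕ h) ∘ y ≈ f ∘ y ⊕ h ∘ y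
∘-⊕ f h y n = trans
  (sum-cong-≗ {suc n} λ k → ℚₚ.*-distribʳ-+ ((y ^ Fin.toℕ k) n) (f (Fin.toℕ k)) (h (Fin.toℕ k)))
  (∑-distrib-+ {suc n} (λ k → f (Fin.toℕ k) ℚ.* (y ^ Fin.toℕ k) n) (λ k → h (Fin.toℕ k) ℚ.* (y ^ Fin.toℕ k) n))

∘-• : ∀ p f y → (p • f) ∘ y ≈ p • (f ∘ y)
∘-• p f y n = trans
  (sum-cong-≗ {suc n} λ k → ℚₚ.*-assoc p (f (Fin.toℕ k)) ((y ^ Fin.toℕ k) n))
  (sym (*-distribˡ-sum {suc n} p (λ k → f (Fin.toℕ k) ℚ.* (y ^ Fin.toℕ k) n)))

∘-const-⊛ : ∀ p f y → (const p ⊛ f) ∘ y ≈ const p ⊛ (f ∘ y)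
∘-const-⊛ p f y = S.trans (∘-cong y (const-⊛ p f)) (S.trans (∘-• p f y) (S.sym (const-⊛ p (f ∘ y))))

x⊛-tail : ∀ f → tail (x^ 1 ⊛ f) ≈ f
x⊛-tail f n = trans (⊛-tail (x^ 1) f refl n) (⊛-identityˡ f n)

x⊛-head : ∀ f → (x^ 1 ⊛ f) 0 ≡ 0ℚ
x⊛-head f = trans (⊛-head (x^ 1) f) (ℚₚ.*-zeroˡ (f 0))

module _ (y : Series) (y₀ : y 0 ≡ 0ℚ) where
  open SeriesReasoning

  ∘-x⊛ : ∀ f → (x^ 1 ⊛ f) ∘ y ≈ y ⊛ (f ∘ y)
  ∘-x⊛ f = begin
    (x^ 1 ⊛ f) ∘ y
      ≈⟨ ∘-unfold y y₀ (x^ 1 ⊛ f) ⟩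
    const ((x^ 1 ⊛ f) 0) ⊕ y ⊛ (tail (x^ 1 ⊛ f) ∘ y)
      ≈⟨ S.+-cong (S.trans (S.reflexive (cong const (x⊛-head f))) const-zero) (S.*-congˡ {y} (∘-cong y (x⊛-tail f))) ⟩
    𝟘 ⊕ y ⊛ (f ∘ y)
      ≈⟨ S.+-identityˡ (y ⊛ (f ∘ y)) ⟩
    y ⊛ (f ∘ y) ∎

  ∘-⊛ : ∀ f h → (f ⊛ h) ∘ y ≈ (f ∘ y) ⊛ (h ∘ y)
  ∘-⊛ f h = fromDifference (contraction y y₀ δ step f)
    where
    δ : Series → Series
    δ f = (f ⊛ h) ∘ y ⊖ (f ∘ y) ⊛ (h ∘ y)
    step : ∀ f → δ f ≈ y ⊛ δ (tail f)
    step f = begin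
      δ f
        ≈⟨ S.+-cong (begin
             (f ⊛ h) ∘ y
               ≈⟨ ∘-unfold y y₀ (f ⊛ h) ⟩
             const ((f ⊛ h) 0) ⊕ y ⊛ ((f 0 • tail h ⊕ tail f ⊛ h) ∘ y)
               ≈⟨ S.+-cong (S.trans (S.reflexive (cong const (⊛-head f h))) (const-* (f 0) (h 0)))
                    (S.*-congˡ {y} (S.trans (∘-⊕ (f 0 • tail h) (tail f ⊛ h) y)
                      (S.+-congʳ {(tail f ⊛ h) ∘ y} (S.trans (∘-• (f 0) (tail h) y) (S.sym (const-⊛ (f 0) (tail h ∘ y))))))) ⟩
             const (f 0) ⊛ const (h 0) ⊕ y ⊛ (const (f 0) ⊛ (tail h ∘ y) ⊕ (tail f ⊛ h) ∘ y) ∎)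
           (S.-‿cong (S.*-congʳ {h ∘ y} (∘-unfold y y₀ f))) ⟩
      (const (f 0) ⊛ const (h 0) ⊕ y ⊛ (const (f 0) ⊛ (tail h ∘ y) ⊕ (tail f ⊛ h) ∘ y))
        ⊖ (const (f 0) ⊕ y ⊛ (tail f ∘ y)) ⊛ (h ∘ y)
        ≈⟨ ⊛-solve 7 (λ y f₀ h₀ th tfh tf h →
             (f₀ :* h₀ :+ y :* (f₀ :* th :+ tfh)) :- (f₀ :+ y :* tf) :* h
             := y :* (tfh :- tf :* h) :+ (:- f₀) :* (h :- (h₀ :+ y :* th)))
             S.refl y (const (f 0)) (const (h 0)) (tail h ∘ y) ((tail f ⊛ h) ∘ y) (tail f ∘ y) (h ∘ y) ⟩
      y ⊛ δ (tail f) ⊕ neg (const (f 0)) ⊛ (h ∘ y ⊖ (const (h 0) ⊕ y ⊛ (tail h ∘ y)))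
        ≈⟨ S.+-congˡ {y ⊛ δ (tail f)} (multiple (neg (const (f 0))) (difference (∘-unfold y y₀ h))) ⟩
      y ⊛ δ (tail f) ⊕ 𝟘
        ≈⟨ S.+-identityʳ (y ⊛ δ (tail f)) ⟩
      y ⊛ δ (tail f) ∎

  -- For θ = x d/dx the logarithmic form θ(f ∘ y) = (θy / y) (θf ∘ y) is the natural one; it is
  -- multiplied by `y`, which has no inverse.
  chain-rule : ∀ f → y ⊛ θ (f ∘ y) ≈ θ y ⊛ (θ f ∘ y)
  chain-rule f = fromDifference (contraction y y₀ δ step f)
    where
    δ : Series → Series
    δ f = y ⊛ θ (f ∘ y) ⊖ θ y ⊛ (θ f ∘ y)
    step : ∀ f → δ f ≈ y ⊛ δ (tail f)
    step f = begin
      δ f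
        ≈⟨ S.+-cong (S.*-congˡ {y} (S.trans (θ-cong (∘-unfold y y₀ f))
             (S.trans (θ-⊕ (const (f 0)) (y ⊛ (tail f ∘ y)))
                  (S.+-cong (DifferentialAlgebra.∂-ι seriesAlgebra (f 0)) (θ-⊛ y (tail f ∘ y))))))
             (S.-‿cong (S.*-congˡ {θ y} (begin
               θ f ∘ y ≈⟨ ∘-unfold y y₀ (θ f) ⟩
               const (0ℚ ℚ.* f 0) ⊕ y ⊛ (tail (θ f) ∘ y)
                 ≈⟨ S.+-cong (S.reflexive (cong const (ℚₚ.*-zeroˡ (f 0)))) (S.*-congˡ {y}
                      (S.trans (∘-cong y (tail-θ f)) (∘-⊕ (tail f) (θ (tail f)) y))) ⟩
               const 0ℚ ⊕ y ⊛ (tail f ∘ y ⊕ θ (tail f) ∘ y) ∎))) ⟩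
      y ⊛ (const 0ℚ ⊕ (θ y ⊛ (tail f ∘ y) ⊕ y ⊛ θ (tail f ∘ y)))
        ⊖ θ y ⊛ (const 0ℚ ⊕ y ⊛ (tail f ∘ y ⊕ θ (tail f) ∘ y))
        ≈⟨ ⊛-solve 5 (λ y y′ φ φ′ ψ →
             y :* (con 0ℚ :+ (y′ :* φ :+ y :* φ′)) :- y′ :* (con 0ℚ :+ y :* (φ :+ ψ))
             := y :* (y :* φ′ :- y′ :* ψ)) S.refl y (θ y) (tail f ∘ y) (θ (tail f ∘ y)) (θ (tail f) ∘ y) ⟩
      y ⊛ δ (tail f) ∎

-- The recurrence as a differential equation

½*ℕ→ℚ : ∀ j → (+ j) ℚ./ 2 ≡ ℚ.½ ℚ.* ℕ→ℚ j
½*ℕ→ℚ j = ℚₚ.toℚᵘ-injective (ℚᵘₚ.≃-trans (ℚₚ.toℚᵘ-fromℚᵘ (ℚᵘ.mkℚᵘ (+ j) 1))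
  (ℚᵘₚ.≃-trans (ℚᵘ.*≡* (cong (ℤ._* + 2) (sym (ℤₚ.*-identityˡ (+ j)))))
               (ℚᵘₚ.≃-sym (ℚₚ.toℚᵘ-homo-* ℚ.½ (ℕ→ℚ j)))))

ℕ→ℚ-* : ∀ m n → ℕ→ℚ (m ℕ.* n) ≡ ℕ→ℚ m ℚ.* ℕ→ℚ n
ℕ→ℚ-* m n = trans (cong ℚLit.fromℤ (ℤₚ.pos-* m n)) (fromℤ-* (+ m) (+ n))

module _ (G H f : Series) where
  open ≡-Reasoning
  open ℚSolver

  private
    linearTerm : ℚ → ℚ → ℚ → ℚ → ℚ → ℚ → ℚ
    linearTerm N i w g h t =
      N ℚ.* (g ℚ.* (w ℚ.* (w ℚ.* t)) ℚ.+ ℚ.½ ℚ.* (i ℚ.* g) ℚ.* (w ℚ.* t))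
        ℚ.- h ℚ.* (w ℚ.* t) ℚ.- ℚ.½ ℚ.* (i ℚ.* h) ℚ.* t

    coefficientTerm : ℚ → ℚ → ℚ → ℚ → ℚ → ℚ → ℚ
    coefficientTerm N i w g h t = ℚ.- ((N ℚ.- ℚ.½ ℚ.* i) ℚ.* (h ℚ.- N ℚ.* w ℚ.* g) ℚ.* t)

    linear-coefficient : ∀ n → linear G H f n ≡
      ∑[ i < suc n ] linearTerm (ℕ→ℚ n) (ℕ→ℚ (Fin.toℕ i)) (ℕ→ℚ (n ∸ Fin.toℕ i))
                       (G (Fin.toℕ i)) (H (Fin.toℕ i)) (f (n ∸ Fin.toℕ i))
    linear-coefficient n = begin
      linear G H f n
        ≡⟨ cong₂ (λ u v → N ℚ.* ((G ⊛ θ (θ f)) n ℚ.+ u) ℚ.- (H ⊛ θ f) n ℚ.- v)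
             (⊛-cong {h = θ f} (const-⊛ ℚ.½ (θ G)) (λ _ → refl) n)
             (⊛-cong {h = f} (const-⊛ ℚ.½ (θ H)) (λ _ → refl) n) ⟩
      N ℚ.* (sum A ℚ.+ sum B) ℚ.- sum C ℚ.- sum D
        ≡⟨ solve 5 (λ N a b c d → N :* (a :+ b) :- c :- d := (N :* (a :+ b) :+ con (ℚ.- 1ℚ) :* c) :+ con (ℚ.- 1ℚ) :* d)
             refl N (sum A) (sum B) (sum C) (sum D) ⟩
      N ℚ.* (sum A ℚ.+ sum B) ℚ.+ ℚ.- 1ℚ ℚ.* sum C ℚ.+ ℚ.- 1ℚ ℚ.* sum D
        ≡⟨ cong₂ ℚ._+_ (cong₂ ℚ._+_ (trans (cong (N ℚ.*_) (sym (∑-distrib-+ A B)))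
             (*-distribˡ-sum N (λ i → A i ℚ.+ B i))) (*-distribˡ-sum (ℚ.- 1ℚ) C)) (*-distribˡ-sum (ℚ.- 1ℚ) D) ⟩
      sum (λ i → N ℚ.* (A i ℚ.+ B i)) ℚ.+ sum (λ i → ℚ.- 1ℚ ℚ.* C i) ℚ.+ sum (λ i → ℚ.- 1ℚ ℚ.* D i)
        ≡⟨ cong (ℚ._+ sum (λ i → ℚ.- 1ℚ ℚ.* D i)) (∑-distrib-+ (λ i → N ℚ.* (A i ℚ.+ B i)) (λ i → ℚ.- 1ℚ ℚ.* C i)) ⟨
      sum (λ i → N ℚ.* (A i ℚ.+ B i) ℚ.+ ℚ.- 1ℚ ℚ.* C i) ℚ.+ sum (λ i → ℚ.- 1ℚ ℚ.* D i)
        ≡⟨ ∑-distrib-+ (λ i → N ℚ.* (A i ℚ.+ B i) ℚ.+ ℚ.- 1ℚ ℚ.* C i) (λ i → ℚ.- 1ℚ ℚ.* D i) ⟨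
      sum (λ i → N ℚ.* (A i ℚ.+ B i) ℚ.+ ℚ.- 1ℚ ℚ.* C i ℚ.+ ℚ.- 1ℚ ℚ.* D i)
        ≡⟨ sum-cong-≗ (λ i → solve 5 (λ N a b c d → (N :* (a :+ b) :+ con (ℚ.- 1ℚ) :* c) :+ con (ℚ.- 1ℚ) :* d := N :* (a :+ b) :- c :- d)
             refl N (A i) (B i) (C i) (D i)) ⟩
      sum (λ i → N ℚ.* (A i ℚ.+ B i) ℚ.- C i ℚ.- D i) ∎
      where
      N : ℚ
      N = ℕ→ℚ n
      sum : (Fin (suc n) → ℚ) → ℚ
      sum t = ∑[ i < suc n ] t i
      A B C D : Fin (suc n) → ℚ
      A i = G (Fin.toℕ i) ℚ.* θ (θ f) (n ∸ Fin.toℕ i)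
      B i = ℚ.½ ℚ.* θ G (Fin.toℕ i) ℚ.* θ f (n ∸ Fin.toℕ i)
      C i = H (Fin.toℕ i) ℚ.* θ f (n ∸ Fin.toℕ i)
      D i = ℚ.½ ℚ.* θ H (Fin.toℕ i) ℚ.* f (n ∸ Fin.toℕ i)

    -- The factor N - i/2 of the recurrence originates here: both the `g` and the `h` part contain w
    -- + i/2, and this equals N - i/2 when N = i + w.
    linearTerm≡ : ∀ {N} i w g h t → N ≡ i ℚ.+ w → linearTerm N i w g h t ≡ coefficientTerm N i w g h t
    linearTerm≡ i w g h t refl = solve 5 (λ i w g h t →
      let N = i :+ w in
      N :* (g :* (w :* (w :* t)) :+ con ℚ.½ :* (i :* g) :* (w :* t))
        :- h :* (w :* t) :- con ℚ.½ :* (i :* h) :* t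
      := :- ((N :- con ℚ.½ :* i) :* (h :- N :* w :* g) :* t)) refl i w g h t

  linear-zero : linear G H f 0 ≡ 0ℚ
  linear-zero = trans (linear-coefficient 0) (solve 3 (λ g h t →
    (con 0ℚ :* (g :* (con 0ℚ :* (con 0ℚ :* t)) :+ con ℚ.½ :* (con 0ℚ :* g) :* (con 0ℚ :* t))
        :- h :* (con 0ℚ :* t) :- con ℚ.½ :* (con 0ℚ :* h) :* t) :+ con 0ℚ
    := con 0ℚ) refl (G 0) (H 0) (f 0))

  -- Since `G 0` is 1 and `H 0` is 0, the summand of index 0 in `linear-coefficient` is (n + 1)³
  -- `f (suc n)`. The others are the terms of the recurrence with opposite sign.
  linear-suc : G 0 ≡ 1ℚ → H 0 ≡ 0ℚ → ∀ n → linear G H f (suc n) ≡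
    ℕ→ℚ (Recurrence.cube G H n) ℚ.* f (suc n)
      ℚ.- ∑[ i < suc n ] (Recurrence.coefficient G H n (suc (Fin.toℕ i)) ℚ.* f (n ∸ Fin.toℕ i))
  linear-suc G₀ H₀ n = begin
    linear G H f (suc n)
      ≡⟨ linear-coefficient (suc n) ⟩
    linearTerm N 0ℚ N (G 0) (H 0) (f (suc n)) ℚ.+ ∑[ i < suc n ] (linearTerm N (ℕ→ℚ (suc (Fin.toℕ i)))
        (ℕ→ℚ (n ∸ Fin.toℕ i)) (G (suc (Fin.toℕ i))) (H (suc (Fin.toℕ i))) (f (n ∸ Fin.toℕ i)))
      ≡⟨ cong₂ ℚ._+_ head (sum-cong-≗ {suc n} term) ⟩
    C ℚ.* f (suc n) ℚ.+ ∑[ i < suc n ] (ℚ.- 1ℚ ℚ.* A i)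
      ≡⟨ cong (C ℚ.* f (suc n) ℚ.+_) (*-distribˡ-sum (ℚ.- 1ℚ) A) ⟨
    C ℚ.* f (suc n) ℚ.+ ℚ.- 1ℚ ℚ.* ∑[ i < suc n ] A i
      ≡⟨ solve 2 (λ c s → c :+ con (ℚ.- 1ℚ) :* s := c :- s) refl (C ℚ.* f (suc n)) (∑[ i < suc n ] A i) ⟩
    C ℚ.* f (suc n) ℚ.- ∑[ i < suc n ] A i ∎
    where
    N C : ℚ
    N = ℕ→ℚ (suc n)
    C = ℕ→ℚ (Recurrence.cube G H n)
    A : Fin (suc n) → ℚ
    A i = Recurrence.coefficient G H n (suc (Fin.toℕ i)) ℚ.* f (n ∸ Fin.toℕ i)
    head : linearTerm N 0ℚ N (G 0) (H 0) (f (suc n)) ≡ C ℚ.* f (suc n)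
    head = begin
      linearTerm N 0ℚ N (G 0) (H 0) (f (suc n))
        ≡⟨ cong₂ (λ g h → linearTerm N 0ℚ N g h (f (suc n))) G₀ H₀ ⟩
      linearTerm N 0ℚ N 1ℚ 0ℚ (f (suc n))
        ≡⟨ solve 2 (λ N t → N :* (con 1ℚ :* (N :* (N :* t)) :+ con ℚ.½ :* (con 0ℚ :* con 1ℚ) :* (N :* t))
             :- con 0ℚ :* (N :* t) :- con ℚ.½ :* (con 0ℚ :* con 0ℚ) :* t := N :* N :* N :* t) refl N (f (suc n)) ⟩
      N ℚ.* N ℚ.* N ℚ.* f (suc n)
        ≡⟨ cong (ℚ._* f (suc n)) (trans (ℕ→ℚ-* (suc n ℕ.* suc n) (suc n)) (cong (ℚ._* N) (ℕ→ℚ-* (suc n) (suc n)))) ⟨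
      C ℚ.* f (suc n) ∎
    term : ∀ i → linearTerm N (ℕ→ℚ (suc (Fin.toℕ i))) (ℕ→ℚ (n ∸ Fin.toℕ i))
                   (G (suc (Fin.toℕ i))) (H (suc (Fin.toℕ i))) (f (n ∸ Fin.toℕ i)) ≡ ℚ.- 1ℚ ℚ.* A i
    term i = begin
      linearTerm N j w g h t
        ≡⟨ linearTerm≡ j w g h t (trans (cong ℕ→ℚ (sym (ℕₚ.m+[n∸m]≡n {suc (Fin.toℕ i)} {suc n} (Finₚ.toℕ<n i))))
             (ℕ→ℚ-+ (suc (Fin.toℕ i)) (n ∸ Fin.toℕ i))) ⟩
      coefficientTerm N j w g h t
        ≡⟨ solve 6 (λ N j w g h t → :- ((N :- j) :* (h :- N :* w :* g) :* t)
             := con (ℚ.- 1ℚ) :* ((N :- j) :* (h :- N :* w :* g) :* t)) refl N (ℚ.½ ℚ.* j) w g h t ⟩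
      ℚ.- 1ℚ ℚ.* ((N ℚ.- ℚ.½ ℚ.* j) ℚ.* (h ℚ.- N ℚ.* w ℚ.* g) ℚ.* t)
        ≡⟨ cong (λ z → ℚ.- 1ℚ ℚ.* ((N ℚ.- z) ℚ.* (h ℚ.- N ℚ.* w ℚ.* g) ℚ.* t)) (½*ℕ→ℚ (suc (Fin.toℕ i))) ⟨
      ℚ.- 1ℚ ℚ.* A i ∎
      where
      j w g h t : ℚ
      j = ℕ→ℚ (suc (Fin.toℕ i))
      w = ℕ→ℚ (n ∸ Fin.toℕ i)
      g = G (suc (Fin.toℕ i))
      h = H (suc (Fin.toℕ i))
      t = f (n ∸ Fin.toℕ i)

module _ (G H : Series) (G₀ : G 0 ≡ 1ℚ) (H₀ : H 0 ≡ 0ℚ) where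
  open Recurrence G H

  linear-T : linear G H T ≈ 𝟘
  linear-T zero    = linear-zero G H T
  linear-T (suc n) = trans (linear-suc G H T G₀ H₀ n)
    (trans (cong (ℚ._- S) (T-suc n)) (ℚₚ.+-inverseʳ S))
    where
    S : ℚ
    S = ∑[ i < suc n ] (coefficient n (suc (Fin.toℕ i)) ℚ.* T (n ∸ Fin.toℕ i))

  linear-unique : ∀ f → f 0 ≡ 1ℚ → linear G H f ≈ 𝟘 → f ≈ T
  linear-unique f f₀ Lf n = below (suc n) n ℕₚ.≤-refl
    where
    below : ∀ N n → n ℕ.< N → f n ≡ T n
    below (suc N) zero    _         = f₀
    below (suc N) (suc n) (s≤s n<N) = *-cancelˡ-≢0 {ℕ→ℚ (cube n)} (λ ()) (begin
      ℕ→ℚ (cube n) ℚ.* f (suc n)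
        ≡⟨ x∙y⁻¹≈ε⇒x≈y (ℕ→ℚ (cube n) ℚ.* f (suc n)) S (trans (sym (linear-suc G H f G₀ H₀ n)) (Lf (suc n))) ⟩
      S ≡⟨ sum-cong-≗ {suc n} (λ i → cong (coefficient n (suc (Fin.toℕ i)) ℚ.*_)
             (below N (n ∸ Fin.toℕ i) (ℕₚ.≤-<-trans (ℕₚ.m∸n≤m n (Fin.toℕ i)) n<N))) ⟩
      ∑[ i < suc n ] (coefficient n (suc (Fin.toℕ i)) ℚ.* T (n ∸ Fin.toℕ i))
        ≡⟨ T-suc n ⟨
      ℕ→ℚ (cube n) ℚ.* T (suc n) ∎)
      where
      open ≡-Reasoning
      open RingProperties (CommutativeRing.ring ℚₚ.+-*-commutativeRing) using (x∙y⁻¹≈ε⇒x≈y)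
      S : ℚ
      S = ∑[ i < suc n ] (coefficient n (suc (Fin.toℕ i)) ℚ.* f (n ∸ Fin.toℕ i))

-- Inverses and square roots

module _ (h : Series) (h₀ : h 0 ≢ 0ℚ) where
  private
    instance
      h₀-nonZero : ℚ.NonZero (h 0)
      h₀-nonZero = ℚ.≢-nonZero h₀
    ones u : Series
    ones _ = 1ℚ
    u = 𝟙 ⊖ const (ℚ.1/ h 0) ⊛ h
    u₀ : u 0 ≡ 0ℚ
    u₀ = trans (cong (λ z → 1ℚ ℚ.- z) (trans (const-⊛ (ℚ.1/ h 0) h 0) (ℚₚ.*-inverseˡ (h 0)))) refl

  -- the geometric series in u = 1 - h / h(0)
  inverse : Series
  inverse = const (ℚ.1/ h 0) ⊛ (ones ∘ u)

  inverseˡ : inverse ⊛ h ≈ 𝟙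
  inverseˡ = begin
    const (ℚ.1/ h 0) ⊛ (ones ∘ u) ⊛ h
      -- The solver takes `𝟙` as a variable `i`, distinct from `con 1ℚ`; the last summand makes up
      -- for the difference.
      ≈⟨ ⊛-solve 4 (λ c g h i → c :* g :* h := i :+ (g :- (i :+ (i :- c :* h) :* g)) :+ (i :- con 1ℚ) :* g)
           S.refl (const (ℚ.1/ h 0)) (ones ∘ u) h 𝟙 ⟩
    _ ≈⟨ S.+-cong (S.+-congˡ {𝟙} (difference unfolded)) (S.trans (S.*-comm (𝟙 ⊖ const 1ℚ) (ones ∘ u))
           (multiple (ones ∘ u) (difference (S.sym const-one)))) ⟩
    𝟙 ⊕ 𝟘 ⊕ 𝟘
      ≈⟨ S.trans (S.+-identityʳ (𝟙 ⊕ 𝟘)) (S.+-identityʳ 𝟙) ⟩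
    𝟙 ∎
    where
    open SeriesReasoning
    unfolded : ones ∘ u ≈ 𝟙 ⊕ u ⊛ (ones ∘ u)
    unfolded = S.trans (∘-unfold u u₀ ones) (S.+-congʳ {u ⊛ (ones ∘ u)} const-one)

-- the binomial series (1 + x)^½
binomial : Series
binomial zero    = 1ℚ
binomial (suc n) = ℚ.1/ ℕ→ℚ (suc n) ℚ.* ((ℚ.½ ℚ.- ℕ→ℚ n) ℚ.* binomial n)

binomial-step : ∀ n → ℕ→ℚ (suc n) ℚ.* binomial (suc n) ≡ (ℚ.½ ℚ.- ℕ→ℚ n) ℚ.* binomial n
binomial-step n = trans (sym (ℚₚ.*-assoc N (ℚ.1/ N) r)) (trans (cong (ℚ._* r) (ℚₚ.*-inverseʳ N)) (ℚₚ.*-identityˡ r))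
  where
  N r : ℚ
  N = ℕ→ℚ (suc n)
  r = (ℚ.½ ℚ.- ℕ→ℚ n) ℚ.* binomial n

θ-binomial : (𝟙 ⊕ x^ 1) ⊛ θ binomial ≈ const ℚ.½ ⊛ x^ 1 ⊛ binomial
θ-binomial n = trans (⊛-distribʳ (θ binomial) 𝟙 (x^ 1) n) (trans (cong (ℚ._+ (x^ 1 ⊛ θ binomial) n) (⊛-identityˡ (θ binomial) n))
  (trans (coefficients n) (sym (trans (⊛-assoc (const ℚ.½) (x^ 1) binomial n) (const-⊛ ℚ.½ (x^ 1 ⊛ binomial) n)))))
  where
  coefficients : ∀ n → θ binomial n ℚ.+ (x^ 1 ⊛ θ binomial) n ≡ ℚ.½ ℚ.* (x^ 1 ⊛ binomial) n
  coefficients zero = refl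
  coefficients (suc n) = begin
    θ binomial (suc n) ℚ.+ (x^ 1 ⊛ θ binomial) (suc n)
      ≡⟨ cong₂ ℚ._+_ (binomial-step n) (x⊛-tail (θ binomial) n) ⟩
    (ℚ.½ ℚ.- ℕ→ℚ n) ℚ.* binomial n ℚ.+ ℕ→ℚ n ℚ.* binomial n
      ≡⟨ solve 2 (λ n b → (con ℚ.½ :- n) :* b :+ n :* b := con ℚ.½ :* b) refl (ℕ→ℚ n) (binomial n) ⟩
    ℚ.½ ℚ.* binomial n
      ≡⟨ cong (ℚ.½ ℚ.*_) (x⊛-tail binomial n) ⟨
    ℚ.½ ℚ.* (x^ 1 ⊛ binomial) (suc n) ∎
    where
    open ≡-Reasoning
    open ℚSolver

-- A solution of (1 + x) θ c = x c is determined by c(0), as it satisfies (n + 1) cₙ₊₁ = (1 - n) cₙ.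
binomial² : binomial ⊛ binomial ≈ 𝟙 ⊕ x^ 1
binomial² = λ { zero → refl ; (suc zero) → refl ; (suc (suc n)) → trans (vanish n) refl }
  where
  X b b² : Series
  X  = x^ 1
  b  = binomial
  b² = binomial ⊛ binomial
  equation : (𝟙 ⊕ X) ⊛ θ b² ≈ X ⊛ b²
  equation = begin
    (𝟙 ⊕ X) ⊛ θ b²
      ≈⟨ S.*-congˡ {𝟙 ⊕ X} (θ-⊛ b b) ⟩
    (𝟙 ⊕ X) ⊛ (θ b ⊛ b ⊕ b ⊛ θ b)
      ≈⟨ ⊛-solve 4 (λ i X b b′ → (i :+ X) :* (b′ :* b :+ b :* b′) :=
           (con (ℕ→ℚ 2) :* b) :* ((i :+ X) :* b′ :- con ℚ.½ :* X :* b) :+ X :* (b :* b))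
           S.refl 𝟙 X b (θ b) ⟩
    (const (ℕ→ℚ 2) ⊛ b) ⊛ ((𝟙 ⊕ X) ⊛ θ b ⊖ const ℚ.½ ⊛ X ⊛ b) ⊕ X ⊛ b²
      ≈⟨ S.+-congʳ {X ⊛ b²} (multiple (const (ℕ→ℚ 2) ⊛ b) (difference θ-binomial)) ⟩
    𝟘 ⊕ X ⊛ b²
      ≈⟨ S.+-identityˡ (X ⊛ b²) ⟩
    X ⊛ b² ∎
    where open SeriesReasoning
  step : ∀ n → ℕ→ℚ (suc n) ℚ.* b² (suc n) ℚ.+ ℕ→ℚ n ℚ.* b² n ≡ b² n
  step n = ≡.begin
    θ b² (suc n) ℚ.+ θ b² n                      ≡.≡⟨ cong₂ ℚ._+_ (⊛-identityˡ (θ b²) (suc n)) (x⊛-tail (θ b²) n) ⟨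
    (𝟙 ⊛ θ b²) (suc n) ℚ.+ (X ⊛ θ b²) (suc n)    ≡.≡⟨ ⊛-distribʳ (θ b²) 𝟙 X (suc n) ⟨
    ((𝟙 ⊕ X) ⊛ θ b²) (suc n)                     ≡.≡⟨ equation (suc n) ⟩
    (X ⊛ b²) (suc n)                             ≡.≡⟨ x⊛-tail b² n ⟩
    b² n ≡.∎
    where module ≡ = ≡-Reasoning
  vanish : ∀ n → b² (suc (suc n)) ≡ 0ℚ
  vanish n = *-cancelˡ-≢0 {ℕ→ℚ (suc (suc n))} (λ ()) (≡.begin
    ℕ→ℚ (suc (suc n)) ℚ.* b² (suc (suc n))
      ≡.≡⟨ solve 3 (λ u v w → u := (u :+ v :* w) :- v :* w) refl (ℕ→ℚ (suc (suc n)) ℚ.* b² (suc (suc n))) (ℕ→ℚ (suc n)) (b² (suc n)) ⟩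
    (ℕ→ℚ (suc (suc n)) ℚ.* b² (suc (suc n)) ℚ.+ ℕ→ℚ (suc n) ℚ.* b² (suc n)) ℚ.- ℕ→ℚ (suc n) ℚ.* b² (suc n)
      ≡.≡⟨ cong (ℚ._- ℕ→ℚ (suc n) ℚ.* b² (suc n)) (step (suc n)) ⟩
    b² (suc n) ℚ.- ℕ→ℚ (suc n) ℚ.* b² (suc n)
      ≡.≡⟨ cong (λ z → b² (suc n) ℚ.- z ℚ.* b² (suc n)) (ℕ→ℚ-suc n) ⟩
    b² (suc n) ℚ.- (1ℚ ℚ.+ ℕ→ℚ n) ℚ.* b² (suc n)
      ≡.≡⟨ solve 2 (λ n b → b :- (con 1ℚ :+ n) :* b := :- n :* b) refl (ℕ→ℚ n) (b² (suc n)) ⟩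
    ℚ.- ℕ→ℚ n ℚ.* b² (suc n)
      ≡.≡⟨ tailVanish n ⟩
    0ℚ
      ≡.≡⟨ ℚₚ.*-zeroʳ (ℕ→ℚ (suc (suc n))) ⟨
    ℕ→ℚ (suc (suc n)) ℚ.* 0ℚ ≡.∎)
    where
    module ≡ = ≡-Reasoning
    open ℚSolver
    tailVanish : ∀ n → ℚ.- ℕ→ℚ n ℚ.* b² (suc n) ≡ 0ℚ
    -- Consecutive coefficients have ratio - n / (n + 2), which is 0 at n = 0, so the square stops
    -- after its linear term.
    tailVanish zero    = refl
    tailVanish (suc n) = trans (cong (ℚ.- ℕ→ℚ (suc n) ℚ.*_) (vanish n)) (ℚₚ.*-zeroʳ (ℚ.- ℕ→ℚ (suc n)))

module _ (f : Series) (r : ℚ) (r≢0 : r ≢ 0ℚ) (f₀ : f 0 ≡ r ℚ.* r) where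
  private
    instance
      r-nonZero : ℚ.NonZero r
      r-nonZero = ℚ.≢-nonZero r≢0
    u : Series
    u = const (ℚ.1/ r ℚ.* ℚ.1/ r) ⊛ f ⊖ 𝟙
    r⁻²r² : ℚ.1/ r ℚ.* ℚ.1/ r ℚ.* (r ℚ.* r) ≡ 1ℚ
    r⁻²r² = begin
      ℚ.1/ r ℚ.* ℚ.1/ r ℚ.* (r ℚ.* r)   ≡⟨ solve 2 (λ i r → i :* i :* (r :* r) := (i :* r) :* (i :* r)) refl (ℚ.1/ r) r ⟩
      ℚ.1/ r ℚ.* r ℚ.* (ℚ.1/ r ℚ.* r)   ≡⟨ cong₂ ℚ._*_ (ℚₚ.*-inverseˡ r) (ℚₚ.*-inverseˡ r) ⟩
      1ℚ                                ∎
      where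
      open ≡-Reasoning
      open ℚSolver
    u₀ : u 0 ≡ 0ℚ
    u₀ = trans (cong (ℚ._- 1ℚ) (trans (const-⊛ (ℚ.1/ r ℚ.* ℚ.1/ r) f 0)
           (trans (cong (ℚ.1/ r ℚ.* ℚ.1/ r ℚ.*_) f₀) r⁻²r²))) refl

  -- As f(0) = r², one has f = r² (1 + u) with u(0) = 0, and the binomial series can be evaluated at
  -- `u`. The choice of `r` selects the branch.
  squareRoot : Series
  squareRoot = const r ⊛ (binomial ∘ u)

  squareRoot-head : squareRoot 0 ≡ r
  squareRoot-head = trans (const-⊛ r (binomial ∘ u) 0) (ℚₚ.*-identityʳ r)

  squareRoot² : squareRoot ⊛ squareRoot ≈ f
  squareRoot² = begin
    const r ⊛ B ⊛ (const r ⊛ B)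
      ≈⟨ ⊛-solve 2 (λ r b → r :* b :* (r :* b) := r :* r :* (b :* b)) S.refl (const r) B ⟩
    const r ⊛ const r ⊛ (B ⊛ B)
      ≈⟨ S.*-congˡ {const r ⊛ const r} (begin
           B ⊛ B                              ≈⟨ ∘-⊛ u u₀ binomial binomial ⟨
           (binomial ⊛ binomial) ∘ u          ≈⟨ ∘-cong u binomial² ⟩
           (𝟙 ⊕ x^ 1) ∘ u                     ≈⟨ ∘-unfold u u₀ (𝟙 ⊕ x^ 1) ⟩
           const 1ℚ ⊕ u ⊛ (tail (𝟙 ⊕ x^ 1) ∘ u)
             ≈⟨ S.+-cong const-one (S.*-congˡ {u} (S.trans (∘-cong u (λ n → ℚₚ.+-identityˡ (𝟙 n))) (S.trans (∘-unfold u u₀ 𝟙)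
                  (S.trans (S.+-cong const-one (S.trans (S.*-congˡ {u} (∘-zero u)) (S.zeroʳ u))) (S.+-identityʳ 𝟙))))) ⟩
           𝟙 ⊕ u ⊛ 𝟙                          ≈⟨ S.+-congˡ {𝟙} (S.*-identityʳ u) ⟩
           𝟙 ⊕ u                              ≈⟨ ⊛-solve 3 (λ i c f → i :+ (c :* f :- i) := c :* f) S.refl 𝟙 C f ⟩
           C ⊛ f                              ∎) ⟩
    const r ⊛ const r ⊛ (C ⊛ f)
      ≈⟨ ⊛-solve 3 (λ r c f → r :* r :* (c :* f) := (c :* (r :* r)) :* f) S.refl (const r) C f ⟩
    C ⊛ (const r ⊛ const r) ⊛ f
      ≈⟨ S.*-congʳ {f} (begin
           C ⊛ (const r ⊛ const r)                ≈⟨ S.*-congˡ {C} (const-* r r) ⟨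
           C ⊛ const (r ℚ.* r)                    ≈⟨ const-* (ℚ.1/ r ℚ.* ℚ.1/ r) (r ℚ.* r) ⟨
           const (ℚ.1/ r ℚ.* ℚ.1/ r ℚ.* (r ℚ.* r)) ≈⟨ S.reflexive (cong const r⁻²r²) ⟩
           const 1ℚ                               ≈⟨ const-one ⟩
           𝟙                                      ∎) ⟩
    𝟙 ⊛ f
      ≈⟨ ⊛-identityˡ f ⟩
    f ∎
    where
    open SeriesReasoning
    B C : Series
    B = binomial ∘ u
    C = const (ℚ.1/ r ℚ.* ℚ.1/ r)
    ∘-zero : ∀ y → 𝟘 ∘ y ≈ 𝟘
    ∘-zero y = S.trans (∘-cong y (λ n → sym (ℚₚ.*-zeroˡ (𝟘 n)))) (S.trans (∘-• 0ℚ 𝟘 y) (λ n → ℚₚ.*-zeroˡ ((𝟘 ∘ y) n)))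

-- Transformations of F₁

module _ where
  open SeriesReasoning

  θ-scale : ∀ c f → θ (const c ⊛ f) ≈ const c ⊛ θ f
  θ-scale c f = begin
    θ (const c ⊛ f)                   ≈⟨ θ-⊛ (const c) f ⟩
    θ (const c) ⊛ f ⊕ const c ⊛ θ f   ≈⟨ S.+-congʳ {const c ⊛ θ f} (S.trans (S.*-congʳ {f} (θ-const c)) (S.zeroˡ f)) ⟩
    𝟘 ⊕ const c ⊛ θ f                 ≈⟨ S.+-identityˡ (const c ⊛ θ f) ⟩
    const c ⊛ θ f                     ∎

  linear-scale : ∀ c G H F → linear G H (const c ⊛ F) ≈ const c ⊛ linear G H F
  linear-scale c G H F = begin
    linear G H (k ⊛ F)
      ≈⟨ S.+-cong (S.+-cong (S.trans (θ-cong principal-scale) (θ-scale c (principal G F)))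
                             (S.-‿cong (S.*-congˡ {H} (θ-scale c F))))
                   (S.refl {neg (const ℚ.½ ⊛ θ H ⊛ (k ⊛ F))}) ⟩
    _ ≈⟨ ⊛-solve 6 (λ k H H′ F F′ P → k :* P :- H :* (k :* F′) :- con ℚ.½ :* H′ :* (k :* F)
           := k :* (P :- H :* F′ :- con ℚ.½ :* H′ :* F)) S.refl k H (θ H) F (θ F) (θ (principal G F)) ⟩
    k ⊛ linear G H F ∎
    where
    k : Series
    k = const c
    principal-scale : principal G (k ⊛ F) ≈ k ⊛ principal G F
    principal-scale = begin
      principal G (k ⊛ F)
        ≈⟨ S.+-cong (S.*-congˡ {G} (S.trans (θ-cong (θ-scale c F)) (θ-scale c (θ F))))
                    (S.*-congˡ {const ℚ.½ ⊛ θ G} (θ-scale c F)) ⟩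
      _ ≈⟨ ⊛-solve 5 (λ k G G′ F′ F″ → G :* (k :* F″) :+ con ℚ.½ :* G′ :* (k :* F′)
             := k :* (G :* F″ :+ con ℚ.½ :* G′ :* F′)) S.refl k G (θ G) (θ F) (θ (θ F)) ⟩
      k ⊛ principal G F ∎

  -- By `∂-quadratic` the derivative of `quadratic G H F` is `linear G H F` times 2 F, a factor that
  -- can be cancelled.
  linear⇐quadratic : ∀ {G H F} → F 0 ≢ 0ℚ → quadratic G H F ≈ 𝟘 → linear G H F ≈ 𝟘
  linear⇐quadratic {G} {H} {F} F₀ Q≈0 =
    ⊛-cancel-zero 0 F (linear G H F) F₀
      (⊛-cancel-zero 0 (const (ℕ→ℚ 2)) (F ⊛ linear G H F) (λ ()) (begin
        const (ℕ→ℚ 2) ⊛ (F ⊛ linear G H F) ≈⟨ S.*-assoc (const (ℕ→ℚ 2)) F (linear G H F) ⟨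
        const (ℕ→ℚ 2) ⊛ F ⊛ linear G H F   ≈⟨ ∂-quadratic G H F ⟨
        θ (quadratic G H F)                ≈⟨ ∂-zero Q≈0 ⟩
        𝟘                                  ∎))

*-≢0 : ∀ {p q} → p ≢ 0ℚ → q ≢ 0ℚ → p ℚ.* q ≢ 0ℚ
*-≢0 {p} p≢0 q≢0 pq≡0 = q≢0 (*-cancelˡ-≢0 p≢0 (trans pq≡0 (sym (ℚₚ.*-zeroʳ p))))

⊛-head-≢0 : ∀ f h → f 0 ≢ 0ℚ → h 0 ≢ 0ℚ → (f ⊛ h) 0 ≢ 0ℚ
⊛-head-≢0 f h f₀ h₀ eq = *-≢0 f₀ h₀ (trans (sym (⊛-head f h)) eq)

⊛-head-zeroˡ : ∀ f h → f 0 ≡ 0ℚ → (f ⊛ h) 0 ≡ 0ℚ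
⊛-head-zeroˡ f h f₀ = trans (⊛-head f h) (*-zero₁ (h 0) f₀)

⊛-head-zeroʳ : ∀ f h → h 0 ≡ 0ℚ → (f ⊛ h) 0 ≡ 0ℚ
⊛-head-zeroʳ f h h₀ = trans (⊛-comm f h 0) (⊛-head-zeroˡ h f h₀)

θ-zero⇒ : ∀ {f} → f 0 ≡ 0ℚ → θ f ≈ 𝟘 → f ≈ 𝟘
θ-zero⇒ f₀ θf≈0 zero    = f₀
θ-zero⇒ f₀ θf≈0 (suc n) = *-cancelˡ-≢0 {ℕ→ℚ (suc n)} (λ ()) (trans (θf≈0 (suc n)) (sym (ℚₚ.*-zeroʳ (ℕ→ℚ (suc n)))))

∘-head : ∀ f y → (f ∘ y) 0 ≡ f 0
∘-head f y = trans (ℚₚ.+-identityʳ (f 0 ℚ.* 1ℚ)) (ℚₚ.*-identityʳ (f 0))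

private
  G₁ H₁ P₁ : Series
  G₁ = ⟦ ℕ→ℚ 1 ∷ ℚ.- ℕ→ℚ 1728 ∷ [] ⟧
  H₁ = ⟦ 0ℚ ∷ ℕ→ℚ 240 ∷ [] ⟧
  P₁ = principal G₁ F₁

G₁-linear : G₁ ≈ 𝟙 ⊕ const (ℚ.- ℕ→ℚ 1728) ⊛ x^ 1
G₁-linear n = trans (coefficients n) (cong (𝟙 n ℚ.+_) (sym (const-⊛ (ℚ.- ℕ→ℚ 1728) (x^ 1) n)))
  where
  coefficients : G₁ ≈ 𝟙 ⊕ (ℚ.- ℕ→ℚ 1728) • x^ 1
  coefficients zero          = refl
  coefficients (suc zero)    = refl
  coefficients (suc (suc n)) = refl

θG₁-linear : θ G₁ ≈ const (ℚ.- ℕ→ℚ 1728) ⊛ x^ 1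
θG₁-linear n = trans (coefficients n) (sym (const-⊛ (ℚ.- ℕ→ℚ 1728) (x^ 1) n))
  where
  coefficients : θ G₁ ≈ (ℚ.- ℕ→ℚ 1728) • x^ 1
  coefficients zero          = refl
  coefficients (suc zero)    = refl
  coefficients (suc (suc n)) = ℚₚ.*-zeroʳ (ℕ→ℚ (suc (suc n)))

H₁-linear : H₁ ≈ const (ℕ→ℚ 240) ⊛ x^ 1
H₁-linear n = trans (coefficients n) (sym (const-⊛ (ℕ→ℚ 240) (x^ 1) n))
  where
  coefficients : H₁ ≈ ℕ→ℚ 240 • x^ 1
  coefficients zero          = refl
  coefficients (suc zero)    = refl
  coefficients (suc (suc n)) = refl

θH₁-linear : θ H₁ ≈ const (ℕ→ℚ 240) ⊛ x^ 1
θH₁-linear n = trans (coefficients n) (sym (const-⊛ (ℕ→ℚ 240) (x^ 1) n))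
  where
  coefficients : θ H₁ ≈ ℕ→ℚ 240 • x^ 1
  coefficients zero          = refl
  coefficients (suc zero)    = refl
  coefficients (suc (suc n)) = ℚₚ.*-zeroʳ (ℕ→ℚ (suc (suc n)))

module _ where
  open SeriesReasoning

  -- Besides the bare `θ (θ F₁)` only multiples of some `x^ 1 ⊛ f` are left, the form in which
  -- `∘-x⊛` substitutes `y`.
  P₁-expand : P₁ ≈ θ (θ F₁) ⊕ const (ℚ.- ℕ→ℚ 1728) ⊛ (x^ 1 ⊛ θ (θ F₁)) ⊕ const (ℚ.- ℕ→ℚ 864) ⊛ (x^ 1 ⊛ θ F₁)
  P₁-expand = begin
    P₁ ≈⟨ S.+-cong (S.*-congʳ {θ (θ F₁)} (S.trans G₁-linear (S.+-congʳ {const (ℚ.- ℕ→ℚ 1728) ⊛ x^ 1} (S.sym const-one))))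
                   (S.*-congʳ {θ F₁} (S.*-congˡ {const ℚ.½} θG₁-linear)) ⟩
    _ ≈⟨ ⊛-solve 3 (λ X F′ F″ → (con 1ℚ :+ con (ℚ.- ℕ→ℚ 1728) :* X) :* F″ :+ con ℚ.½ :* (con (ℚ.- ℕ→ℚ 1728) :* X) :* F′
           := F″ :+ con (ℚ.- ℕ→ℚ 1728) :* (X :* F″) :+ con (ℚ.- ℕ→ℚ 864) :* (X :* F′))
           S.refl (x^ 1) (θ F₁) (θ (θ F₁)) ⟩
    _ ∎

  θP₁ : θ P₁ ≈ x^ 1 ⊛ (const (ℕ→ℚ 240) ⊛ θ F₁ ⊕ const (ℕ→ℚ 120) ⊛ F₁)
  θP₁ = begin
    θ P₁
      ≈⟨ ⊛-solve 3 (λ P a b → P := (P :- a :- b) :+ (a :+ b)) S.refl (θ P₁) (H₁ ⊛ θ F₁) (const ℚ.½ ⊛ θ H₁ ⊛ F₁) ⟩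
    linear G₁ H₁ F₁ ⊕ (H₁ ⊛ θ F₁ ⊕ const ℚ.½ ⊛ θ H₁ ⊛ F₁)
      ≈⟨ S.+-cong (linear-T G₁ H₁ refl refl)
           (S.+-cong (S.*-congʳ {θ F₁} H₁-linear) (S.*-congʳ {F₁} (S.*-congˡ {const ℚ.½} θH₁-linear))) ⟩
    𝟘 ⊕ (const (ℕ→ℚ 240) ⊛ x^ 1 ⊛ θ F₁ ⊕ const ℚ.½ ⊛ (const (ℕ→ℚ 240) ⊛ x^ 1) ⊛ F₁)
      ≈⟨ S.+-identityˡ (const (ℕ→ℚ 240) ⊛ x^ 1 ⊛ θ F₁ ⊕ const ℚ.½ ⊛ (const (ℕ→ℚ 240) ⊛ x^ 1) ⊛ F₁) ⟩
    const (ℕ→ℚ 240) ⊛ x^ 1 ⊛ θ F₁ ⊕ const ℚ.½ ⊛ (const (ℕ→ℚ 240) ⊛ x^ 1) ⊛ F₁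
      ≈⟨ ⊛-solve 3 (λ X F F′ → con (ℕ→ℚ 240) :* X :* F′ :+ con ℚ.½ :* (con (ℕ→ℚ 240) :* X) :* F
           := X :* (con (ℕ→ℚ 240) :* F′ :+ con (ℕ→ℚ 120) :* F)) S.refl (x^ 1) F₁ (θ F₁) ⟩
    x^ 1 ⊛ (const (ℕ→ℚ 240) ⊛ θ F₁ ⊕ const (ℕ→ℚ 120) ⊛ F₁) ∎

-- The index `suc k` witnesses that `y` is not zero. Being positive, it witnesses the same for
-- `θ y`, and both are cancelled below.
module Transformation
  (G H y M m : Series)
  (G₀ : G 0 ≡ 1ℚ) (H₀ : H 0 ≡ 0ℚ)
  (y₀ : y 0 ≡ 0ℚ) (k : ℕ) (yₖ : y (suc k) ≢ 0ℚ)
  (m² : m ⊛ m ≈ M) (m₀ : m 0 ≢ 0ℚ)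
  (G∂y² : G ⊛ (θ y ⊛ θ y) ≈ M ⊛ (y ⊛ y) ⊛ (const 1ℚ ⊖ const (ℕ→ℚ 1728) ⊛ y))
  (HM² : H ⊛ (M ⊛ M) ⊕ G ⊛ M ⊛ θ (θ M) ⊖ const (ℕ→ℚ 5) ⊛ const ℚ.½ ⊛ const ℚ.½ ⊛ G ⊛ (θ M ⊛ θ M)
         ⊕ const ℚ.½ ⊛ θ G ⊛ M ⊛ θ M ≈ const (ℕ→ℚ 240) ⊛ y ⊛ (M ⊛ M ⊛ M))
  where

  open SeriesReasoning

  private
    f φ₁ φ₂ g₁ p : Series
    f  = F₁ ∘ y
    φ₁ = θ F₁ ∘ y
    φ₂ = θ (θ F₁) ∘ y
    g₁ = const 1ℚ ⊖ const (ℕ→ℚ 1728) ⊛ y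
    p  = g₁ ⊛ φ₂ ⊖ const (ℕ→ℚ 864) ⊛ y ⊛ φ₁

    P₁∘y : P₁ ∘ y ≈ p
    P₁∘y = begin
      P₁ ∘ y
        ≈⟨ ∘-cong y P₁-expand ⟩
      (θ (θ F₁) ⊕ a ⊛ (x^ 1 ⊛ θ (θ F₁)) ⊕ b ⊛ (x^ 1 ⊛ θ F₁)) ∘ y
        ≈⟨ ∘-⊕ (θ (θ F₁) ⊕ a ⊛ (x^ 1 ⊛ θ (θ F₁))) (b ⊛ (x^ 1 ⊛ θ F₁)) y ⟩
      (θ (θ F₁) ⊕ a ⊛ (x^ 1 ⊛ θ (θ F₁))) ∘ y ⊕ (b ⊛ (x^ 1 ⊛ θ F₁)) ∘ y
        ≈⟨ S.+-cong (S.trans (∘-⊕ (θ (θ F₁)) (a ⊛ (x^ 1 ⊛ θ (θ F₁))) y)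
                       (S.+-congˡ {φ₂} (S.trans (∘-const-⊛ (ℚ.- ℕ→ℚ 1728) (x^ 1 ⊛ θ (θ F₁)) y) (S.*-congˡ {a} (∘-x⊛ y y₀ (θ (θ F₁)))))))
                     (S.trans (∘-const-⊛ (ℚ.- ℕ→ℚ 864) (x^ 1 ⊛ θ F₁) y) (S.*-congˡ {b} (∘-x⊛ y y₀ (θ F₁)))) ⟩
      φ₂ ⊕ a ⊛ (y ⊛ φ₂) ⊕ b ⊛ (y ⊛ φ₁)
        ≈⟨ ⊛-solve 3 (λ y φ₁ φ₂ → φ₂ :+ con (ℚ.- ℕ→ℚ 1728) :* (y :* φ₂) :+ con (ℚ.- ℕ→ℚ 864) :* (y :* φ₁)
             := (con 1ℚ :- con (ℕ→ℚ 1728) :* y) :* φ₂ :- con (ℕ→ℚ 864) :* y :* φ₁) S.refl y φ₁ φ₂ ⟩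
      p ∎
      where
      a b : Series
      a = const (ℚ.- ℕ→ℚ 1728)
      b = const (ℚ.- ℕ→ℚ 864)

    y∂p : y ⊛ θ p ≈ θ y ⊛ (y ⊛ (const (ℕ→ℚ 240) ⊛ φ₁ ⊕ const (ℕ→ℚ 120) ⊛ f))
    y∂p = begin
      y ⊛ θ p              ≈⟨ S.*-congˡ {y} (θ-cong P₁∘y) ⟨
      y ⊛ θ (P₁ ∘ y)       ≈⟨ chain-rule y y₀ P₁ ⟩
      θ y ⊛ (θ P₁ ∘ y)     ≈⟨ S.*-congˡ {θ y} (begin
        θ P₁ ∘ y             ≈⟨ ∘-cong y θP₁ ⟩
        (x^ 1 ⊛ (const (ℕ→ℚ 240) ⊛ θ F₁ ⊕ const (ℕ→ℚ 120) ⊛ F₁)) ∘ y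
          ≈⟨ ∘-x⊛ y y₀ (const (ℕ→ℚ 240) ⊛ θ F₁ ⊕ const (ℕ→ℚ 120) ⊛ F₁) ⟩
        y ⊛ ((const (ℕ→ℚ 240) ⊛ θ F₁ ⊕ const (ℕ→ℚ 120) ⊛ F₁) ∘ y)
          ≈⟨ S.*-congˡ {y} (S.trans (∘-⊕ (const (ℕ→ℚ 240) ⊛ θ F₁) (const (ℕ→ℚ 120) ⊛ F₁) y)
               (S.+-cong (∘-const-⊛ (ℕ→ℚ 240) (θ F₁) y) (∘-const-⊛ (ℕ→ℚ 120) F₁ y))) ⟩
        y ⊛ (const (ℕ→ℚ 240) ⊛ φ₁ ⊕ const (ℕ→ℚ 120) ⊛ f) ∎) ⟩
      θ y ⊛ (y ⊛ (const (ℕ→ℚ 240) ⊛ φ₁ ⊕ const (ℕ→ℚ 120) ⊛ f)) ∎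

  private
    module Hyp = Hypergeometric {y} {f} {φ₁} {φ₂} (chain-rule y y₀ F₁) (chain-rule y y₀ (θ F₁)) y∂p
    module Mod = Hyp.Modular {G} {M} G∂y²

    -- Cancelling `y` leaves a series with zero θ, hence a constant. That constant is 0: `φ₁` and
    -- `φ₂` are composites of θ-images and `y` has no constant term.
    E≈0 : Hyp.firstIntegral ≈ 𝟘
    E≈0 = θ-zero⇒ head (⊛-cancel-zero (suc k) y (θ Hyp.firstIntegral) yₖ Hyp.∂-firstIntegral)
      where
      φ-head : ∀ h → (θ h ∘ y) 0 ≡ 0ℚ
      φ-head h = trans (∘-head (θ h) y) (ℚₚ.*-zeroˡ (h 0))
      p-head : p 0 ≡ 0ℚ
      p-head = cong₂ ℚ._-_ (⊛-head-zeroʳ g₁ φ₂ (φ-head (θ F₁))) (⊛-head-zeroʳ (const (ℕ→ℚ 864) ⊛ y) φ₁ (φ-head F₁))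
      head : Hyp.firstIntegral 0 ≡ 0ℚ
      head = cong₂ ℚ._-_ (cong₂ ℚ._-_ (⊛-head-zeroʳ (const (ℕ→ℚ 2) ⊛ f) p p-head)
                                       (⊛-head-zeroʳ g₁ (φ₁ ⊛ φ₁) (⊛-head-zeroˡ φ₁ φ₁ (φ-head F₁))))
                          (⊛-head-zeroˡ (const (ℕ→ℚ 240) ⊛ y) (f ⊛ f) (⊛-head-zeroʳ (const (ℕ→ℚ 240)) y y₀))

    θyₖ : θ y (suc k) ≢ 0ℚ
    θyₖ = *-≢0 {ℕ→ℚ (suc k)} (λ ()) yₖ

    cancel-y : ∀ h z → y ⊛ h ⊛ z ≈ 𝟘 → h ⊛ z ≈ 𝟘
    cancel-y h z eq = ⊛-cancel-zero (suc k) y (h ⊛ z) yₖ (S.trans (S.sym (S.*-assoc y h z)) eq)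

    P≈0 : Mod.principalRelation ≈ 𝟘
    P≈0 = ⊛-cancel-zero (suc k) (θ y) Mod.principalRelation θyₖ
      (cancel-y (θ y) Mod.principalRelation (cancel-y (y ⊛ θ y) Mod.principalRelation
        (S.trans (S.*-congʳ {Mod.principalRelation} (S.sym (S.*-assoc y y (θ y)))) Mod.principalRelation-zero)))

    ∂f² : G ⊛ (θ f ⊛ θ f) ≈ M ⊛ g₁ ⊛ (φ₁ ⊛ φ₁)
    ∂f² = ⊛-cancelˡ (suc k) y yₖ (⊛-cancelˡ (suc k) y yₖ
      (S.trans (S.sym (S.*-assoc y y (G ⊛ (θ f ⊛ θ f)))) (S.trans Mod.∂f² (S.*-assoc y y (M ⊛ g₁ ⊛ (φ₁ ⊛ φ₁))))))

    Φ : Series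
    Φ = inverse m m₀ ⊛ f

    mΦ : m ⊛ Φ ≈ f
    mΦ = begin
      m ⊛ (inverse m m₀ ⊛ f)   ≈⟨ S.*-assoc m (inverse m m₀) f ⟨
      m ⊛ inverse m m₀ ⊛ f     ≈⟨ S.*-congʳ {f} (S.trans (S.*-comm m (inverse m m₀)) (inverseˡ m m₀)) ⟩
      𝟙 ⊛ f                    ≈⟨ S.*-identityˡ f ⟩
      f                        ∎

    m₀Φ₀ : m 0 ℚ.* Φ 0 ≡ 1ℚ
    m₀Φ₀ = trans (sym (⊛-head m Φ)) (trans (mΦ 0) (∘-head F₁ y))

    Φ₀ : Φ 0 ≢ 0ℚ
    Φ₀ eq = case trans (sym m₀Φ₀) (trans (cong (m 0 ℚ.*_) eq) (ℚₚ.*-zeroʳ (m 0))) of λ ()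

    M₀ : M 0 ≢ 0ℚ
    M₀ eq = ⊛-head-≢0 m m m₀ m₀ (trans (m² 0) eq)

    linear-Φ : linear G H Φ ≈ 𝟘
    linear-Φ = linear⇐quadratic {G} {H} {Φ} Φ₀ (⊛-cancel-zero 0 scale (quadratic G H Φ)
      (⊛-head-≢0 (const (ℕ→ℚ 4) ⊛ (M ⊛ M)) (m ⊛ m)
        (⊛-head-≢0 (const (ℕ→ℚ 4)) (M ⊛ M) (λ ()) (⊛-head-≢0 M M M₀ M₀)) (⊛-head-≢0 m m m₀ m₀))
      (Mod.Quotient.quadratic-zero {m} {Φ} {H} m² mΦ ∂f² E≈0 P≈0 HM²))
      where
      scale : Series
      scale = const (ℕ→ℚ 4) ⊛ (M ⊛ M) ⊛ (m ⊛ m)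

  -- `T` and `F₁ ∘ y` both begin with 1, so the factor of proportionality has to be `m 0`. For the
  -- two roots of the theorem it will be ℓ and 1.
  transformation : Recurrence.T G H ⊛ m ≈ m 0 • (F₁ ∘ y)
  transformation = begin
    Recurrence.T G H ⊛ m        ≈⟨ S.*-congʳ {m} (linear-unique G H G₀ H₀ (const (m 0) ⊛ Φ)
                                     (trans (const-⊛ (m 0) Φ 0) m₀Φ₀)
                                     (S.trans (linear-scale (m 0) G H Φ) (multiple (const (m 0)) linear-Φ))) ⟨
    const (m 0) ⊛ Φ ⊛ m         ≈⟨ ⊛-solve 3 (λ c Φ m → c :* Φ :* m := c :* (m :* Φ)) S.refl (const (m 0)) Φ m ⟩
    const (m 0) ⊛ (m ⊛ Φ)       ≈⟨ S.*-congˡ {const (m 0)} mΦ ⟩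
    const (m 0) ⊛ f             ≈⟨ const-⊛ (m 0) f ⟩
    m 0 • f                     ∎

-- Integer polynomials adjoined a square root

-- Integer coefficients, because the relations are checked by evaluation, and rational arithmetic
-- would reduce a fraction at every operation.
Poly : Set
Poly = List ℤ

⟪_⟫ : Poly → Series
⟪ p ⟫ = ⟦ List.map ℚLit.fromℤ p ⟧

int : ℤ → Series
int k = const (ℚLit.fromℤ k)

infixl 6 _+ₚ_
infixl 7 _*ₚ_

_+ₚ_ _*ₚ_ : Poly → Poly → Poly
[]      +ₚ q       = q
(i ∷ p) +ₚ []      = i ∷ p
(i ∷ p) +ₚ (j ∷ q) = i ℤ.+ j ∷ p +ₚ q

scaleₚ : ℤ → Poly → Poly
scaleₚ i = List.map (i ℤ.*_)

[]      *ₚ q = []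
(i ∷ p) *ₚ q = scaleₚ i q +ₚ (+ 0 ∷ p *ₚ q)

θₚ : Poly → Poly
θₚ []      = []
θₚ (i ∷ p) = + 0 ∷ p +ₚ θₚ p

isZeroₚ : Poly → Bool
isZeroₚ []            = true
isZeroₚ (+ zero ∷ p)  = isZeroₚ p
isZeroₚ (_ ∷ _)       = false

⟪⟫-+ : ∀ p q → ⟪ p +ₚ q ⟫ ≈ ⟪ p ⟫ ⊕ ⟪ q ⟫
⟪⟫-+ []      q       n       = sym (ℚₚ.+-identityˡ (⟪ q ⟫ n))
⟪⟫-+ (i ∷ p) []      n       = sym (ℚₚ.+-identityʳ (⟪ i ∷ p ⟫ n))
⟪⟫-+ (i ∷ p) (j ∷ q) zero    = fromℤ-+ i j
⟪⟫-+ (i ∷ p) (j ∷ q) (suc n) = ⟪⟫-+ p q n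

⟪⟫-scale : ∀ i p → ⟪ scaleₚ i p ⟫ ≈ ℚLit.fromℤ i • ⟪ p ⟫
⟪⟫-scale i []      n       = sym (ℚₚ.*-zeroʳ (ℚLit.fromℤ i))
⟪⟫-scale i (j ∷ p) zero    = fromℤ-* i j
⟪⟫-scale i (j ∷ p) (suc n) = ⟪⟫-scale i p n

⟪⟫-neg : ∀ p → ⟪ scaleₚ ℤ.-1ℤ p ⟫ ≈ neg ⟪ p ⟫
⟪⟫-neg p n = trans (⟪⟫-scale ℤ.-1ℤ p n)
  (trans (sym (ℚₚ.neg-distribˡ-* 1ℚ (⟪ p ⟫ n))) (cong ℚ.-_ (ℚₚ.*-identityˡ (⟪ p ⟫ n))))

⟪⟫-* : ∀ p q → ⟪ p *ₚ q ⟫ ≈ ⟪ p ⟫ ⊛ ⟪ q ⟫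
⟪⟫-* []      q n = sym (S.zeroˡ ⟪ q ⟫ n)
⟪⟫-* (i ∷ p) q n = trans (⟪⟫-+ (scaleₚ i q) (+ 0 ∷ p *ₚ q) n)
  (trans (cong (ℚ._+ ⟪ + 0 ∷ p *ₚ q ⟫ n) (⟪⟫-scale i q n)) (shift n))
  where
  shift : ∀ n → ℚLit.fromℤ i ℚ.* ⟪ q ⟫ n ℚ.+ ⟪ + 0 ∷ p *ₚ q ⟫ n ≡ (⟪ i ∷ p ⟫ ⊛ ⟪ q ⟫) n
  shift zero    = refl
  shift (suc n) = cong (ℚLit.fromℤ i ℚ.* ⟪ q ⟫ (suc n) ℚ.+_) (⟪⟫-* p q n)

⟪⟫-θ : ∀ p → ⟪ θₚ p ⟫ ≈ θ ⟪ p ⟫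
⟪⟫-θ []      n       = sym (ℚₚ.*-zeroʳ (ℕ→ℚ n))
⟪⟫-θ (i ∷ p) zero    = sym (ℚₚ.*-zeroˡ (ℚLit.fromℤ i))
⟪⟫-θ (i ∷ p) (suc n) = trans (⟪⟫-+ p (θₚ p) n)
  (trans (cong (⟪ p ⟫ n ℚ.+_) (⟪⟫-θ p n)) (sym (tail-θ ⟪ i ∷ p ⟫ n)))

isZeroₚ-sound : ∀ p → isZeroₚ p ≡ true → ⟪ p ⟫ ≈ 𝟘
isZeroₚ-sound []           eq n       = refl
isZeroₚ-sound (+ zero ∷ p) eq zero    = refl
isZeroₚ-sound (+ zero ∷ p) eq (suc n) = isZeroₚ-sound p eq n

⟪⟫-constant : ∀ k → ⟪ k ∷ [] ⟫ ≈ int k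
⟪⟫-constant k zero    = sym (ℚₚ.*-identityʳ (ℚLit.fromℤ k))
⟪⟫-constant k (suc n) = sym (ℚₚ.*-zeroʳ (ℚLit.fromℤ k))

-- Expressions in ℤ[x][s] with s² = g; the normal form (p , q) stands for p + q s.
infixl 6 _⟨+⟩_ _⟨-⟩_
infixl 7 _⟨*⟩_

data Expr : Set where
  poly  : Poly → Expr
  lit   : ℤ → Expr
  root  : Expr
  _⟨+⟩_ _⟨-⟩_ _⟨*⟩_ : Expr → Expr → Expr

module Evaluation (g : Poly) where

  normalise : Expr → Poly × Poly
  normalise (poly p)  = p , []
  normalise (lit k)   = (k ∷ []) , []
  normalise root      = [] , (+ 1 ∷ [])
  normalise (e ⟨+⟩ f) with normalise e | normalise f
  ... | p , q | p′ , q′ = p +ₚ p′ , q +ₚ q′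
  normalise (e ⟨-⟩ f) with normalise e | normalise f
  ... | p , q | p′ , q′ = p +ₚ scaleₚ ℤ.-1ℤ p′ , q +ₚ scaleₚ ℤ.-1ℤ q′
  normalise (e ⟨*⟩ f) with normalise e | normalise f
  ... | p , q | p′ , q′ = p *ₚ p′ +ₚ q *ₚ q′ *ₚ g , p *ₚ q′ +ₚ q *ₚ p′

  vanishes : Expr → Bool
  vanishes e = isZeroₚ (proj₁ (normalise e)) ∧ isZeroₚ (proj₂ (normalise e))

  module _ (s : Series) (s² : s ⊛ s ≈ ⟪ g ⟫) where
    open SeriesReasoning

    value : Expr → Series
    value (poly p)  = ⟪ p ⟫
    value (lit k)   = int k
    value root      = s
    value (e ⟨+⟩ f) = value e ⊕ value f
    value (e ⟨-⟩ f) = value e ⊖ value f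
    value (e ⟨*⟩ f) = value e ⊛ value f

    pair : Poly × Poly → Series
    pair (p , q) = ⟪ p ⟫ ⊕ ⟪ q ⟫ ⊛ s

    private
      pair-+ : ∀ p q p′ q′ → pair (p +ₚ p′ , q +ₚ q′) ≈ pair (p , q) ⊕ pair (p′ , q′)
      pair-+ p q p′ q′ = begin
        ⟪ p +ₚ p′ ⟫ ⊕ ⟪ q +ₚ q′ ⟫ ⊛ s
          ≈⟨ S.+-cong (⟪⟫-+ p p′) (S.*-congʳ {s} (⟪⟫-+ q q′)) ⟩
        ⟪ p ⟫ ⊕ ⟪ p′ ⟫ ⊕ (⟪ q ⟫ ⊕ ⟪ q′ ⟫) ⊛ s
          ≈⟨ ⊛-solve 5 (λ p q p′ q′ s → p :+ p′ :+ (q :+ q′) :* s := p :+ q :* s :+ (p′ :+ q′ :* s))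
               S.refl ⟪ p ⟫ ⟪ q ⟫ ⟪ p′ ⟫ ⟪ q′ ⟫ s ⟩
        pair (p , q) ⊕ pair (p′ , q′) ∎

      pair-neg : ∀ p q → pair (scaleₚ ℤ.-1ℤ p , scaleₚ ℤ.-1ℤ q) ≈ neg (pair (p , q))
      pair-neg p q = begin
        ⟪ scaleₚ ℤ.-1ℤ p ⟫ ⊕ ⟪ scaleₚ ℤ.-1ℤ q ⟫ ⊛ s
          ≈⟨ S.+-cong (⟪⟫-neg p) (S.*-congʳ {s} (⟪⟫-neg q)) ⟩
        neg ⟪ p ⟫ ⊕ neg ⟪ q ⟫ ⊛ s
          ≈⟨ ⊛-solve 3 (λ p q s → :- p :+ (:- q) :* s := :- (p :+ q :* s)) S.refl ⟪ p ⟫ ⟪ q ⟫ s ⟩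
        neg (pair (p , q)) ∎

      pair-* : ∀ p q p′ q′ → pair (p *ₚ p′ +ₚ q *ₚ q′ *ₚ g , p *ₚ q′ +ₚ q *ₚ p′) ≈ pair (p , q) ⊛ pair (p′ , q′)
      pair-* p q p′ q′ = begin
        ⟪ p *ₚ p′ +ₚ q *ₚ q′ *ₚ g ⟫ ⊕ ⟪ p *ₚ q′ +ₚ q *ₚ p′ ⟫ ⊛ s
          ≈⟨ S.+-cong (S.trans (⟪⟫-+ (p *ₚ p′) (q *ₚ q′ *ₚ g))
                         (S.+-cong (⟪⟫-* p p′) (S.trans (⟪⟫-* (q *ₚ q′) g) (S.*-cong (⟪⟫-* q q′) (S.sym s²)))))
                       (S.*-congʳ {s} (S.trans (⟪⟫-+ (p *ₚ q′) (q *ₚ p′)) (S.+-cong (⟪⟫-* p q′) (⟪⟫-* q p′)))) ⟩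
        ⟪ p ⟫ ⊛ ⟪ p′ ⟫ ⊕ ⟪ q ⟫ ⊛ ⟪ q′ ⟫ ⊛ (s ⊛ s) ⊕ (⟪ p ⟫ ⊛ ⟪ q′ ⟫ ⊕ ⟪ q ⟫ ⊛ ⟪ p′ ⟫) ⊛ s
          ≈⟨ ⊛-solve 5 (λ p q p′ q′ s → p :* p′ :+ q :* q′ :* (s :* s) :+ (p :* q′ :+ q :* p′) :* s
               := (p :+ q :* s) :* (p′ :+ q′ :* s)) S.refl ⟪ p ⟫ ⟪ q ⟫ ⟪ p′ ⟫ ⟪ q′ ⟫ s ⟩
        pair (p , q) ⊛ pair (p′ , q′) ∎

      []⊛ : ∀ f → ⟪ [] ⟫ ⊛ f ≈ 𝟘
      []⊛ = S.zeroˡ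

    normalise-sound : ∀ e → pair (normalise e) ≈ value e
    normalise-sound (poly p) = S.trans (S.+-congˡ {⟪ p ⟫} ([]⊛ s)) (S.+-identityʳ ⟪ p ⟫)
    normalise-sound (lit k) = S.trans (S.+-cong (⟪⟫-constant k) ([]⊛ s)) (S.+-identityʳ (int k))
    normalise-sound root = S.trans (S.+-identityˡ (⟪ + 1 ∷ [] ⟫ ⊛ s))
      (S.trans (S.*-congʳ {s} (S.trans (⟪⟫-constant (+ 1)) const-one)) (S.*-identityˡ s))
    normalise-sound (e ⟨+⟩ f) with normalise e | normalise-sound e | normalise f | normalise-sound f
    ... | p , q | ih | p′ , q′ | ih′ = S.trans (pair-+ p q p′ q′) (S.+-cong ih ih′)
    normalise-sound (e ⟨-⟩ f) with normalise e | normalise-sound e | normalise f | normalise-sound f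
    ... | p , q | ih | p′ , q′ | ih′ =
      S.trans (pair-+ p q (scaleₚ ℤ.-1ℤ p′) (scaleₚ ℤ.-1ℤ q′)) (S.+-cong ih (S.trans (pair-neg p′ q′) (S.-‿cong ih′)))
    normalise-sound (e ⟨*⟩ f) with normalise e | normalise-sound e | normalise f | normalise-sound f
    ... | p , q | ih | p′ , q′ | ih′ = S.trans (pair-* p q p′ q′) (S.*-cong ih ih′)

    vanishes-sound : ∀ e → vanishes e ≡ true → value e ≈ 𝟘
    vanishes-sound e eq with normalise e | normalise-sound e
    ... | p , q | sound with isZeroₚ p in p≡0 | isZeroₚ q in q≡0
    ... | true | true = S.trans (S.sym sound)
      (S.trans (S.+-cong (isZeroₚ-sound p p≡0) (S.trans (S.*-congʳ {s} (isZeroₚ-sound q q≡0)) (S.zeroˡ s))) (S.+-identityˡ 𝟘))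

-- Scaled to be integral: `Aₚ`, `Bₚ` and `Hₚ` stand for 2 a, 2 b and 4 H, since a and b are
-- half-integral at `ℓ₂` and H has a factor ¼ at `ℓ₁₃`. The exponent `e` is ℓ - 1.
record Data : Set where
  field
    Aₚ Bₚ cₚ dₚ gₚ Kₚ Gₚ Hₚ : Poly
    e ℓ : ℕ

  open Evaluation gₚ public

  -- 2 g θ(p + q s), by 2 g θs = (θg) s
  ∂[_⟨+⟩_root] : Poly → Poly → Expr
  ∂[ p ⟨+⟩ q root] = lit (+ 2) ⟨*⟩ poly gₚ ⟨*⟩ poly (θₚ p)
    ⟨+⟩ (lit (+ 2) ⟨*⟩ poly gₚ ⟨*⟩ poly (θₚ q) ⟨+⟩ poly q ⟨*⟩ poly (θₚ gₚ)) ⟨*⟩ root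

  Xₚ monomial -Bₚ : Poly
  Xₚ = + 0 ∷ + 1 ∷ []
  monomial = List.replicate e (+ 0) List.++ + 1 ∷ []
  -Bₚ = scaleₚ ℤ.-1ℤ Bₚ

  -- `∂[_⟨+⟩_root]` differentiates only expressions of the form p + q s, so the first derivative of
  -- `M′` is normalised before the second is taken.
  uv : Poly × Poly
  uv = normalise ∂[ Aₚ ⟨+⟩ -Bₚ root]

  -- M′, M₁ and M₂ stand for 2 M, 2 g θ(2 M) and 4 g² θ²(2 M).
  K³ N N₁ L₂ M′ M₁ M₂′ M₂ relationA relationB relationC relationE : Expr
  K³ = poly Kₚ ⟨*⟩ poly Kₚ ⟨*⟩ poly Kₚ
  N  = poly cₚ ⟨+⟩ poly dₚ ⟨*⟩ root
  N₁ = ∂[ cₚ ⟨+⟩ dₚ root]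
  L₂ = lit (+ 2) ⟨*⟩ poly gₚ ⟨*⟩ (poly Kₚ ⟨*⟩ N ⟨-⟩ lit (+ 3) ⟨*⟩ poly (θₚ Kₚ) ⟨*⟩ N) ⟨+⟩ poly Kₚ ⟨*⟩ N₁
  M′ = poly Aₚ ⟨+⟩ poly -Bₚ ⟨*⟩ root
  M₁ = poly (proj₁ uv) ⟨+⟩ poly (proj₂ uv) ⟨*⟩ root
  M₂′ = ∂[ proj₁ uv ⟨+⟩ proj₂ uv root]
  M₂ = M₂′ ⟨-⟩ lit (+ 2) ⟨*⟩ poly (θₚ gₚ) ⟨*⟩ M₁
  relationA = lit (+ 2) ⟨*⟩ poly Gₚ ⟨*⟩ poly Kₚ ⟨*⟩ L₂ ⟨*⟩ L₂
    ⟨-⟩ lit (+ 4) ⟨*⟩ poly gₚ ⟨*⟩ poly gₚ ⟨*⟩ M′ ⟨*⟩ (N ⟨*⟩ N) ⟨*⟩ (K³ ⟨-⟩ lit (+ 864) ⟨*⟩ (poly Xₚ ⟨*⟩ N))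
  relationB = K³ ⟨*⟩ (lit (+ 4) ⟨*⟩ poly gₚ ⟨*⟩ poly gₚ ⟨*⟩ poly Hₚ ⟨*⟩ (M′ ⟨*⟩ M′)
      ⟨+⟩ lit (+ 4) ⟨*⟩ poly Gₚ ⟨*⟩ M′ ⟨*⟩ M₂ ⟨-⟩ lit (+ 5) ⟨*⟩ poly Gₚ ⟨*⟩ (M₁ ⟨*⟩ M₁)
      ⟨+⟩ lit (+ 4) ⟨*⟩ poly (θₚ Gₚ) ⟨*⟩ poly gₚ ⟨*⟩ M′ ⟨*⟩ M₁)
    ⟨-⟩ lit (+ 960) ⟨*⟩ poly gₚ ⟨*⟩ poly gₚ ⟨*⟩ (poly Xₚ ⟨*⟩ N) ⟨*⟩ (M′ ⟨*⟩ M′ ⟨*⟩ M′)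
  -- The last two relations are the norms of c + d s and a + b s. In `relationE` the 4 is due to
  -- `Aₚ` and `Bₚ` being doubled.
  relationC = poly cₚ ⟨*⟩ poly cₚ ⟨-⟩ poly dₚ ⟨*⟩ poly dₚ ⟨*⟩ poly gₚ ⟨-⟩ lit (+ 4) ⟨*⟩ poly monomial ⟨*⟩ K³
  relationE = poly Aₚ ⟨*⟩ poly Aₚ ⟨-⟩ poly Bₚ ⟨*⟩ poly Bₚ ⟨*⟩ poly gₚ
    ⟨-⟩ lit (+ 4) ⟨*⟩ lit (+ (ℓ ℕ.* ℓ)) ⟨*⟩ poly Kₚ

-- Convergence

module _ where
  open ℚₚ.≤-Reasoning

  *-monoʳ : ∀ {p q} r → 0ℚ ℚ.≤ r → p ℚ.≤ q → r ℚ.* p ℚ.≤ r ℚ.* q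
  *-monoʳ r 0≤r = ℚₚ.*-monoˡ-≤-nonNeg r {{ℚ.nonNegative 0≤r}}

  *-mono : ∀ {p q r s} → 0ℚ ℚ.≤ r → 0ℚ ℚ.≤ q → p ℚ.≤ q → r ℚ.≤ s → p ℚ.* r ℚ.≤ q ℚ.* s
  *-mono {p} {q} {r} {s} 0≤r 0≤q p≤q r≤s = begin
    p ℚ.* r  ≤⟨ ℚₚ.*-monoʳ-≤-nonNeg r {{ℚ.nonNegative 0≤r}} p≤q ⟩
    q ℚ.* r  ≤⟨ *-monoʳ q 0≤q r≤s ⟩
    q ℚ.* s  ∎

  ℕ→ℚ-mono : ∀ {m n} → m ℕ.≤ n → ℕ→ℚ m ℚ.≤ ℕ→ℚ n
  ℕ→ℚ-mono {m} {n} m≤n = ℚ.*≤* (ℤₚ.*-monoʳ-≤-nonNeg (+ 1) (ℤ.+≤+ m≤n))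

  0≤ℕ→ℚ : ∀ n → 0ℚ ℚ.≤ ℕ→ℚ n
  0≤ℕ→ℚ n = ℕ→ℚ-mono {0} {n} z≤n

  ∣p∣≤∣↥p∣ : ∀ p → ℚ.∣ p ∣ ℚ.≤ ℕ→ℚ ℤ.∣ ℚ.↥ p ∣
  ∣p∣≤∣↥p∣ (ℚ.mkℚ n d-1 _) = ℚ.*≤* (ℤₚ.*-monoˡ-≤-nonNeg (+ ℤ.∣ n ∣) (ℤ.+≤+ (s≤s z≤n)))

  ∣sum∣≤ : ∀ N (α A b : Fin N → ℚ) → (∀ i → ℚ.∣ α i ∣ ℚ.≤ A i) →
           ℚ.∣ ∑[ i < N ] (α i ℚ.* b i) ∣ ℚ.≤ ∑[ i < N ] (A i ℚ.* ℚ.∣ b i ∣)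
  ∣sum∣≤ zero    α A b α≤A = ℚₚ.≤-refl
  ∣sum∣≤ (suc N) α A b α≤A = begin
    ℚ.∣ α₀ ℚ.* b₀ ℚ.+ s ∣                   ≤⟨ ℚₚ.∣p+q∣≤∣p∣+∣q∣ (α₀ ℚ.* b₀) s ⟩
    ℚ.∣ α₀ ℚ.* b₀ ∣ ℚ.+ ℚ.∣ s ∣             ≡⟨ cong (ℚ._+ ℚ.∣ s ∣) (ℚₚ.∣p*q∣≡∣p∣*∣q∣ α₀ b₀) ⟩
    ℚ.∣ α₀ ∣ ℚ.* ℚ.∣ b₀ ∣ ℚ.+ ℚ.∣ s ∣
      ≤⟨ ℚₚ.+-mono-≤ (ℚₚ.*-monoʳ-≤-nonNeg ℚ.∣ b₀ ∣ {{ℚ.nonNegative (ℚₚ.0≤∣p∣ b₀)}} (α≤A Fin.zero))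
           (∣sum∣≤ N (λ i → α (Fin.suc i)) (λ i → A (Fin.suc i)) (λ i → b (Fin.suc i)) (λ i → α≤A (Fin.suc i))) ⟩
    A Fin.zero ℚ.* ℚ.∣ b₀ ∣ ℚ.+ ∑[ i < N ] (A (Fin.suc i) ℚ.* ℚ.∣ b (Fin.suc i) ∣) ∎
    where
    α₀ b₀ s : ℚ
    α₀ = α Fin.zero
    b₀ = b Fin.zero
    s = ∑[ i < N ] (α (Fin.suc i) ℚ.* b (Fin.suc i))

  ⊛-mono : ∀ n {f f′} h → (∀ k → f k ℚ.≤ f′ k) → (∀ k → 0ℚ ℚ.≤ h k) → (f ⊛ h) n ℚ.≤ (f′ ⊛ h) n
  ⊛-mono zero    h f≤ 0≤h = ℚₚ.+-monoˡ-≤ 0ℚ (ℚₚ.*-monoʳ-≤-nonNeg (h 0) {{ℚ.nonNegative (0≤h 0)}} (f≤ 0))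
  ⊛-mono (suc n) h f≤ 0≤h = ℚₚ.+-mono-≤ (ℚₚ.*-monoʳ-≤-nonNeg (h (suc n)) {{ℚ.nonNegative (0≤h (suc n))}} (f≤ 0))
                              (⊛-mono n h (λ k → f≤ (suc k)) 0≤h)

geometric : ℕ → ℕ → Series
geometric C R n = ℕ→ℚ (C ℕ.* R ℕ.^ n)

Bounded : Series → ℕ → ℕ → Set
Bounded f C R = ∀ n → ℚ.∣ f n ∣ ℚ.≤ geometric C R n

geometric-suc : ∀ C R n → geometric C R (suc n) ≡ ℕ→ℚ R ℚ.* geometric C R n
geometric-suc C R n = trans (cong ℕ→ℚ (begin
  C ℕ.* (R ℕ.* R ℕ.^ n)   ≡⟨ ℕₚ.*-assoc C R (R ℕ.^ n) ⟨
  C ℕ.* R ℕ.* R ℕ.^ n     ≡⟨ cong (ℕ._* R ℕ.^ n) (ℕₚ.*-comm C R) ⟩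
  R ℕ.* C ℕ.* R ℕ.^ n     ≡⟨ ℕₚ.*-assoc R C (R ℕ.^ n) ⟩
  R ℕ.* (C ℕ.* R ℕ.^ n)   ∎)) (ℕ→ℚ-* R (C ℕ.* R ℕ.^ n))
  where open ≡-Reasoning

geometric-mono : ∀ {C C′ R R′} → C ℕ.≤ C′ → R ℕ.≤ R′ → ∀ n → geometric C R n ℚ.≤ geometric C′ R′ n
geometric-mono C≤ R≤ n = ℕ→ℚ-mono (ℕₚ.*-mono-≤ C≤ (ℕₚ.^-monoˡ-≤ n R≤))

common : ∀ {f h} → Convergent f → Convergent h → ∃[ C ] ∃[ R ] (Bounded f C R × Bounded h C R)
common (C , R , p) (C′ , R′ , q) = C ℕ.+ C′ , R ℕ.+ R′
  , (λ n → ℚₚ.≤-trans (p n) (geometric-mono (ℕₚ.m≤m+n C C′) (ℕₚ.m≤m+n R R′) n))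
  , (λ n → ℚₚ.≤-trans (q n) (geometric-mono (ℕₚ.m≤n+m C′ C) (ℕₚ.m≤n+m R′ R) n))

convergent-cong : ∀ {f h} → f ≈ h → Convergent h → Convergent f
convergent-cong f≈h (C , R , p) = C , R , λ n → subst (λ z → ℚ.∣ z ∣ ℚ.≤ geometric C R n) (sym (f≈h n)) (p n)

convergent-neg : ∀ {f} → Convergent f → Convergent (neg f)
convergent-neg {f} (C , R , f≤) = C , R , λ n → subst (ℚ._≤ geometric C R n) (sym (ℚₚ.∣-p∣≡∣p∣ (f n))) (f≤ n)

convergent-⊕ : ∀ {f h} → Convergent f → Convergent h → Convergent (f ⊕ h)
convergent-⊕ {f} {h} cf ch with common cf ch
... | C , R , p , q = C ℕ.+ C , R , λ n → begin
  ℚ.∣ f n ℚ.+ h n ∣                     ≤⟨ ℚₚ.∣p+q∣≤∣p∣+∣q∣ (f n) (h n) ⟩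
  ℚ.∣ f n ∣ ℚ.+ ℚ.∣ h n ∣               ≤⟨ ℚₚ.+-mono-≤ (p n) (q n) ⟩
  geometric C R n ℚ.+ geometric C R n   ≡⟨ ℕ→ℚ-+ (C ℕ.* R ℕ.^ n) (C ℕ.* R ℕ.^ n) ⟨
  ℕ→ℚ (C ℕ.* R ℕ.^ n ℕ.+ C ℕ.* R ℕ.^ n) ≡⟨ cong ℕ→ℚ (ℕₚ.*-distribʳ-+ (R ℕ.^ n) C C) ⟨
  geometric (C ℕ.+ C) R n               ∎
  where open ℚₚ.≤-Reasoning

-- The coefficients of `W ⊛ W` are (n + 1) C² Rⁿ, and n + 1 ≤ 2ⁿ; `square` runs this as an induction
-- in which each step at most doubles.
convergent-⊛ : ∀ {f h} → Convergent f → Convergent h → Convergent (f ⊛ h)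
convergent-⊛ {f} {h} cf ch with common cf ch
... | C , R , p , q = C ℕ.* C , 2 ℕ.* R , λ n → begin
  ℚ.∣ (f ⊛ h) n ∣            ≤⟨ ∣sum∣≤ (suc n) (λ i → f (Fin.toℕ i)) (λ i → W (Fin.toℕ i)) (λ i → h (n ∸ Fin.toℕ i)) (λ i → p (Fin.toℕ i)) ⟩
  (W ⊛ (λ k → ℚ.∣ h k ∣)) n  ≡⟨ ⊛-comm W (λ k → ℚ.∣ h k ∣) n ⟩
  ((λ k → ℚ.∣ h k ∣) ⊛ W) n  ≤⟨ ⊛-mono n W q (λ k → 0≤ℕ→ℚ (C ℕ.* R ℕ.^ k)) ⟩
  (W ⊛ W) n                  ≤⟨ square n ⟩
  geometric (C ℕ.* C) (2 ℕ.* R) n ∎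
  where
  open ℚₚ.≤-Reasoning
  W V : Series
  W = geometric C R
  V = geometric (C ℕ.* C) (2 ℕ.* R)
  square : ∀ n → (W ⊛ W) n ℚ.≤ V n
  square zero = ℚₚ.≤-reflexive (trans (ℚₚ.+-identityʳ (W 0 ℚ.* W 0)) (trans (sym (ℕ→ℚ-* (C ℕ.* 1) (C ℕ.* 1)))
    (cong ℕ→ℚ (trans (cong₂ ℕ._*_ (ℕₚ.*-identityʳ C) (ℕₚ.*-identityʳ C)) (sym (ℕₚ.*-identityʳ (C ℕ.* C)))))))
  square (suc n) = begin
    (W ⊛ W) (suc n)
      ≡⟨ ⊛-suc W W n ⟩
    (W ⊛ tail W) n ℚ.+ W (suc n) ℚ.* W 0
      ≡⟨ cong₂ ℚ._+_ (trans (⊛-cong {W} (λ _ → refl) (geometric-suc C R) n) (trans (⊛-comm W (ℕ→ℚ R • W) n) (•-⊛ (ℕ→ℚ R) W W n)))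
           (trans (sym (ℕ→ℚ-* (C ℕ.* (R ℕ.* R ℕ.^ n)) (C ℕ.* 1))) (trans (cong ℕ→ℚ rearrange) (ℕ→ℚ-* R (C ℕ.* C ℕ.* R ℕ.^ n)))) ⟩
    ℕ→ℚ R ℚ.* (W ⊛ W) n ℚ.+ ℕ→ℚ R ℚ.* geometric (C ℕ.* C) R n
      ≤⟨ ℚₚ.+-mono-≤ (*-monoʳ (ℕ→ℚ R) (0≤ℕ→ℚ R) (square n))
           (*-monoʳ (ℕ→ℚ R) (0≤ℕ→ℚ R) (geometric-mono {C ℕ.* C} {C ℕ.* C} ℕₚ.≤-refl (ℕₚ.m≤m+n R (R ℕ.+ 0)) n)) ⟩
    ℕ→ℚ R ℚ.* V n ℚ.+ ℕ→ℚ R ℚ.* V n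
      ≡⟨ solve 2 (λ r v → r :* v :+ r :* v := con (ℕ→ℚ 2) :* r :* v) refl (ℕ→ℚ R) (V n) ⟩
    ℕ→ℚ 2 ℚ.* ℕ→ℚ R ℚ.* V n
      ≡⟨ cong (ℚ._* V n) (ℕ→ℚ-* 2 R) ⟨
    ℕ→ℚ (2 ℕ.* R) ℚ.* V n
      ≡⟨ geometric-suc (C ℕ.* C) (2 ℕ.* R) n ⟨
    V (suc n) ∎
    where
    open ℚSolver
    rearrange : C ℕ.* (R ℕ.* R ℕ.^ n) ℕ.* (C ℕ.* 1) ≡ R ℕ.* (C ℕ.* C ℕ.* R ℕ.^ n)
    rearrange = ℕSolver.solve 3 (λ C R P → C ℕSolver.:* (R ℕSolver.:* P) ℕSolver.:* (C ℕSolver.:* ℕSolver.con 1)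
      ℕSolver.:= R ℕSolver.:* (C ℕSolver.:* C ℕSolver.:* P)) refl C R (R ℕ.^ n)

convergent-const : ∀ p → Convergent (const p)
convergent-const p = ℤ.∣ ℚ.↥ p ∣ , 1 , λ
  { zero    → ℚₚ.≤-trans (ℚₚ.≤-reflexive (cong ℚ.∣_∣ (ℚₚ.*-identityʳ p)))
                (ℚₚ.≤-trans (∣p∣≤∣↥p∣ p) (ℚₚ.≤-reflexive (cong ℕ→ℚ (sym (ℕₚ.*-identityʳ ℤ.∣ ℚ.↥ p ∣)))))
  ; (suc n) → ℚₚ.≤-trans (ℚₚ.≤-reflexive (cong ℚ.∣_∣ (ℚₚ.*-zeroʳ p))) (0≤ℕ→ℚ (ℤ.∣ ℚ.↥ p ∣ ℕ.* (1 ℕ.* 1 ℕ.^ n))) }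

convergent-x : Convergent (x^ 1)
convergent-x = 1 , 1 , λ
  { zero → 0≤ℕ→ℚ 1
  ; (suc zero) → ℚₚ.≤-refl
  ; (suc (suc n)) → 0≤ℕ→ℚ (1 ℕ.* 1 ℕ.^ suc (suc n)) }

convergent-⟪⟫ : ∀ p → Convergent ⟪ p ⟫
convergent-⟪⟫ []      = 0 , 0 , λ n → ℚₚ.≤-refl
convergent-⟪⟫ (i ∷ p) = convergent-cong unfold
  (convergent-⊕ (convergent-const (ℚLit.fromℤ i)) (convergent-⊛ convergent-x (convergent-⟪⟫ p)))
  where
  unfold : ⟪ i ∷ p ⟫ ≈ int i ⊕ x^ 1 ⊛ ⟪ p ⟫
  unfold zero = sym (trans (cong₂ ℚ._+_ (ℚₚ.*-identityʳ (ℚLit.fromℤ i)) (x⊛-head ⟪ p ⟫)) (ℚₚ.+-identityʳ (ℚLit.fromℤ i)))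
  unfold (suc n) = sym (trans (cong₂ ℚ._+_ (ℚₚ.*-zeroʳ (ℚLit.fromℤ i)) (x⊛-tail ⟪ p ⟫ n)) (ℚₚ.+-identityˡ (⟪ p ⟫ n)))

-- If u is bounded by this linear recursion then so is the right hand side S by S(n + 1) ≤ (1 + C) R S(n).
majorant : ∀ C R u → ℚ.∣ u 0 ∣ ℚ.≤ ℕ→ℚ C →
  (∀ n → ℚ.∣ u (suc n) ∣ ℚ.≤ geometric C R (suc n) ℚ.+ (tail (geometric C R) ⊛ (λ k → ℚ.∣ u k ∣)) n) →
  Bounded u C (suc C ℕ.* R)
majorant C R u u₀ step = λ
  { zero → ℚₚ.≤-trans u₀ (ℚₚ.≤-reflexive (cong ℕ→ℚ (sym (ℕₚ.*-identityʳ C))))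
  ; (suc n) → ℚₚ.≤-trans (step n) (S≤ n) }
  where
  open ℚₚ.≤-Reasoning
  open ℚSolver
  W v B S : Series
  W = geometric C R
  v k = ℚ.∣ u k ∣
  B = geometric C (suc C ℕ.* R)
  S n = W (suc n) ℚ.+ (tail W ⊛ v) n
  c r : ℚ
  c = ℕ→ℚ C
  r = ℕ→ℚ R
  grow : ∀ n → r ℚ.* B n ℚ.+ B n ℚ.* (r ℚ.* c) ≡ B (suc n)
  grow n = ≡.begin
    r ℚ.* B n ℚ.+ B n ℚ.* (r ℚ.* c)         ≡.≡⟨ solve 3 (λ r c b → r :* b :+ b :* (r :* c) := (con 1ℚ :+ c) :* r :* b) refl r c (B n) ⟩
    (1ℚ ℚ.+ c) ℚ.* r ℚ.* B n                ≡.≡⟨ cong (λ z → z ℚ.* r ℚ.* B n) (ℕ→ℚ-suc C) ⟨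
    ℕ→ℚ (suc C) ℚ.* r ℚ.* B n               ≡.≡⟨ cong (ℚ._* B n) (ℕ→ℚ-* (suc C) R) ⟨
    ℕ→ℚ (suc C ℕ.* R) ℚ.* B n               ≡.≡⟨ geometric-suc C (suc C ℕ.* R) n ⟨
    B (suc n)                               ≡.∎
    where module ≡ = ≡-Reasoning
  W₀ : W 0 ≡ c
  W₀ = cong ℕ→ℚ (ℕₚ.*-identityʳ C)
  W₁ : W 1 ≡ r ℚ.* c
  W₁ = trans (geometric-suc C R 0) (cong (r ℚ.*_) W₀)
  B₀ : B 0 ≡ c
  B₀ = cong ℕ→ℚ (ℕₚ.*-identityʳ C)
  S≤ : ∀ n → S n ℚ.≤ B (suc n)
  S≤ zero = begin
    W 1 ℚ.+ (W 1 ℚ.* v 0 ℚ.+ 0ℚ)            ≡⟨ cong (λ z → z ℚ.+ (z ℚ.* v 0 ℚ.+ 0ℚ)) W₁ ⟩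
    r ℚ.* c ℚ.+ (r ℚ.* c ℚ.* v 0 ℚ.+ 0ℚ)    ≡⟨ solve 3 (λ r c w → r :* c :+ (r :* c :* w :+ con 0ℚ) := r :* c :+ (r :* c) :* w) refl r c (v 0) ⟩
    r ℚ.* c ℚ.+ r ℚ.* c ℚ.* v 0             ≤⟨ ℚₚ.+-monoʳ-≤ (r ℚ.* c) (*-monoʳ (r ℚ.* c) 0≤rc u₀) ⟩
    r ℚ.* c ℚ.+ r ℚ.* c ℚ.* c               ≡⟨ cong (r ℚ.* c ℚ.+_) (ℚₚ.*-comm (r ℚ.* c) c) ⟩
    r ℚ.* c ℚ.+ c ℚ.* (r ℚ.* c)             ≡⟨ cong (λ z → r ℚ.* z ℚ.+ z ℚ.* (r ℚ.* c)) B₀ ⟨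
    r ℚ.* B 0 ℚ.+ B 0 ℚ.* (r ℚ.* c)         ≡⟨ grow 0 ⟩
    B 1                                     ∎
    where
    0≤rc : 0ℚ ℚ.≤ r ℚ.* c
    0≤rc = subst (0ℚ ℚ.≤_) (ℕ→ℚ-* R C) (0≤ℕ→ℚ (R ℕ.* C))
  S≤ (suc n) = begin
    W (suc (suc n)) ℚ.+ (tail W ⊛ v) (suc n)
      ≡⟨ cong₂ ℚ._+_ (geometric-suc C R (suc n)) (begin-equality
           (tail W ⊛ v) (suc n)                       ≡⟨ ⊛-comm (tail W) v (suc n) ⟩
           (v ⊛ tail W) (suc n)                       ≡⟨ ⊛-suc v (tail W) n ⟩
           (v ⊛ tail (tail W)) n ℚ.+ v (suc n) ℚ.* W 1
             ≡⟨ cong₂ (λ s w → s ℚ.+ v (suc n) ℚ.* w)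
                  (trans (⊛-comm v (tail (tail W)) n) (trans (⊛-cong {h = v} (λ k → geometric-suc C R (suc k)) (λ _ → refl) n) (•-⊛ r (tail W) v n)))
                  W₁ ⟩
           r ℚ.* (tail W ⊛ v) n ℚ.+ v (suc n) ℚ.* (r ℚ.* c) ∎) ⟩
    r ℚ.* W (suc n) ℚ.+ (r ℚ.* (tail W ⊛ v) n ℚ.+ v (suc n) ℚ.* (r ℚ.* c))
      ≡⟨ solve 4 (λ r w t z → r :* w :+ (r :* t :+ z) := r :* (w :+ t) :+ z) refl r (W (suc n)) ((tail W ⊛ v) n) (v (suc n) ℚ.* (r ℚ.* c)) ⟩
    r ℚ.* S n ℚ.+ v (suc n) ℚ.* (r ℚ.* c)
      ≤⟨ ℚₚ.+-mono-≤ (*-monoʳ r (0≤ℕ→ℚ R) (S≤ n))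
           (ℚₚ.*-monoʳ-≤-nonNeg (r ℚ.* c) {{ℚ.nonNegative (subst (0ℚ ℚ.≤_) (ℕ→ℚ-* R C) (0≤ℕ→ℚ (R ℕ.* C)))}} (ℚₚ.≤-trans (step n) (S≤ n))) ⟩
    r ℚ.* B (suc n) ℚ.+ B (suc n) ℚ.* (r ℚ.* c)
      ≡⟨ grow (suc n) ⟩
    B (suc (suc n)) ∎

-- The coefficients may vary with `n` as long as their bound depends on `j` alone. This covers
-- quotients, square roots and the series `T` alike. `K` bounds `u 0`, so that `C ℕ.+ K` can serve
-- as the constant in `majorant`.
recursion-convergent : ∀ {C R} u f (α : ℕ → ℕ → ℚ) → Bounded f C R →
  (∀ n j → j ℕ.≤ n → ℚ.∣ α n j ∣ ℚ.≤ geometric C R (suc j)) →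
  (∀ n → u (suc n) ≡ f (suc n) ℚ.+ ∑[ i < suc n ] (α n (Fin.toℕ i) ℚ.* u (n ∸ Fin.toℕ i))) →
  Convergent u
recursion-convergent {C} {R} u f α f≤ α≤ recursion =
  C ℕ.+ K , suc (C ℕ.+ K) ℕ.* R , majorant (C ℕ.+ K) R u
    (ℚₚ.≤-trans (∣p∣≤∣↥p∣ (u 0)) (ℕ→ℚ-mono (ℕₚ.m≤n+m K C)))
    λ n → begin
      ℚ.∣ u (suc n) ∣
        ≡⟨ cong ℚ.∣_∣ (recursion n) ⟩
      ℚ.∣ f (suc n) ℚ.+ ∑[ i < suc n ] (α n (Fin.toℕ i) ℚ.* u (n ∸ Fin.toℕ i)) ∣
        ≤⟨ ℚₚ.∣p+q∣≤∣p∣+∣q∣ (f (suc n)) (∑[ i < suc n ] (α n (Fin.toℕ i) ℚ.* u (n ∸ Fin.toℕ i))) ⟩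
      ℚ.∣ f (suc n) ∣ ℚ.+ ℚ.∣ ∑[ i < suc n ] (α n (Fin.toℕ i) ℚ.* u (n ∸ Fin.toℕ i)) ∣
        ≤⟨ ℚₚ.+-mono-≤ (ℚₚ.≤-trans (f≤ (suc n)) (enlarge (suc n)))
             (∣sum∣≤ (suc n) (λ i → α n (Fin.toℕ i)) (λ i → geometric (C ℕ.+ K) R (suc (Fin.toℕ i))) (λ i → u (n ∸ Fin.toℕ i))
               (λ i → ℚₚ.≤-trans (α≤ n (Fin.toℕ i) (ℕₚ.≤-pred (Finₚ.toℕ<n i))) (enlarge (suc (Fin.toℕ i))))) ⟩
      geometric (C ℕ.+ K) R (suc n) ℚ.+ (tail (geometric (C ℕ.+ K) R) ⊛ (λ k → ℚ.∣ u k ∣)) n ∎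
  where
  open ℚₚ.≤-Reasoning
  K : ℕ
  K = ℤ.∣ ℚ.↥ (u 0) ∣
  enlarge : ∀ n → geometric C R n ℚ.≤ geometric (C ℕ.+ K) R n
  enlarge = geometric-mono (ℕₚ.m≤m+n C K) (ℕₚ.≤-refl {R})

scale-head : ∀ (h : Series) (h₀ : h 0 ≢ 0ℚ) → (const (ℚ.1/_ (h 0) {{ℚ.≢-nonZero h₀}}) ⊛ h) 0 ≡ 1ℚ
scale-head h h₀ = trans (const-⊛ (ℚ.1/_ (h 0) {{ℚ.≢-nonZero h₀}}) h 0) (ℚₚ.*-inverseˡ (h 0) {{ℚ.≢-nonZero h₀}})

-- Scaling `h` to constant term 1 turns the equation into a recursion that expresses y(n + 1) by
-- earlier coefficients of `y`, with the coefficients of -h as multipliers.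
quotient-convergent : ∀ {y h f} → h 0 ≢ 0ℚ → y ⊛ h ≈ f → Convergent f → Convergent h → Convergent y
quotient-convergent {y} {h} {f} h₀ yh≈f cf ch
  with common (convergent-⊛ (convergent-const 1/h₀) cf) (convergent-⊛ (convergent-const 1/h₀) ch)
  where
  1/h₀ : ℚ
  1/h₀ = ℚ.1/_ (h 0) {{ℚ.≢-nonZero h₀}}
... | C , R , f≤ , h≤ = recursion-convergent {C} {R} y f̂ (λ _ j → ℚ.- ĥ (suc j)) f≤
        (λ _ j _ → subst (ℚ._≤ geometric C R (suc j)) (sym (ℚₚ.∣-p∣≡∣p∣ (ĥ (suc j)))) (h≤ (suc j)))
        recursion
  where
  c : Series
  c = const (ℚ.1/_ (h 0) {{ℚ.≢-nonZero h₀}})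
  f̂ ĥ : Series
  f̂ = c ⊛ f
  ĥ = c ⊛ h
  ĥy : ĥ ⊛ y ≈ f̂
  ĥy = S.trans (S.*-assoc c h y) (S.*-congˡ {c} (S.trans (S.*-comm h y) yh≈f))
  recursion : ∀ n → y (suc n) ≡ f̂ (suc n) ℚ.+ (neg (tail ĥ) ⊛ y) n
  recursion n = begin
    y (suc n)
      ≡⟨ solve 2 (λ y t → y := (con 1ℚ :* y :+ t) :- t) refl (y (suc n)) ((tail ĥ ⊛ y) n) ⟩
    1ℚ ℚ.* y (suc n) ℚ.+ (tail ĥ ⊛ y) n ℚ.- (tail ĥ ⊛ y) n
      ≡⟨ cong (λ z → z ℚ.* y (suc n) ℚ.+ (tail ĥ ⊛ y) n ℚ.- (tail ĥ ⊛ y) n) (scale-head h h₀) ⟨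
    (ĥ ⊛ y) (suc n) ℚ.- (tail ĥ ⊛ y) n
      ≡⟨ cong₂ ℚ._+_ (ĥy (suc n)) (neg-⊛ n) ⟩
    f̂ (suc n) ℚ.+ (neg (tail ĥ) ⊛ y) n ∎
    where
    open ≡-Reasoning
    open ℚSolver
    neg-⊛ : neg (tail ĥ ⊛ y) ≈ neg (tail ĥ) ⊛ y
    neg-⊛ = RingProperties.-‿distribˡ-* S.ring (tail ĥ) y

divide-bound : ∀ k {α x β} → ℕ→ℚ (suc k) ℚ.* α ≡ x → ℚ.∣ x ∣ ℚ.≤ ℕ→ℚ (suc k) ℚ.* β → ℚ.∣ α ∣ ℚ.≤ β
divide-bound k {α} {β = β} refl bound = ℚₚ.*-cancelˡ-≤-pos (ℕ→ℚ (suc k))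
  (subst (ℚ._≤ ℕ→ℚ (suc k) ℚ.* β) (ℚₚ.∣p*q∣≡∣p∣*∣q∣ (ℕ→ℚ (suc k)) α) bound)

-- The multipliers may grow with `n` as fast as the leading factor, which is written `suc (d n)` so
-- that dividing by it is immediate.
homogeneous-convergent : ∀ {C R} u (d : ℕ → ℕ) (x : ℕ → ℕ → ℚ) →
  (∀ n j → j ℕ.≤ n → ℚ.∣ x n j ∣ ℚ.≤ ℕ→ℚ (suc (d n)) ℚ.* geometric C R (suc j)) →
  (∀ n → ℕ→ℚ (suc (d n)) ℚ.* u (suc n) ≡ ∑[ i < suc n ] (x n (Fin.toℕ i) ℚ.* u (n ∸ Fin.toℕ i))) →
  Convergent u
homogeneous-convergent {C} {R} u d x x≤ recursion =
  recursion-convergent {C} {R} u 𝟘 α (λ n → 0≤ℕ→ℚ (C ℕ.* R ℕ.^ n))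
    (λ n j j≤n → divide-bound (d n) (cα n j) (x≤ n j j≤n))
    (λ n → *-cancelˡ-≢0 {c n} (λ ()) (begin
      c n ℚ.* u (suc n)
        ≡⟨ recursion n ⟩
      ∑[ i < suc n ] (x n (Fin.toℕ i) ℚ.* u (n ∸ Fin.toℕ i))
        ≡⟨ sum-cong-≗ {suc n} (λ i → trans (cong (ℚ._* u (n ∸ Fin.toℕ i)) (sym (cα n (Fin.toℕ i)))) (ℚₚ.*-assoc (c n) (α n (Fin.toℕ i)) (u (n ∸ Fin.toℕ i)))) ⟩
      ∑[ i < suc n ] (c n ℚ.* (α n (Fin.toℕ i) ℚ.* u (n ∸ Fin.toℕ i)))
        ≡⟨ *-distribˡ-sum (c n) (λ (i : Fin (suc n)) → α n (Fin.toℕ i) ℚ.* u (n ∸ Fin.toℕ i)) ⟨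
      c n ℚ.* ∑[ i < suc n ] (α n (Fin.toℕ i) ℚ.* u (n ∸ Fin.toℕ i))
        ≡⟨ cong (c n ℚ.*_) (ℚₚ.+-identityˡ (∑[ i < suc n ] (α n (Fin.toℕ i) ℚ.* u (n ∸ Fin.toℕ i)))) ⟨
      c n ℚ.* (0ℚ ℚ.+ ∑[ i < suc n ] (α n (Fin.toℕ i) ℚ.* u (n ∸ Fin.toℕ i))) ∎))
  where
  open ≡-Reasoning
  c : ℕ → ℚ
  c n = ℕ→ℚ (suc (d n))
  α : ℕ → ℕ → ℚ
  α n j = ℚ.1/ c n ℚ.* x n j
  cα : ∀ n j → c n ℚ.* α n j ≡ x n j
  cα n j = trans (sym (ℚₚ.*-assoc (c n) (ℚ.1/ c n) (x n j)))
    (trans (cong (ℚ._* x n j) (ℚₚ.*-inverseʳ (c n))) (ℚₚ.*-identityˡ (x n j)))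

∣ℕ→ℚ∣ : ∀ n → ℚ.∣ ℕ→ℚ n ∣ ≡ ℕ→ℚ n
∣ℕ→ℚ∣ n = ℚₚ.0≤p⇒∣p∣≡p (0≤ℕ→ℚ n)

module _ where
  open ℚₚ.≤-Reasoning

  ∣p-q∣≤ : ∀ p q {b c} → ℚ.∣ p ∣ ℚ.≤ b → ℚ.∣ q ∣ ℚ.≤ c → ℚ.∣ p ℚ.- q ∣ ℚ.≤ b ℚ.+ c
  ∣p-q∣≤ p q p≤ q≤ = ℚₚ.≤-trans (ℚₚ.∣p-q∣≤∣p∣+∣q∣ p q) (ℚₚ.+-mono-≤ p≤ q≤)

  ∣p*q∣≤ : ∀ p q {b c} → ℚ.∣ p ∣ ℚ.≤ b → ℚ.∣ q ∣ ℚ.≤ c → ℚ.∣ p ℚ.* q ∣ ℚ.≤ b ℚ.* c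
  ∣p*q∣≤ p q {b} {c} p≤ q≤ = begin
    ℚ.∣ p ℚ.* q ∣       ≡⟨ ℚₚ.∣p*q∣≡∣p∣*∣q∣ p q ⟩
    ℚ.∣ p ∣ ℚ.* ℚ.∣ q ∣ ≤⟨ *-mono (ℚₚ.0≤∣p∣ q) (ℚₚ.≤-trans (ℚₚ.0≤∣p∣ p) p≤) p≤ q≤ ⟩
    b ℚ.* c             ∎

∣ℕ→ℚ∣≤ : ∀ {m n} → m ℕ.≤ n → ℚ.∣ ℕ→ℚ m ∣ ℚ.≤ ℕ→ℚ n
∣ℕ→ℚ∣≤ {m} {n} m≤n = subst (ℚ._≤ ℕ→ℚ n) (sym (∣ℕ→ℚ∣ m)) (ℕ→ℚ-mono m≤n)

-- s² = f gives the linear equation 2 f θs = (θf) s.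
squareRoot-convergent : ∀ {s f} → f 0 ≢ 0ℚ → s ⊛ s ≈ f → Convergent f → Convergent s
squareRoot-convergent {s} {f} f₀ s²≈f cf with convergent-⊛ (convergent-const (ℚ.1/_ (f 0) {{ℚ.≢-nonZero f₀}})) cf
-- The successor of this value is what `2 ℕ.* suc n` reduces to.
... | C , R , f̂≤ = homogeneous-convergent {2 ℕ.* C} {R} s (λ n → n ℕ.+ suc (n ℕ.+ 0)) x x≤ recursion
  where
  c f̂ : Series
  c = const (ℚ.1/_ (f 0) {{ℚ.≢-nonZero f₀}})
  f̂ = c ⊛ f
  equation : const (ℕ→ℚ 2) ⊛ (f̂ ⊛ θ s) ≈ θ f̂ ⊛ s
  equation = begin
    const (ℕ→ℚ 2) ⊛ (c ⊛ f ⊛ θ s)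
      ≈⟨ S.*-congˡ {const (ℕ→ℚ 2)} (S.*-congʳ {θ s} (S.*-congˡ {c} s²≈f)) ⟨
    const (ℕ→ℚ 2) ⊛ (c ⊛ (s ⊛ s) ⊛ θ s)
      ≈⟨ ⊛-solve 3 (λ c s s′ → con (ℕ→ℚ 2) :* (c :* (s :* s) :* s′) := c :* (s′ :* s :+ s :* s′) :* s) S.refl c s (θ s) ⟩
    c ⊛ (θ s ⊛ s ⊕ s ⊛ θ s) ⊛ s
      ≈⟨ S.*-congʳ {s} (S.*-congˡ {c} (S.trans (S.sym (θ-⊛ s s)) (θ-cong s²≈f))) ⟩
    c ⊛ θ f ⊛ s
      ≈⟨ S.*-congʳ {s} (θ-scale (ℚ.1/_ (f 0) {{ℚ.≢-nonZero f₀}}) f) ⟨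
    θ f̂ ⊛ s ∎
    where open SeriesReasoning
  x : ℕ → ℕ → ℚ
  x n j = (ℕ→ℚ (suc j) ℚ.- ℕ→ℚ (2 ℕ.* (n ∸ j))) ℚ.* f̂ (suc j)
  x≤ : ∀ n j → j ℕ.≤ n → ℚ.∣ x n j ∣ ℚ.≤ ℕ→ℚ (2 ℕ.* suc n) ℚ.* geometric (2 ℕ.* C) R (suc j)
  x≤ n j j≤n = begin
    ℚ.∣ x n j ∣
      ≤⟨ ∣p*q∣≤ (ℕ→ℚ (suc j) ℚ.- ℕ→ℚ (2 ℕ.* (n ∸ j))) (f̂ (suc j))
                (∣p-q∣≤ (ℕ→ℚ (suc j)) (ℕ→ℚ (2 ℕ.* (n ∸ j))) (∣ℕ→ℚ∣≤ (ℕₚ.≤-trans (s≤s j≤n) (ℕₚ.m≤m+n (suc n) (suc n ℕ.+ 0))))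
                        (∣ℕ→ℚ∣≤ (ℕₚ.*-monoʳ-≤ 2 (ℕₚ.≤-trans (ℕₚ.m∸n≤m n j) (ℕₚ.n≤1+n n)))))
                (f̂≤ (suc j)) ⟩
    (N ℚ.+ N) ℚ.* geometric C R (suc j)
      ≡⟨ solve 2 (λ n g → (n :+ n) :* g := n :* (con (ℕ→ℚ 2) :* g)) refl N (geometric C R (suc j)) ⟩
    N ℚ.* (ℕ→ℚ 2 ℚ.* geometric C R (suc j))
      ≡⟨ cong (N ℚ.*_) (trans (sym (ℕ→ℚ-* 2 (C ℕ.* R ℕ.^ suc j))) (cong ℕ→ℚ (sym (ℕₚ.*-assoc 2 C (R ℕ.^ suc j))))) ⟩
    N ℚ.* geometric (2 ℕ.* C) R (suc j) ∎
    where
    open ℚₚ.≤-Reasoning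
    open ℚSolver
    N : ℚ
    N = ℕ→ℚ (2 ℕ.* suc n)
  recursion : ∀ n → ℕ→ℚ (2 ℕ.* suc n) ℚ.* s (suc n) ≡ ∑[ i < suc n ] (x n (Fin.toℕ i) ℚ.* s (n ∸ Fin.toℕ i))
  recursion n = begin
    ℕ→ℚ (2 ℕ.* suc n) ℚ.* s (suc n)
      ≡⟨ cong (ℚ._* s (suc n)) (ℕ→ℚ-* 2 (suc n)) ⟩
    ℕ→ℚ 2 ℚ.* N ℚ.* s (suc n)
      ≡⟨ solve 3 (λ N s t → con (ℕ→ℚ 2) :* N :* s := con (ℕ→ℚ 2) :* (con 1ℚ :* (N :* s) :+ t) :+ con (ℚ.- ℕ→ℚ 2) :* t)
           refl N (s (suc n)) ((tail f̂ ⊛ θ s) n) ⟩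
    ℕ→ℚ 2 ℚ.* (1ℚ ℚ.* θ s (suc n) ℚ.+ (tail f̂ ⊛ θ s) n) ℚ.+ ℚ.- ℕ→ℚ 2 ℚ.* (tail f̂ ⊛ θ s) n
      ≡⟨ cong (λ z → ℕ→ℚ 2 ℚ.* (z ℚ.* θ s (suc n) ℚ.+ (tail f̂ ⊛ θ s) n) ℚ.+ ℚ.- ℕ→ℚ 2 ℚ.* (tail f̂ ⊛ θ s) n) (scale-head f f₀) ⟨
    ℕ→ℚ 2 ℚ.* (f̂ ⊛ θ s) (suc n) ℚ.+ ℚ.- ℕ→ℚ 2 ℚ.* (tail f̂ ⊛ θ s) n
      ≡⟨ cong₂ ℚ._+_ (trans (sym (const-⊛ (ℕ→ℚ 2) (f̂ ⊛ θ s) (suc n))) (trans (equation (suc n)) (⊛-tail (θ f̂) s (ℚₚ.*-zeroˡ (f̂ 0)) n)))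
           (*-distribˡ-sum (ℚ.- ℕ→ℚ 2) (λ (i : Fin (suc n)) → f̂ (suc (Fin.toℕ i)) ℚ.* θ s (n ∸ Fin.toℕ i))) ⟩
    (tail (θ f̂) ⊛ s) n ℚ.+ ∑[ i < suc n ] (ℚ.- ℕ→ℚ 2 ℚ.* (f̂ (suc (Fin.toℕ i)) ℚ.* θ s (n ∸ Fin.toℕ i)))
      ≡⟨ ∑-distrib-+ {suc n} (λ i → θ f̂ (suc (Fin.toℕ i)) ℚ.* s (n ∸ Fin.toℕ i))
           (λ i → ℚ.- ℕ→ℚ 2 ℚ.* (f̂ (suc (Fin.toℕ i)) ℚ.* θ s (n ∸ Fin.toℕ i))) ⟨
    ∑[ i < suc n ] (θ f̂ (suc (Fin.toℕ i)) ℚ.* s (n ∸ Fin.toℕ i) ℚ.+ ℚ.- ℕ→ℚ 2 ℚ.* (f̂ (suc (Fin.toℕ i)) ℚ.* θ s (n ∸ Fin.toℕ i)))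
      ≡⟨ sum-cong-≗ {suc n} (λ i → trans
           (solve 4 (λ j w f s → j :* f :* s :+ con (ℚ.- ℕ→ℚ 2) :* (f :* (w :* s)) := (j :- con (ℕ→ℚ 2) :* w) :* f :* s)
              refl (ℕ→ℚ (suc (Fin.toℕ i))) (ℕ→ℚ (n ∸ Fin.toℕ i)) (f̂ (suc (Fin.toℕ i))) (s (n ∸ Fin.toℕ i)))
           (cong (λ z → (ℕ→ℚ (suc (Fin.toℕ i)) ℚ.- z) ℚ.* f̂ (suc (Fin.toℕ i)) ℚ.* s (n ∸ Fin.toℕ i))
              (sym (ℕ→ℚ-* 2 (n ∸ Fin.toℕ i))))) ⟩
    ∑[ i < suc n ] (x n (Fin.toℕ i) ℚ.* s (n ∸ Fin.toℕ i)) ∎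
    where
    open ≡-Reasoning
    open ℚSolver
    N : ℚ
    N = ℕ→ℚ (suc n)

-- With N = n + 1, the two factors of `coefficient` are at most 2 N and 2 N² times the geometric
-- bound. Their product matches the leading factor N³ up to 4.
T-convergent : ∀ {G H} → Convergent G → Convergent H → Convergent (Recurrence.T G H)
T-convergent {G} {H} cG cH with common cG cH
... | C , R , G≤ , H≤ = homogeneous-convergent {4 ℕ.* C} {R} (T G H) (λ n → ℕ.pred (cube G H n)) (λ n j → coefficient G H n (suc j)) bound (T-suc G H)
  where
  open Recurrence
  bound : ∀ n j → j ℕ.≤ n → ℚ.∣ coefficient G H n (suc j) ∣ ℚ.≤ ℕ→ℚ (cube G H n) ℚ.* geometric (4 ℕ.* C) R (suc j)
  bound n j j≤n = begin
    ℚ.∣ (N ℚ.- (+ suc j) ℚ./ 2) ℚ.* (H (suc j) ℚ.- N ℚ.* w ℚ.* G (suc j)) ∣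
      ≤⟨ ∣p*q∣≤ (N ℚ.- (+ suc j) ℚ./ 2) (H (suc j) ℚ.- N ℚ.* w ℚ.* G (suc j))
                (∣p-q∣≤ N ((+ suc j) ℚ./ 2) (ℚₚ.≤-reflexive (∣ℕ→ℚ∣ (suc n))) half≤)
                (∣p-q∣≤ (H (suc j)) (N ℚ.* w ℚ.* G (suc j)) (ℚₚ.≤-trans (H≤ (suc j)) g≤NNg)
                        (∣p*q∣≤ (N ℚ.* w) (G (suc j)) (∣p*q∣≤ N w (ℚₚ.≤-reflexive (∣ℕ→ℚ∣ (suc n))) (∣ℕ→ℚ∣≤ (ℕₚ.≤-trans (ℕₚ.m∸n≤m n j) (ℕₚ.n≤1+n n)))) (G≤ (suc j)))) ⟩
    (N ℚ.+ N) ℚ.* (N ℚ.* N ℚ.* g ℚ.+ N ℚ.* N ℚ.* g)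
      ≡⟨ solve 2 (λ N g → (N :+ N) :* (N :* N :* g :+ N :* N :* g) := (N :* N :* N) :* (con (ℕ→ℚ 4) :* g)) refl N g ⟩
    N ℚ.* N ℚ.* N ℚ.* (ℕ→ℚ 4 ℚ.* g)
      ≡⟨ cong₂ ℚ._*_ (sym (trans (ℕ→ℚ-* (suc n ℕ.* suc n) (suc n)) (cong (ℚ._* N) (ℕ→ℚ-* (suc n) (suc n)))))
           (trans (sym (ℕ→ℚ-* 4 (C ℕ.* R ℕ.^ suc j))) (cong ℕ→ℚ (sym (ℕₚ.*-assoc 4 C (R ℕ.^ suc j))))) ⟩
    ℕ→ℚ (cube G H n) ℚ.* geometric (4 ℕ.* C) R (suc j) ∎
    where
    open ℚₚ.≤-Reasoning
    open ℚSolver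
    N w g : ℚ
    N = ℕ→ℚ (suc n)
    w = ℕ→ℚ (n ∸ j)
    g = geometric C R (suc j)
    half≤ : ℚ.∣ (+ suc j) ℚ./ 2 ∣ ℚ.≤ N
    half≤ = begin
      ℚ.∣ (+ suc j) ℚ./ 2 ∣       ≡⟨ cong ℚ.∣_∣ (½*ℕ→ℚ (suc j)) ⟩
      ℚ.∣ ℚ.½ ℚ.* ℕ→ℚ (suc j) ∣   ≤⟨ ∣p*q∣≤ ℚ.½ (ℕ→ℚ (suc j)) {1ℚ} (ℚ.*≤* (ℤ.+≤+ (s≤s z≤n))) (∣ℕ→ℚ∣≤ (s≤s j≤n)) ⟩
      1ℚ ℚ.* N                    ≡⟨ ℚₚ.*-identityˡ N ⟩
      N                           ∎
    g≤NNg : g ℚ.≤ N ℚ.* N ℚ.* g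
    g≤NNg = begin
      g                 ≡⟨ ℚₚ.*-identityˡ g ⟨
      1ℚ ℚ.* g          ≤⟨ ℚₚ.*-monoʳ-≤-nonNeg g {{ℚ.nonNegative (0≤ℕ→ℚ (C ℕ.* R ℕ.^ suc j))}} (subst (1ℚ ℚ.≤_) (ℕ→ℚ-* (suc n) (suc n)) (ℕ→ℚ-mono {1} (s≤s z≤n))) ⟩
      N ℚ.* N ℚ.* g     ∎

-- The two conjugate parametrisations

x^-suc : ∀ k → x^ suc k ≈ x^ 1 ⊛ x^ k
x^-suc k zero    = sym (x⊛-head (x^ k))
x^-suc k (suc n) = sym (x⊛-tail (x^ k) n)

x^-diagonal : ∀ k → (x^ k) k ≡ 1ℚ
x^-diagonal zero    = refl
x^-diagonal (suc k) = x^-diagonal k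

monomial≈x^ : ∀ e → ⟪ List.replicate e (+ 0) List.++ + 1 ∷ [] ⟫ ≈ x^ e
monomial≈x^ zero    zero    = refl
monomial≈x^ zero    (suc n) = refl
monomial≈x^ (suc e) zero    = refl
monomial≈x^ (suc e) (suc n) = monomial≈x^ e n

θ-x : θ (x^ 1) ≈ x^ 1
θ-x zero          = refl
θ-x (suc zero)    = refl
θ-x (suc (suc n)) = ℚₚ.*-zeroʳ (ℕ→ℚ (suc (suc n)))

leading : ∀ k y h v → h 0 ≢ 0ℚ → y ⊛ h ≈ x^ k ⊛ v → (∀ n → n ℕ.< k → y n ≡ 0ℚ) × y k ℚ.* h 0 ≡ v 0
leading zero y h v h₀ eq = (λ n ()) , trans (sym (⊛-head y h)) (trans (eq 0) (⊛-identityˡ v 0))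
leading (suc k) y h v h₀ eq = (λ { zero _ → y₀ ; (suc n) (s≤s n<k) → proj₁ ih n n<k }) , proj₂ ih
  where
  y₀ : y 0 ≡ 0ℚ
  y₀ = *-cancelˡ-≢0 h₀ (trans (ℚₚ.*-comm (h 0) (y 0)) (trans (sym (⊛-head y h))
         (trans (eq 0) (trans (⊛-head-zeroˡ (x^ suc k) v refl) (sym (ℚₚ.*-zeroʳ (h 0)))))))
  ih : (∀ n → n ℕ.< k → y (suc n) ≡ 0ℚ) × y (suc k) ℚ.* h 0 ≡ v 0
  ih = leading k (tail y) h v h₀ λ n →
    trans (sym (⊛-tail y h y₀ n)) (trans (eq (suc n)) (⊛-tail (x^ suc k) v refl n))

leading-mod : ∀ k y h v → h 0 ≢ 0ℚ → h 0 ≡ v 0 → y ⊛ h ≈ x^ k ⊛ v → y ≈ x^ k mod-x^ suc k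
leading-mod k y h v h₀ h₀≡v₀ eq n (s≤s n≤k) with leading k y h v h₀ eq | ℕₚ.m≤n⇒m<n∨m≡n n≤k
... | below , at | inj₁ n<k  = trans (below n n<k) (sym (vanish k n n<k))
  where
  vanish : ∀ k n → n ℕ.< k → (x^ k) n ≡ 0ℚ
  vanish (suc k) zero    _         = refl
  vanish (suc k) (suc n) (s≤s n<k) = vanish k n n<k
... | below , at | inj₂ refl = trans (*-cancelˡ-≢0 h₀ (trans (ℚₚ.*-comm (h 0) (y k))
        (trans at (trans (sym h₀≡v₀) (sym (ℚₚ.*-identityʳ (h 0))))))) (sym (x^-diagonal k))

-- Formulated for an arbitrary root `s` of `g`: √g gives y⁻, and its negative gives y⁺.
module Conjugate
  (D : Data)
  (A≈0 : Data.vanishes D (Data.relationA D) ≡ true)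
  (B≈0 : Data.vanishes D (Data.relationB D) ≡ true)
  (C≈0 : Data.vanishes D (Data.relationC D) ≡ true)
  (g₀ : ⟪ Data.gₚ D ⟫ 0 ≢ 0ℚ) (K₀ : ⟪ Data.Kₚ D ⟫ 0 ≡ 1ℚ)
  (s : Series) (s² : s ⊛ s ≈ ⟪ Data.gₚ D ⟫)
  where

  open Data D
  open SeriesReasoning

  private
    v : Expr → Series
    v = value s s²
    g K C Dₛ X x^e n : Series
    g = ⟪ gₚ ⟫
    K = ⟪ Kₚ ⟫
    C = ⟪ cₚ ⟫
    Dₛ = ⟪ dₚ ⟫
    X = ⟪ Xₚ ⟫
    x^e = ⟪ monomial ⟫
    n = const (ℕ→ℚ 2)

  2K³ : Series
  2K³ = n ⊛ (K ⊛ K ⊛ K)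

  private
    X≈x : X ≈ x^ 1
    X≈x = monomial≈x^ 1

    ∂s : const (ℕ→ℚ 2) ⊛ g ⊛ θ s ≈ θ g ⊛ s
    ∂s = begin
      const (ℕ→ℚ 2) ⊛ g ⊛ θ s         ≈⟨ S.*-congʳ {θ s} (S.*-congˡ {const (ℕ→ℚ 2)} s²) ⟨
      const (ℕ→ℚ 2) ⊛ (s ⊛ s) ⊛ θ s   ≈⟨ ⊛-solve 2 (λ s s′ → con (ℕ→ℚ 2) :* (s :* s) :* s′ := (s′ :* s :+ s :* s′) :* s) S.refl s (θ s) ⟩
      (θ s ⊛ s ⊕ s ⊛ θ s) ⊛ s         ≈⟨ S.*-congʳ {s} (S.trans (S.sym (θ-⊛ s s)) (θ-cong s²)) ⟩
      θ g ⊛ s                         ∎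

    ∂root : ∀ p q → const (ℕ→ℚ 2) ⊛ g ⊛ θ (⟪ p ⟫ ⊕ ⟪ q ⟫ ⊛ s) ≈ v ∂[ p ⟨+⟩ q root]
    ∂root p q = begin
      const (ℕ→ℚ 2) ⊛ g ⊛ θ (⟪ p ⟫ ⊕ ⟪ q ⟫ ⊛ s)
        ≈⟨ S.*-congˡ {const (ℕ→ℚ 2) ⊛ g} (S.trans (θ-⊕ ⟪ p ⟫ (⟪ q ⟫ ⊛ s)) (S.+-cong (S.sym (⟪⟫-θ p))
             (S.trans (θ-⊛ ⟪ q ⟫ s) (S.+-congʳ {⟪ q ⟫ ⊛ θ s} (S.*-congʳ {s} (S.sym (⟪⟫-θ q))))))) ⟩
      const (ℕ→ℚ 2) ⊛ g ⊛ (⟪ θₚ p ⟫ ⊕ (⟪ θₚ q ⟫ ⊛ s ⊕ ⟪ q ⟫ ⊛ θ s))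
        ≈⟨ ⊛-solve 7 (λ g g′ s s′ p′ q q′ →
             con (ℕ→ℚ 2) :* g :* (p′ :+ (q′ :* s :+ q :* s′)) :=
             con (ℕ→ℚ 2) :* g :* p′ :+ (con (ℕ→ℚ 2) :* g :* q′ :+ q :* g′) :* s
               :+ q :* (con (ℕ→ℚ 2) :* g :* s′ :- g′ :* s))
             S.refl g ⟪ θₚ gₚ ⟫ s (θ s) ⟪ θₚ p ⟫ ⟪ q ⟫ ⟪ θₚ q ⟫ ⟩
      v ∂[ p ⟨+⟩ q root] ⊕ ⟪ q ⟫ ⊛ (const (ℕ→ℚ 2) ⊛ g ⊛ θ s ⊖ ⟪ θₚ gₚ ⟫ ⊛ s)
        ≈⟨ S.+-congˡ {v ∂[ p ⟨+⟩ q root]} (multiple ⟪ q ⟫ (difference (S.trans ∂s (S.*-congʳ {s} (S.sym (⟪⟫-θ gₚ)))))) ⟩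
      v ∂[ p ⟨+⟩ q root] ⊕ 𝟘
        ≈⟨ S.+-identityʳ (v ∂[ p ⟨+⟩ q root]) ⟩
      v ∂[ p ⟨+⟩ q root] ∎

    -- Multiplying by the conjugate trades the denominator `C ⊖ Dₛ ⊛ s` for a power of x times a
    -- unit.
    norm : (C ⊖ Dₛ ⊛ s) ⊛ v N ≈ const (ℕ→ℚ 4) ⊛ x^e ⊛ (K ⊛ K ⊛ K)
    norm = fromDifference (begin
      (C ⊖ Dₛ ⊛ s) ⊛ v N ⊖ const (ℕ→ℚ 4) ⊛ x^e ⊛ (K ⊛ K ⊛ K)
        ≈⟨ ⊛-solve 6 (λ c d s g x k → (c :- d :* s) :* (c :+ d :* s) :- con (ℕ→ℚ 4) :* x :* k :=
             (:- d :* d) :* (s :* s :- g) :+ (c :* c :- d :* d :* g :- con (ℕ→ℚ 4) :* x :* k))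
             S.refl C Dₛ s g x^e (K ⊛ K ⊛ K) ⟩
      (neg Dₛ ⊛ Dₛ) ⊛ (s ⊛ s ⊖ g) ⊕ v relationC
        ≈⟨ multiple (neg Dₛ ⊛ Dₛ) (difference s²) ⊞ vanishes-sound s s² relationC C≈0 ⟩
      𝟘 ∎)

    2x^suc : ℕ→ℚ 2 • x^ suc e ≈ n ⊛ (X ⊛ x^e)
    2x^suc = S.trans (S.sym (const-⊛ (ℕ→ℚ 2) (x^ suc e)))
      (S.*-congˡ {n} (S.trans (x^-suc e) (S.*-cong (S.sym X≈x) (S.sym (monomial≈x^ e)))))

  2K³-head : 2K³ 0 ≡ ℕ→ℚ 2
  2K³-head = trans (const-⊛ (ℕ→ℚ 2) (K ⊛ K ⊛ K) 0) (cong (ℕ→ℚ 2 ℚ.*_)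
    (trans (⊛-head (K ⊛ K) K) (trans (cong (ℚ._* K 0) (⊛-head K K)) (cong (λ z → z ℚ.* z ℚ.* z) K₀))))

  private
    2K³₀ : 2K³ 0 ≢ 0ℚ
    2K³₀ eq = case trans (sym 2K³-head) eq of λ ()

  -- By `norm`, if c + d s is a unit then c - d s has order exactly `e`: its coefficient there,
  -- times the constant term of c + d s, is 4.
  conjugate-leading : (C ⊕ Dₛ ⊛ s) 0 ≢ 0ℚ → ∃[ i ] (C ⊖ Dₛ ⊛ s) i ≢ 0ℚ
  conjugate-leading N₀ = e , λ eq →
    case trans (sym (trans (proj₂ (leading e (C ⊖ Dₛ ⊛ s) (v N) (n ⊛ 2K³) N₀ (S.trans norm (begin
      const (ℕ→ℚ 4) ⊛ x^e ⊛ (K ⊛ K ⊛ K)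
        ≈⟨ ⊛-solve 2 (λ x k → con (ℕ→ℚ 4) :* x :* k := x :* (con (ℕ→ℚ 2) :* (con (ℕ→ℚ 2) :* k))) S.refl x^e (K ⊛ K ⊛ K) ⟩
      x^e ⊛ (n ⊛ 2K³)
        ≈⟨ S.*-congʳ {n ⊛ 2K³} (monomial≈x^ e) ⟩
      x^ e ⊛ (n ⊛ 2K³) ∎)))) (trans (const-⊛ (ℕ→ℚ 2) 2K³ 0) (cong (ℕ→ℚ 2 ℚ.*_) 2K³-head))))
      (*-zero₁ (v N 0) eq) of λ ()

  solution : Series
  solution = x^ 1 ⊛ v N ⊛ inverse 2K³ 2K³₀

  solution-spec : solution ⊛ (C ⊖ Dₛ ⊛ s) ≈ ℕ→ℚ 2 • x^ suc e
  solution-spec = begin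
    x^ 1 ⊛ v N ⊛ i ⊛ (C ⊖ Dₛ ⊛ s)
      ≈⟨ ⊛-solve 4 (λ x N i c → x :* N :* i :* c := x :* i :* (c :* N)) S.refl (x^ 1) (v N) i (C ⊖ Dₛ ⊛ s) ⟩
    x^ 1 ⊛ i ⊛ ((C ⊖ Dₛ ⊛ s) ⊛ v N)
      ≈⟨ S.*-congˡ {x^ 1 ⊛ i} norm ⟩
    x^ 1 ⊛ i ⊛ (const (ℕ→ℚ 4) ⊛ x^e ⊛ (K ⊛ K ⊛ K))
      ≈⟨ ⊛-solve 4 (λ x i xe k → x :* i :* (con (ℕ→ℚ 4) :* xe :* k) := con (ℕ→ℚ 2) :* (x :* xe) :* (i :* (con (ℕ→ℚ 2) :* k)))
           S.refl (x^ 1) i x^e (K ⊛ K ⊛ K) ⟩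
    n ⊛ (x^ 1 ⊛ x^e) ⊛ (i ⊛ 2K³)
      ≈⟨ S.*-cong (S.*-congˡ {n} (S.*-congʳ {x^e} (S.sym X≈x))) (inverseˡ 2K³ 2K³₀) ⟩
    n ⊛ (X ⊛ x^e) ⊛ 𝟙
      ≈⟨ S.*-identityʳ (n ⊛ (X ⊛ x^e)) ⟩
    n ⊛ (X ⊛ x^e)
      ≈⟨ 2x^suc ⟨
    ℕ→ℚ 2 • x^ suc e ∎
    where
    i : Series
    i = inverse 2K³ 2K³₀

  module Solution (y : Series) (y-spec : y ⊛ (C ⊖ Dₛ ⊛ s) ≈ ℕ→ℚ 2 • x^ suc e) where

    -- The specification multiplied by c + d s and simplified by `norm`; then the powers of x are
    -- cancelled. It exhibits an arbitrary solution `y` as a quotient by the unit `2K³`, which gives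
    -- its derivative, its leading term and its convergence.
    2K³y : 2K³ ⊛ y ≈ X ⊛ v N
    2K³y = ⊛-cancelˡ 0 n (λ ()) (⊛-cancelˡ e x^e
      (λ eq → case trans (sym (trans (monomial≈x^ e e) (x^-diagonal e))) eq of λ ()) (begin
      x^e ⊛ (n ⊛ (2K³ ⊛ y))
        ≈⟨ ⊛-solve 3 (λ x k y → x :* (con (ℕ→ℚ 2) :* (con (ℕ→ℚ 2) :* k :* y)) := y :* (con (ℕ→ℚ 4) :* x :* k))
             S.refl x^e (K ⊛ K ⊛ K) y ⟩
      y ⊛ (const (ℕ→ℚ 4) ⊛ x^e ⊛ (K ⊛ K ⊛ K))
        ≈⟨ S.*-congˡ {y} norm ⟨
      y ⊛ ((C ⊖ Dₛ ⊛ s) ⊛ v N)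
        ≈⟨ S.*-assoc y (C ⊖ Dₛ ⊛ s) (v N) ⟨
      y ⊛ (C ⊖ Dₛ ⊛ s) ⊛ v N
        ≈⟨ S.*-congʳ {v N} (S.trans y-spec 2x^suc) ⟩
      n ⊛ (X ⊛ x^e) ⊛ v N
        ≈⟨ ⊛-solve 4 (λ n X x N → n :* (X :* x) :* N := x :* (n :* (X :* N))) S.refl n X x^e (v N) ⟩
      x^e ⊛ (n ⊛ (X ⊛ v N)) ∎))

    y2K³ : y ⊛ 2K³ ≈ x^ 1 ⊛ v N
    y2K³ = S.trans (S.*-comm y 2K³) (S.trans 2K³y (S.*-congʳ {v N} X≈x))

    y-convergent : Convergent s → Convergent y
    y-convergent cs = quotient-convergent 2K³₀ y2K³
      (convergent-⊛ convergent-x (convergent-⊕ (convergent-⟪⟫ cₚ) (convergent-⊛ (convergent-⟪⟫ dₚ) cs)))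
      (convergent-⊛ (convergent-const (ℕ→ℚ 2)) (convergent-⊛ (convergent-⊛ (convergent-⟪⟫ Kₚ) (convergent-⟪⟫ Kₚ)) (convergent-⟪⟫ Kₚ)))

    private
      module Par = Parametrisation {X} {v N} {K} {⟪ θₚ Kₚ ⟫} {g} {⟪ θₚ gₚ ⟫} {⟪ Gₚ ⟫} {⟪ θₚ Gₚ ⟫}
        {const ((+ 1) ℚ./ 4) ⊛ ⟪ Hₚ ⟫} {v M′} {v N₁} {v M₁} {v M₂′} {⟪ Hₚ ⟫} {y}
        (S.trans (θ-cong X≈x) (S.trans θ-x (S.sym X≈x)))
        (S.sym (⟪⟫-θ Kₚ)) (S.sym (⟪⟫-θ gₚ)) 2K³y (∂root cₚ dₚ)
        (S.trans (∂root Aₚ -Bₚ) (S.sym (normalise-sound s s² ∂[ Aₚ ⟨+⟩ -Bₚ root])))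
        (∂root (proj₁ uv) (proj₂ uv))
        (⊛-solve 1 (λ h → con (ℕ→ℚ 4) :* (con ((+ 1) ℚ./ 4) :* h) := h) S.refl ⟪ Hₚ ⟫)

    module Transformed
      {G H m : Series}
      (G≈ : G ≈ ⟪ Gₚ ⟫) (H≈ : H ≈ const ((+ 1) ℚ./ 4) ⊛ ⟪ Hₚ ⟫) (G₀ : G 0 ≡ 1ℚ) (H₀ : H 0 ≡ 0ℚ)
      (k : ℕ) (y-mod : y ≈ x^ suc k mod-x^ suc (suc k))
      (m² : m ⊛ m ≈ const ℚ.½ ⊛ v M′) (m₀ : m 0 ≢ 0ℚ)
      where

      private
        M : Series
        M = const ℚ.½ ⊛ v M′

        K≢0 : K 0 ≢ 0ℚ
        K≢0 eq = case trans (sym K₀) eq of λ ()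

        G∂y² : G ⊛ (θ y ⊛ θ y) ≈ M ⊛ (y ⊛ y) ⊛ (const 1ℚ ⊖ const (ℕ→ℚ 1728) ⊛ y)
        G∂y² = S.trans (S.*-congʳ {θ y ⊛ θ y} G≈) (fromDifference (⊛-cancel-zero 0 scale _
          (⊛-head-≢0 (const (ℕ→ℚ 32) ⊛ (g ⊛ g)) K⁹ (⊛-head-≢0 (const (ℕ→ℚ 32)) (g ⊛ g) (λ ()) (⊛-head-≢0 g g g₀ g₀)) K⁹≢0)
          (Par.G∂y²-multiple (vanishes-sound s s² relationA A≈0))))
          where
          K⁹ scale : Series
          K⁹ = K ⊛ K ⊛ K ⊛ K ⊛ K ⊛ K ⊛ K ⊛ K ⊛ K
          scale = const (ℕ→ℚ 32) ⊛ (g ⊛ g) ⊛ K⁹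
          times : ∀ f → f 0 ≢ 0ℚ → (f ⊛ K) 0 ≢ 0ℚ
          times f f₀ = ⊛-head-≢0 f K f₀ K≢0
          K⁹≢0 : K⁹ 0 ≢ 0ℚ
          K⁹≢0 = times (K ⊛ K ⊛ K ⊛ K ⊛ K ⊛ K ⊛ K ⊛ K) (times (K ⊛ K ⊛ K ⊛ K ⊛ K ⊛ K ⊛ K) (times (K ⊛ K ⊛ K ⊛ K ⊛ K ⊛ K)
            (times (K ⊛ K ⊛ K ⊛ K ⊛ K) (times (K ⊛ K ⊛ K ⊛ K) (times (K ⊛ K ⊛ K) (times (K ⊛ K) (times K K≢0)))))))

        HM² : H ⊛ (M ⊛ M) ⊕ G ⊛ M ⊛ θ (θ M) ⊖ const (ℕ→ℚ 5) ⊛ const ℚ.½ ⊛ const ℚ.½ ⊛ G ⊛ (θ M ⊛ θ M)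
              ⊕ const ℚ.½ ⊛ θ G ⊛ M ⊛ θ M ≈ const (ℕ→ℚ 240) ⊛ y ⊛ (M ⊛ M ⊛ M)
        HM² = S.trans
          (S.+-cong (S.+-cong (S.+-cong (S.*-congʳ {M ⊛ M} H≈) (S.*-congʳ {θ (θ M)} (S.*-congʳ {M} G≈)))
                              (S.-‿cong (S.*-congʳ {θ M ⊛ θ M} (S.*-congˡ {const (ℕ→ℚ 5) ⊛ const ℚ.½ ⊛ const ℚ.½} G≈))))
                    (S.*-congʳ {θ M} (S.*-congʳ {M} (S.*-congˡ {const ℚ.½} (S.trans (θ-cong G≈) (S.sym (⟪⟫-θ Gₚ)))))))
          (fromDifference (⊛-cancel-zero 0 scale _
            (⊛-head-≢0 (const (ℕ→ℚ 64) ⊛ (g ⊛ g)) (K ⊛ K ⊛ K)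
              (⊛-head-≢0 (const (ℕ→ℚ 64)) (g ⊛ g) (λ ()) (⊛-head-≢0 g g g₀ g₀))
              (⊛-head-≢0 (K ⊛ K) K (⊛-head-≢0 K K K≢0 K≢0) K≢0))
            (Par.HM²-multiple (vanishes-sound s s² relationB B≈0))))
          where
          scale : Series
          scale = const (ℕ→ℚ 64) ⊛ (g ⊛ g) ⊛ (K ⊛ K ⊛ K)

      transformed : Recurrence.T G H ⊛ m ≈ m 0 • (F₁ ∘ y)
      transformed = Transformation.transformation G H y M m G₀ H₀ (y-mod 0 (s≤s z≤n)) k
        (λ eq → case trans (sym (trans (y-mod (suc k) ℕₚ.≤-refl) (x^-diagonal (suc k)))) eq of λ ())
        m² m₀ G∂y² HM²

-- The seven levels

scale-⟪⟫ : ∀ r p → ⟦ List.map (r ℚ.*_) (List.map ℚLit.fromℤ p) ⟧ ≈ r • ⟪ p ⟫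
scale-⟪⟫ r []      n       = sym (ℚₚ.*-zeroʳ r)
scale-⟪⟫ r (i ∷ p) zero    = refl
scale-⟪⟫ r (i ∷ p) (suc n) = scale-⟪⟫ r p n

-- The list is part of the witness, so a polynomial given as a product is multiplied out by
-- computation when `Data` is assembled.
Multiple : ℚ → Series → Set
Multiple r f = ∃[ p ] f ≈ const r ⊛ ⟪ p ⟫

Integral : Series → Set
Integral f = ∃[ p ] f ≈ ⟪ p ⟫

exact : ∀ p → Integral ⟪ p ⟫
exact p = p , λ _ → refl

infixl 8 _⊛ᵢ_
_⊛ᵢ_ : ∀ {f h} → Integral f → Integral h → Integral (f ⊛ h)
(p , f≈) ⊛ᵢ (q , h≈) = p *ₚ q , S.trans (S.*-cong f≈ h≈) (S.sym (⟪⟫-* p q))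

multiple-⟪⟫ : ∀ r p → Multiple r ⟦ List.map (r ℚ.*_) (List.map ℚLit.fromℤ p) ⟧
multiple-⟪⟫ r p = p , S.trans (scale-⟪⟫ r p) (S.sym (const-⊛ r ⟪ p ⟫))

-- Matches the way `H` is written from `ℓ₅` on: `r ℚ.* ℚLit.fromℤ k` evaluates to the literal in
-- front, for instance ¼ · 48 to 12.
multiple-x : ∀ r k p → Multiple r ((r ℚ.* ℚLit.fromℤ k) • x^ 1 ⊛ ⟪ p ⟫)
multiple-x r k p = scaleₚ k (+ 0 ∷ p) , (begin
  (r ℚ.* ℚLit.fromℤ k) • x^ 1 ⊛ ⟪ p ⟫
    ≈⟨ const-⊛ (r ℚ.* ℚLit.fromℤ k) (x^ 1 ⊛ ⟪ p ⟫) ⟨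
  const (r ℚ.* ℚLit.fromℤ k) ⊛ (x^ 1 ⊛ ⟪ p ⟫)
    ≈⟨ S.*-cong (const-* r (ℚLit.fromℤ k)) shift ⟩
  const r ⊛ int k ⊛ ⟪ + 0 ∷ p ⟫
    ≈⟨ S.*-assoc (const r) (int k) ⟪ + 0 ∷ p ⟫ ⟩
  const r ⊛ (int k ⊛ ⟪ + 0 ∷ p ⟫)
    ≈⟨ S.*-congˡ {const r} (S.trans (const-⊛ (ℚLit.fromℤ k) ⟪ + 0 ∷ p ⟫) (S.sym (⟪⟫-scale k (+ 0 ∷ p)))) ⟩
  const r ⊛ ⟪ scaleₚ k (+ 0 ∷ p) ⟫ ∎)
  where
  open SeriesReasoning
  shift : x^ 1 ⊛ ⟪ p ⟫ ≈ ⟪ + 0 ∷ p ⟫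
  shift zero    = x⊛-head ⟪ p ⟫
  shift (suc n) = x⊛-tail ⟪ p ⟫ n

record Model (ℓ : Level) : Set where
  open Polynomials (polynomials ℓ)
  field
    a-half : Multiple ℚ.½ a
    b-half : Multiple ℚ.½ b
    c-int  : Integral c
    d-int  : Integral d
    g-int  : Integral g
    K-int  : Integral K
    G-int  : Integral (G ℓ)
    H-quarter : Multiple ((+ 1) ℚ./ 4) (H ℓ)

  D : Data
  D = record
    { Aₚ = proj₁ a-half ; Bₚ = proj₁ b-half
    ; cₚ = proj₁ c-int ; dₚ = proj₁ d-int
    ; gₚ = proj₁ g-int ; Kₚ = proj₁ K-int
    ; Gₚ = proj₁ G-int ; Hₚ = proj₁ H-quarter
    ; e = toℕ ℓ ∸ 1 ; ℓ = toℕ ℓ }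
  open Data D using (vanishes; relationA; relationB; relationC; relationE)

  field
    A≈0 : vanishes relationA ≡ true
    B≈0 : vanishes relationB ≡ true
    C≈0 : vanishes relationC ≡ true
    E≈0 : vanishes relationE ≡ true
    suc-e : suc (toℕ ℓ ∸ 1) ≡ toℕ ℓ
    ℓ>0   : 0ℚ ℚ.< ℕ→ℚ (toℕ ℓ)
    1/ℓ²-inverse : 1/ℓ² ℓ ℚ.* ℕ→ℚ (toℕ ℓ ℕ.* toℕ ℓ) ≡ 1ℚ
    G₀ : G ℓ 0 ≡ 1ℚ
    H₀ : H ℓ 0 ≡ 0ℚ
    c₀ : c 0 ≡ 1ℚ
    d₀ : d 0 ≡ 1ℚ
    g₀ : g 0 ≡ 1ℚ
    K₀ : K 0 ≡ 1ℚ
    -- The values of a ± b √g at 0. They make ℓ and 1 the constant terms of the two roots, and so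
    -- the factors in front of F₁.
    a₀+b₀ : a 0 ℚ.+ b 0 ≡ ℕ→ℚ (toℕ ℓ) ℚ.* ℕ→ℚ (toℕ ℓ)
    a₀-b₀ : a 0 ℚ.- b 0 ≡ 1ℚ

module Models where
  open import Agda.Builtin.FromNat using (Number; fromNat)
  open import Agda.Builtin.FromNeg using (Negative; fromNeg)
  import Data.Integer.Literals as ℤLit
  open import Data.Unit.Base using (tt)

  private
    instance
      ℤ-literals : Number ℤ
      ℤ-literals = ℤLit.number

      ℤ-negative-literals : Negative ℤ
      ℤ-negative-literals = ℤLit.negative

    ½⟪_⟫ : ∀ p → Multiple ℚ.½ ⟦ List.map (ℚ.½ ℚ.*_) (List.map ℚLit.fromℤ p) ⟧
    ½⟪_⟫ = multiple-⟪⟫ ℚ.½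

    ¼ : ℚ
    ¼ = (+ 1) ℚ./ 4

    ℓ-positive : ∀ {n} → 0ℚ ℚ.< ℕ→ℚ (suc n)
    ℓ-positive = ℚ.*<* (ℤ.+<+ (s≤s z≤n))

  model : ∀ ℓ → Model ℓ
  model ℓ₂ = record
    { a-half = ½⟪ 5 ∷ [] ⟫
    ; b-half = ½⟪ 3 ∷ [] ⟫
    ; c-int = exact (1 ∷ -207 ∷ 3456 ∷ [])
    ; d-int = exact (1 ∷ -81 ∷ [])
    ; g-int = exact (1 ∷ -256 ∷ [])
    ; K-int = exact (1 ∷ 144 ∷ [])
    ; G-int = exact (1 ∷ -256 ∷ [])
    ; H-quarter = multiple-⟪⟫ ¼ (0 ∷ 192 ∷ [])
    ; A≈0 = refl ; B≈0 = refl ; C≈0 = refl ; E≈0 = refl ; suc-e = refl ; ℓ>0 = ℓ-positive ; 1/ℓ²-inverse = refl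
    ; G₀ = refl ; H₀ = refl ; c₀ = refl ; d₀ = refl ; g₀ = refl ; K₀ = refl ; a₀+b₀ = refl ; a₀-b₀ = refl }
  model ℓ₃ = record
    { a-half = ½⟪ 10 ∷ [] ⟫
    ; b-half = ½⟪ 8 ∷ [] ⟫
    ; c-int = exact (1 ∷ -126 ∷ 2944 ∷ [])
    ; d-int = exact (1 ∷ -8 ∷ []) ⊛ᵢ exact (1 ∷ -64 ∷ [])
    ; g-int = exact (1 ∷ -108 ∷ [])
    ; K-int = exact (1 ∷ 192 ∷ [])
    ; G-int = exact (1 ∷ -108 ∷ [])
    ; H-quarter = multiple-⟪⟫ ¼ (0 ∷ 96 ∷ [])
    ; A≈0 = refl ; B≈0 = refl ; C≈0 = refl ; E≈0 = refl ; suc-e = refl ; ℓ>0 = ℓ-positive ; 1/ℓ²-inverse = refl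
    ; G₀ = refl ; H₀ = refl ; c₀ = refl ; d₀ = refl ; g₀ = refl ; K₀ = refl ; a₀+b₀ = refl ; a₀-b₀ = refl }
  model ℓ₅ = record
    { a-half = ½⟪ 26 ∷ -72 ∷ [] ⟫
    ; b-half = ½⟪ 24 ∷ [] ⟫
    ; c-int = exact (1 ∷ -80 ∷ 1890 ∷ -12600 ∷ 7776 ∷ 3456 ∷ [])
    ; d-int = exact (1 ∷ -4 ∷ []) ⊛ᵢ exact (1 ∷ -18 ∷ []) ⊛ᵢ exact (1 ∷ -36 ∷ [])
    ; g-int = exact (1 ∷ -44 ∷ -16 ∷ [])
    ; K-int = exact (1 ∷ 216 ∷ 144 ∷ [])
    ; G-int = exact (1 ∷ -44 ∷ -16 ∷ [])
    ; H-quarter = multiple-x ¼ 48 (1 ∷ 1 ∷ [])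
    ; A≈0 = refl ; B≈0 = refl ; C≈0 = refl ; E≈0 = refl ; suc-e = refl ; ℓ>0 = ℓ-positive ; 1/ℓ²-inverse = refl
    ; G₀ = refl ; H₀ = refl ; c₀ = refl ; d₀ = refl ; g₀ = refl ; K₀ = refl ; a₀+b₀ = refl ; a₀-b₀ = refl }
  model ℓ₇ = record
    { a-half = ½⟪ 50 ∷ -160 ∷ [] ⟫
    ; b-half = ½⟪ 48 ∷ [] ⟫
    ; c-int = exact (1 ∷ -21 ∷ 8 ∷ []) ⊛ᵢ exact (1 ∷ -42 ∷ 454 ∷ -1008 ∷ -1280 ∷ [])
    ; d-int = exact (1 ∷ -2 ∷ []) ⊛ᵢ exact (1 ∷ -8 ∷ []) ⊛ᵢ exact (1 ∷ -24 ∷ []) ⊛ᵢ exact (1 ∷ -16 ∷ -8 ∷ [])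
    ; g-int = exact (1 ∷ 1 ∷ []) ⊛ᵢ exact (1 ∷ -27 ∷ [])
    ; K-int = exact (1 ∷ 224 ∷ 448 ∷ [])
    ; G-int = exact (1 ∷ 1 ∷ []) ⊛ᵢ exact (1 ∷ -27 ∷ [])
    ; H-quarter = multiple-x ¼ 32 (1 ∷ 3 ∷ [])
    ; A≈0 = refl ; B≈0 = refl ; C≈0 = refl ; E≈0 = refl ; suc-e = refl ; ℓ>0 = ℓ-positive ; 1/ℓ²-inverse = refl
    ; G₀ = refl ; H₀ = refl ; c₀ = refl ; d₀ = refl ; g₀ = refl ; K₀ = refl ; a₀+b₀ = refl ; a₀-b₀ = refl }
  model ℓ₁₁ = record
    { a-half = ½⟪ 122 ∷ -736 ∷ 704 ∷ [] ⟫
    ; b-half = ½⟪ 120 ∷ [] ⟫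
    ; c-int = exact (1 ∷ -66 ∷ 1793 ∷ -26048 ∷ 221056 ∷ -1132670 ∷ 3535840 ∷ -6683072
        ∷ 7418752 ∷ -4460544 ∷ 1183744 ∷ -65536 ∷ [])
    ; d-int = exact (1 ∷ -1 ∷ []) ⊛ᵢ exact (1 ∷ -2 ∷ []) ⊛ᵢ exact (1 ∷ -4 ∷ [])
        ⊛ᵢ exact (1 ∷ -7 ∷ []) ⊛ᵢ exact (1 ∷ -16 ∷ [])
        ⊛ᵢ exact (1 ∷ -12 ∷ 16 ∷ []) ⊛ᵢ exact (1 ∷ -14 ∷ 4 ∷ [])
    ; g-int = exact (1 ∷ -20 ∷ 56 ∷ -44 ∷ [])
    ; K-int = exact (1 ∷ 224 ∷ -192 ∷ -832 ∷ 1024 ∷ [])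
    ; G-int = exact (1 ∷ -20 ∷ 56 ∷ -44 ∷ [])
    ; H-quarter = multiple-x ¼ 32 (1 ∷ -8 ∷ 11 ∷ [])
    ; A≈0 = refl ; B≈0 = refl ; C≈0 = refl ; E≈0 = refl ; suc-e = refl ; ℓ>0 = ℓ-positive ; 1/ℓ²-inverse = refl
    ; G₀ = refl ; H₀ = refl ; c₀ = refl ; d₀ = refl ; g₀ = refl ; K₀ = refl ; a₀+b₀ = refl ; a₀-b₀ = refl }
  model ℓ₁₃ = record
    { a-half = ½⟪ 170 ∷ -270 ∷ -560 ∷ [] ⟫
    ; b-half = ½⟪ 168 ∷ 96 ∷ [] ⟫
    ; c-int = exact (1 ∷ -39 ∷ 546 ∷ -2938 ∷ 117 ∷ 42861 ∷ -36998 ∷ -255294 ∷ 15366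
        ∷ 519610 ∷ 342576 ∷ -14976 ∷ -35840 ∷ [])
    ; d-int = exact (1 ∷ 2 ∷ []) ⊛ᵢ exact (1 ∷ 1 ∷ []) ⊛ᵢ exact (1 ∷ -1 ∷ [])
        ⊛ᵢ exact (1 ∷ -3 ∷ []) ⊛ᵢ exact (1 ∷ -8 ∷ []) ⊛ᵢ exact (1 ∷ -11 ∷ -8 ∷ [])
        ⊛ᵢ exact (1 ∷ -4 ∷ -8 ∷ []) ⊛ᵢ exact (1 ∷ -10 ∷ -2 ∷ [])
    ; g-int = exact (1 ∷ -10 ∷ -27 ∷ [])
    ; K-int = exact (1 ∷ 234 ∷ 1417 ∷ 1872 ∷ 832 ∷ [])
    ; G-int = exact (1 ∷ 1 ∷ []) ⊛ᵢ exact (1 ∷ -10 ∷ -27 ∷ [])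
    ; H-quarter = multiple-x ¼ 1 (12 ∷ 175 ∷ 231 ∷ [])
    ; A≈0 = refl ; B≈0 = refl ; C≈0 = refl ; E≈0 = refl ; suc-e = refl ; ℓ>0 = ℓ-positive ; 1/ℓ²-inverse = refl
    ; G₀ = refl ; H₀ = refl ; c₀ = refl ; d₀ = refl ; g₀ = refl ; K₀ = refl ; a₀+b₀ = refl ; a₀-b₀ = refl }
  model ℓ₂₃ = record
    { a-half = ½⟪ 530 ∷ -1880 ∷ 620 ∷ -120 ∷ -270 ∷ [] ⟫
    ; b-half = ½⟪ 528 ∷ -240 ∷ [] ⟫
    ; c-int = exact (1 ∷ -46 ∷ 920 ∷ -10465 ∷ 74221 ∷ -336927 ∷ 953856 ∷ -1470068
        ∷ 336674 ∷ 3209696 ∷ -6447728 ∷ 5423124 ∷ 302266 ∷ -6612454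
        ∷ 8362616 ∷ -4877702 ∷ -116403 ∷ 2732814 ∷ -2492280 ∷ 1115109
        ∷ -170775 ∷ -83835 ∷ 48600 ∷ -6750 ∷ [])
    ; d-int = exact (1 ∷ 1 ∷ []) ⊛ᵢ exact (1 ∷ -1 ∷ []) ⊛ᵢ exact (1 ∷ -2 ∷ [])
        ⊛ᵢ exact (1 ∷ -3 ∷ []) ⊛ᵢ exact (1 ∷ -5 ∷ []) ⊛ᵢ exact (1 ∷ -8 ∷ 3 ∷ [])
        ⊛ᵢ exact (1 ∷ -6 ∷ -9 ∷ []) ⊛ᵢ exact (1 ∷ -7 ∷ 3 ∷ -5 ∷ [])
        ⊛ᵢ exact (1 ∷ -7 ∷ 7 ∷ -3 ∷ []) ⊛ᵢ exact (1 ∷ -4 ∷ 0 ∷ 0 ∷ -1 ∷ [])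
    ; g-int = exact (1 ∷ 0 ∷ -1 ∷ 1 ∷ []) ⊛ᵢ exact (1 ∷ -8 ∷ 3 ∷ -7 ∷ [])
    ; K-int = exact (1 ∷ 232 ∷ 732 ∷ -968 ∷ 1894 ∷ -2280 ∷ 2268 ∷ -1080 ∷ 225 ∷ [])
    ; G-int = exact (1 ∷ 0 ∷ -1 ∷ 1 ∷ []) ⊛ᵢ exact (1 ∷ -8 ∷ 3 ∷ -7 ∷ [])
    ; H-quarter = multiple-x ¼ 16 (1 ∷ -1 ∷ -1 ∷ 12 ∷ -15 ∷ 14 ∷ [])
    ; A≈0 = refl ; B≈0 = refl ; C≈0 = refl ; E≈0 = refl ; suc-e = refl ; ℓ>0 = ℓ-positive ; 1/ℓ²-inverse = refl
    ; G₀ = refl ; H₀ = refl ; c₀ = refl ; d₀ = refl ; g₀ = refl ; K₀ = refl ; a₀+b₀ = refl ; a₀-b₀ = refl }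

-- Branches

square≈ : ∀ f → f ^ 2 ≈ f ⊛ f
square≈ f = S.*-congˡ {f} (S.*-identityʳ f)

cube≈ : ∀ f → f ^ 3 ≈ f ⊛ f ⊛ f
cube≈ f = S.trans (S.*-congˡ {f} (square≈ f)) (S.sym (S.*-assoc f f f))

-- In (p + r)(p - r) = 0 the first factor is positive. It fixes the constant terms of the roots in
-- an arbitrary `Branches`.
positive-root : ∀ {p r} → 0ℚ ℚ.< p → 0ℚ ℚ.< r → p ℚ.* p ≡ r ℚ.* r → p ≡ r
positive-root {p} {r} 0<p 0<r p²≡r² = x∙y⁻¹≈ε⇒x≈y p r (*-cancelˡ-≢0 p+r≢0 (begin
  (p ℚ.+ r) ℚ.* (p ℚ.- r)  ≡⟨ solve 2 (λ p r → (p :+ r) :* (p :- r) := p :* p :- r :* r) refl p r ⟩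
  p ℚ.* p ℚ.- r ℚ.* r      ≡⟨ cong (ℚ._- r ℚ.* r) p²≡r² ⟩
  r ℚ.* r ℚ.- r ℚ.* r      ≡⟨ ℚₚ.+-inverseʳ (r ℚ.* r) ⟩
  0ℚ                       ≡⟨ ℚₚ.*-zeroʳ (p ℚ.+ r) ⟨
  (p ℚ.+ r) ℚ.* 0ℚ         ∎))
  where
  open ≡-Reasoning
  open ℚSolver
  open RingProperties (CommutativeRing.ring ℚₚ.+-*-commutativeRing) using (x∙y⁻¹≈ε⇒x≈y)
  p+r≢0 : p ℚ.+ r ≢ 0ℚ
  p+r≢0 eq = ℚₚ.<⇒≢ (ℚₚ.+-mono-< 0<p 0<r) (sym eq)

0<⇒≢0 : ∀ {p} → 0ℚ ℚ.< p → p ≢ 0ℚ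
0<⇒≢0 0<p eq = ℚₚ.<⇒≢ 0<p (sym eq)

open Models using (model)

-- Existence and properties of the branches at one level

module AtLevel (ℓ : Level) where
  open Polynomials (polynomials ℓ)
  open Model (model ℓ)
  open Data D using (Aₚ; Bₚ; cₚ; dₚ; gₚ; Kₚ; M′; value; monomial; vanishes-sound)
  open SeriesReasoning

  private
    ℓℚ : ℚ
    ℓℚ = ℕ→ℚ (toℕ ℓ)

    g≈ : g ≈ ⟪ gₚ ⟫
    g≈ = proj₂ g-int

  a+b√ a-b√ c+d√ c-d√ : Series → Series
  a+b√ s = a ⊕ b ⊛ s
  a-b√ s = a ⊖ b ⊛ s
  c+d√ s = c ⊕ d ⊛ s
  c-d√ s = c ⊖ d ⊛ s

  plus≈minus-neg : ∀ f h s → f ⊕ h ⊛ s ≈ f ⊖ h ⊛ neg s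
  plus≈minus-neg f h s = ⊛-solve 3 (λ f h s → f :+ h :* s := f :- h :* (:- s)) S.refl f h s

  module Sign (s : Series) (s² : s ⊛ s ≈ g) where

    c-d√≈ : c-d√ s ≈ ⟪ cₚ ⟫ ⊖ ⟪ dₚ ⟫ ⊛ s
    c-d√≈ = S.+-cong (proj₂ c-int) (S.-‿cong (S.*-congʳ {s} (proj₂ d-int)))

    c+d√≈ : c+d√ s ≈ ⟪ cₚ ⟫ ⊕ ⟪ dₚ ⟫ ⊛ s
    c+d√≈ = S.+-cong (proj₂ c-int) (S.*-congʳ {s} (proj₂ d-int))

    s²ₚ : s ⊛ s ≈ ⟪ gₚ ⟫
    s²ₚ = S.trans s² g≈

    a-b√≈ : a-b√ s ≈ const ℚ.½ ⊛ value s s²ₚ M′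
    a-b√≈ = begin
      a ⊖ b ⊛ s
        ≈⟨ S.+-cong (proj₂ a-half) (S.-‿cong (S.*-congʳ {s} (proj₂ b-half))) ⟩
      const ℚ.½ ⊛ ⟪ Aₚ ⟫ ⊖ const ℚ.½ ⊛ ⟪ Bₚ ⟫ ⊛ s
        ≈⟨ ⊛-solve 3 (λ a b s → con ℚ.½ :* a :- con ℚ.½ :* b :* s := con ℚ.½ :* (a :+ (:- b) :* s)) S.refl ⟪ Aₚ ⟫ ⟪ Bₚ ⟫ s ⟩
      const ℚ.½ ⊛ (⟪ Aₚ ⟫ ⊕ neg ⟪ Bₚ ⟫ ⊛ s)
        ≈⟨ S.*-congˡ {const ℚ.½} (S.+-congˡ {⟪ Aₚ ⟫} (S.*-congʳ {s} (⟪⟫-neg Bₚ))) ⟨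
      const ℚ.½ ⊛ value s s²ₚ M′ ∎

    module Conj = Conjugate D A≈0 B≈0 C≈0
      (λ eq → case trans (sym g₀) (trans (g≈ 0) eq) of λ ())
      (trans (sym (proj₂ K-int 0)) K₀)
      s s²ₚ

    power≡ : ℕ→ℚ 2 • x^ suc (toℕ ℓ ∸ 1) ≈ ℕ→ℚ 2 • x^ toℕ ℓ
    power≡ n = cong (λ k → ℕ→ℚ 2 ℚ.* (x^ k) n) suc-e

    solution-spec : Conj.solution ⊛ c-d√ s ≈ ℕ→ℚ 2 • x^ toℕ ℓ
    solution-spec = S.trans (S.*-congˡ {Conj.solution} c-d√≈) (S.trans Conj.solution-spec power≡)

    module Sol (y : Series) (y-spec : y ⊛ c-d√ s ≈ ℕ→ℚ 2 • x^ toℕ ℓ) where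

      open Conj.Solution y (S.trans (S.*-congˡ {y} (S.sym c-d√≈)) (S.trans y-spec (S.sym power≡))) public

      relation : ∀ k {m} → y ≈ x^ suc k mod-x^ suc (suc k) → m ⊛ m ≈ a-b√ s → m 0 ≢ 0ℚ →
                 F ℓ ⊛ m ≈ m 0 • (F₁ ∘ y)
      relation k {m} y-mod m² m₀ = Transformed.transformed {G ℓ} {H ℓ} {m} (proj₂ G-int) (proj₂ H-quarter) G₀ H₀ k y-mod
        (S.trans m² a-b√≈) m₀

  a-convergent : Convergent a
  a-convergent = convergent-cong (proj₂ a-half) (convergent-⊛ (convergent-const ℚ.½) (convergent-⟪⟫ Aₚ))

  b-convergent : Convergent b
  b-convergent = convergent-cong (proj₂ b-half) (convergent-⊛ (convergent-const ℚ.½) (convergent-⟪⟫ Bₚ))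

  G-convergent : Convergent (G ℓ)
  G-convergent = convergent-cong (proj₂ G-int) (convergent-⟪⟫ (proj₁ G-int))

  H-convergent : Convergent (H ℓ)
  H-convergent = convergent-cong (proj₂ H-quarter) (convergent-⊛ (convergent-const ((+ 1) ℚ./ 4)) (convergent-⟪⟫ (proj₁ H-quarter)))

  sum-head : ∀ f h {s} → s 0 ≡ 1ℚ → (f ⊕ h ⊛ s) 0 ≡ f 0 ℚ.+ h 0
  sum-head f h {s} s₀ = cong (f 0 ℚ.+_) (trans (⊛-head h s) (trans (cong (h 0 ℚ.*_) s₀) (ℚₚ.*-identityʳ (h 0))))

  difference-head : ∀ f h {s} → s 0 ≡ 1ℚ → (f ⊖ h ⊛ s) 0 ≡ f 0 ℚ.- h 0
  difference-head f h {s} s₀ = cong (λ z → f 0 ℚ.- z) (trans (⊛-head h s) (trans (cong (h 0 ℚ.*_) s₀) (ℚₚ.*-identityʳ (h 0))))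

  module Heads {s : Series} (s₀ : s 0 ≡ 1ℚ) where

    c+d√-head : c+d√ s 0 ≡ ℕ→ℚ 2
    c+d√-head = trans (sum-head c d {s} s₀) (cong₂ ℚ._+_ c₀ d₀)

    c+d√-head-≢0 : c+d√ s 0 ≢ 0ℚ
    c+d√-head-≢0 eq = case trans (sym c+d√-head) eq of λ ()

    a+b√-head : a+b√ s 0 ≡ ℓℚ ℚ.* ℓℚ
    a+b√-head = trans (sum-head a b {s} s₀) a₀+b₀

    a-b√-head : a-b√ s 0 ≡ 1ℚ
    a-b√-head = trans (difference-head a b {s} s₀) a₀-b₀

  neg² : ∀ {s} → s ⊛ s ≈ g → neg s ⊛ neg s ≈ g
  neg² {s} s² = S.trans (⊛-solve 1 (λ s → (:- s) :* (:- s) := s :* s) S.refl s) s²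

  private
    1>0 : 0ℚ ℚ.< 1ℚ
    1>0 = ℚ.*<* (ℤ.+<+ (s≤s z≤n))

  c-d√-nonzero : ∀ {s} → s 0 ≡ 1ℚ → s ⊛ s ≈ g → ∃[ n ] c-d√ s n ≢ 0ℚ
  c-d√-nonzero {s} s₀ s² = proj₁ nonzero , λ eq →
    proj₂ nonzero (trans (sym (Signed.c-d√≈ (proj₁ nonzero))) eq)
    where
    module Signed = Sign s s²
    nonzero : ∃[ n ] (⟪ cₚ ⟫ ⊖ ⟪ dₚ ⟫ ⊛ s) n ≢ 0ℚ
    nonzero = Signed.Conj.conjugate-leading
      (λ eq → Heads.c+d√-head-≢0 {s} s₀ (trans (Signed.c+d√≈ 0) eq))

  √g₀ : Series
  √g₀ = squareRoot g 1ℚ (λ ()) g₀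

  √g₀² : √g₀ ⊛ √g₀ ≈ g
  √g₀² = squareRoot² g 1ℚ (λ ()) g₀

  branches : Branches ℓ
  branches = record
    { √g = √g₀
    ; y⁺ = Plus.Conj.solution
    ; y⁻ = Minus.Conj.solution
    ; √[a+b√g] = squareRoot (a+b√ √g₀) ℓℚ (0<⇒≢0 ℓ>0) a+b√-head
    ; √[a-b√g] = squareRoot (a-b√ √g₀) 1ℚ (λ ()) a-b√-head
    ; √g-spec = subst (0ℚ ℚ.<_) (sym √g₀-head) 1>0 , √g₀²
    ; y⁺-spec = (0 , c+d√-head-≢0)
      , S.trans (S.*-congˡ {Plus.Conj.solution} (plus≈minus-neg c d √g₀)) Plus.solution-spec
    ; y⁻-spec = c-d√-nonzero {√g₀} √g₀-head √g₀² , Minus.solution-spec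
    ; √[a+b√g]-spec = subst (0ℚ ℚ.<_) (sym (squareRoot-head (a+b√ √g₀) ℓℚ (0<⇒≢0 ℓ>0) a+b√-head)) ℓ>0
      , squareRoot² (a+b√ √g₀) ℓℚ (0<⇒≢0 ℓ>0) a+b√-head
    ; √[a-b√g]-spec = subst (0ℚ ℚ.<_) (sym (squareRoot-head (a-b√ √g₀) 1ℚ (λ ()) a-b√-head)) 1>0
      , squareRoot² (a-b√ √g₀) 1ℚ (λ ()) a-b√-head
    }
    where
    √g₀-head : √g₀ 0 ≡ 1ℚ
    √g₀-head = squareRoot-head g 1ℚ (λ ()) g₀
    open Heads {√g₀} √g₀-head
    module Minus = Sign √g₀ √g₀²
    module Plus = Sign (neg √g₀) (neg² {√g₀} √g₀²)

  module Properties (B : Branches ℓ) where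
    open Branches B

    private
      √g² : √g ⊛ √g ≈ g
      √g² = proj₂ √g-spec

      √g-head : √g 0 ≡ 1ℚ
      √g-head = positive-root (proj₁ √g-spec) 1>0 (trans (sym (⊛-head √g √g)) (trans (√g² 0) g₀))

      open Heads {√g} √g-head

      y⁺-minus-spec : y⁺ ⊛ c-d√ (neg √g) ≈ ℕ→ℚ 2 • x^ toℕ ℓ
      y⁺-minus-spec = S.trans (S.*-congˡ {y⁺} (S.sym (plus≈minus-neg c d √g))) (proj₂ y⁺-spec)

      module Minus = Sign.Sol √g √g² y⁻ (proj₂ y⁻-spec)
      module Plus = Sign.Sol (neg √g) (neg² {√g} √g²) y⁺ y⁺-minus-spec

      √[a+b√g]-head : √[a+b√g] 0 ≡ ℓℚ
      √[a+b√g]-head = positive-root (proj₁ √[a+b√g]-spec) ℓ>0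
        (trans (sym (⊛-head √[a+b√g] √[a+b√g])) (trans (proj₂ √[a+b√g]-spec 0) a+b√-head))

      √[a-b√g]-head : √[a-b√g] 0 ≡ 1ℚ
      √[a-b√g]-head = positive-root (proj₁ √[a-b√g]-spec) 1>0
        (trans (sym (⊛-head √[a-b√g] √[a-b√g])) (trans (proj₂ √[a-b√g]-spec 0) a-b√-head))

    √g-convergent : Convergent √g
    √g-convergent = squareRoot-convergent {√g} {g} (λ eq → case trans (sym g₀) eq of λ ()) √g²
      (convergent-cong g≈ (convergent-⟪⟫ gₚ))

    y⁺-convergent : Convergent y⁺
    y⁺-convergent = Plus.y-convergent (convergent-neg {√g} √g-convergent)

    y⁻-convergent : Convergent y⁻
    y⁻-convergent = Minus.y-convergent √g-convergent

    √[a+b√g]-convergent : Convergent √[a+b√g]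
    √[a+b√g]-convergent = squareRoot-convergent {√[a+b√g]} {a+b√ √g}
      (λ eq → *-≢0 (0<⇒≢0 ℓ>0) (0<⇒≢0 ℓ>0) (trans (sym a+b√-head) eq)) (proj₂ √[a+b√g]-spec)
      (convergent-⊕ a-convergent (convergent-⊛ b-convergent √g-convergent))

    √[a-b√g]-convergent : Convergent √[a-b√g]
    √[a-b√g]-convergent = squareRoot-convergent {√[a-b√g]} {a-b√ √g}
      (λ eq → case trans (sym a-b√-head) eq of λ ()) (proj₂ √[a-b√g]-spec)
      (convergent-⊕ a-convergent (convergent-neg {b ⊛ √g} (convergent-⊛ b-convergent √g-convergent)))

    y⁺-leading : y⁺ ≈ x^ toℕ ℓ mod-x^ suc (toℕ ℓ)
    y⁺-leading = leading-mod (toℕ ℓ) y⁺ (c+d√ √g) (const (ℕ→ℚ 2)) c+d√-head-≢0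
      c+d√-head (S.trans (proj₂ y⁺-spec) (S.trans (S.sym (const-⊛ (ℕ→ℚ 2) (x^ toℕ ℓ))) (S.*-comm (const (ℕ→ℚ 2)) (x^ toℕ ℓ))))

    -- The denominator in the specification has order ℓ - 1, so the leading term is read off from y⁻
    -- · 2 K³ = x (c + d √g) instead, where both `2K³` and c + d √g have constant term 2.
    y⁻-leading : y⁻ ≈ x^ 1 mod-x^ 2
    y⁻-leading = leading-mod 1 y⁻ (Sign.Conj.2K³ √g √g²) (⟪ cₚ ⟫ ⊕ ⟪ dₚ ⟫ ⊛ √g)
      (λ eq → case trans (sym (Sign.Conj.2K³-head √g √g²)) eq of λ ())
      (trans (Sign.Conj.2K³-head √g √g²) (trans (sym c+d√-head) (Sign.c+d√≈ √g √g² 0))) Minus.y2K³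

    relation⁺ : F ℓ ⊛ √[a+b√g] ≈ ℓℚ • (F₁ ∘ y⁺)
    relation⁺ n = trans
      (Plus.relation (toℕ ℓ ∸ 1) {√[a+b√g]} (subst (λ k → y⁺ ≈ x^ k mod-x^ suc k) (sym suc-e) y⁺-leading)
        (S.trans (proj₂ √[a+b√g]-spec) (plus≈minus-neg a b √g))
        (0<⇒≢0 (proj₁ √[a+b√g]-spec)) n)
      (cong (ℚ._* (F₁ ∘ y⁺) n) √[a+b√g]-head)

    relation⁻ : F ℓ ⊛ √[a-b√g] ≈ F₁ ∘ y⁻
    relation⁻ n = trans
      (Minus.relation 0 {√[a-b√g]} y⁻-leading (proj₂ √[a-b√g]-spec) (0<⇒≢0 (proj₁ √[a-b√g]-spec)) n)
      (trans (cong (ℚ._* (F₁ ∘ y⁻) n) √[a-b√g]-head) (ℚₚ.*-identityˡ ((F₁ ∘ y⁻) n)))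

    properties :
      (Convergent (F ℓ) × Convergent F₁ × Convergent √g ×
       Convergent y⁺ × Convergent y⁻ ×
       Convergent √[a+b√g] × Convergent √[a-b√g]) ×
      y⁺ ≈ x^ (toℕ ℓ) mod-x^ suc (toℕ ℓ) ×
      y⁻ ≈ x^ 1 mod-x^ 2 ×
      F ℓ ≈ ℓℚ • F₁ ∘ y⁺ ÷ √[a+b√g] ×
      F ℓ ≈ F₁ ∘ y⁻ ÷ √[a-b√g]
    properties =
      ( T-convergent {G ℓ} {H ℓ} G-convergent H-convergent
      , T-convergent (convergent-⟪⟫ (+ 1 ∷ ℤ.-[1+ 1727 ] ∷ [])) (convergent-⟪⟫ (+ 0 ∷ + 240 ∷ []))
      , √g-convergent , y⁺-convergent , y⁻-convergent , √[a+b√g]-convergent , √[a-b√g]-convergent )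
      , y⁺-leading , y⁻-leading
      , ((0 , 0<⇒≢0 (proj₁ √[a+b√g]-spec)) , relation⁺)
      , ((0 , 0<⇒≢0 (proj₁ √[a-b√g]-spec)) , relation⁻)

  norm-c : K ^ 3 ≈ c ^ 2 ⊖ d ^ 2 ⊛ g ÷ ℕ→ℚ 4 • x^ (toℕ ℓ ∸ 1)
  norm-c = (toℕ ℓ ∸ 1 , λ eq → case trans (sym (cong (ℕ→ℚ 4 ℚ.*_) (x^-diagonal (toℕ ℓ ∸ 1)))) eq of λ ()) , (begin
    K ^ 3 ⊛ (ℕ→ℚ 4 • x^ (toℕ ℓ ∸ 1))
      ≈⟨ S.*-cong (S.trans (cube≈ K) (S.*-cong (S.*-cong K≈ K≈) K≈))
           (S.trans (S.sym (const-⊛ (ℕ→ℚ 4) (x^ (toℕ ℓ ∸ 1)))) (S.*-congˡ {const (ℕ→ℚ 4)} (S.sym (monomial≈x^ (toℕ ℓ ∸ 1))))) ⟩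
    ⟪ Kₚ ⟫ ⊛ ⟪ Kₚ ⟫ ⊛ ⟪ Kₚ ⟫ ⊛ (const (ℕ→ℚ 4) ⊛ ⟪ monomial ⟫)
      ≈⟨ S.*-comm (⟪ Kₚ ⟫ ⊛ ⟪ Kₚ ⟫ ⊛ ⟪ Kₚ ⟫) (const (ℕ→ℚ 4) ⊛ ⟪ monomial ⟫) ⟩
    const (ℕ→ℚ 4) ⊛ ⟪ monomial ⟫ ⊛ (⟪ Kₚ ⟫ ⊛ ⟪ Kₚ ⟫ ⊛ ⟪ Kₚ ⟫)
      -- `relationC` does not contain `root`, so its value is the same for every root of `g`; `√g₀`
      -- is the one at hand.
      ≈⟨ fromDifference (vanishes-sound √g₀ (S.trans √g₀² g≈) (Data.relationC D) C≈0) ⟨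
    ⟪ cₚ ⟫ ⊛ ⟪ cₚ ⟫ ⊖ ⟪ dₚ ⟫ ⊛ ⟪ dₚ ⟫ ⊛ ⟪ gₚ ⟫
      ≈⟨ S.+-cong (S.*-cong (proj₂ c-int) (proj₂ c-int))
           (S.-‿cong (S.*-cong (S.*-cong (proj₂ d-int) (proj₂ d-int)) g≈)) ⟨
    c ⊛ c ⊖ d ⊛ d ⊛ g
      ≈⟨ S.+-cong (square≈ c) (S.-‿cong (S.*-congʳ {g} (square≈ d))) ⟨
    c ^ 2 ⊖ d ^ 2 ⊛ g ∎)
    where
    K≈ : K ≈ ⟪ Kₚ ⟫
    K≈ = proj₂ K-int

  norm-a : (1/ℓ² ℓ • (a ^ 2 ⊖ b ^ 2 ⊛ g)) ^ 3 ≈ K ^ 3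
  norm-a = S.trans (cube≈ (1/ℓ² ℓ • (a ^ 2 ⊖ b ^ 2 ⊛ g))) (S.trans (S.*-cong (S.*-cong base base) base) (S.sym (cube≈ K)))
    where
    ℓ² : ℚ
    ℓ² = ℕ→ℚ (toℕ ℓ ℕ.* toℕ ℓ)
    r A B : Series
    r = const (1/ℓ² ℓ)
    A = ⟪ Aₚ ⟫
    B = ⟪ Bₚ ⟫
    base : 1/ℓ² ℓ • (a ^ 2 ⊖ b ^ 2 ⊛ g) ≈ K
    base = begin
      1/ℓ² ℓ • (a ^ 2 ⊖ b ^ 2 ⊛ g)
        ≈⟨ const-⊛ (1/ℓ² ℓ) (a ^ 2 ⊖ b ^ 2 ⊛ g) ⟨
      r ⊛ (a ^ 2 ⊖ b ^ 2 ⊛ g)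
        ≈⟨ S.*-congˡ {r} (S.+-cong (S.trans (square≈ a) (S.*-cong (proj₂ a-half) (proj₂ a-half)))
             (S.-‿cong (S.*-cong (S.trans (square≈ b) (S.*-cong (proj₂ b-half) (proj₂ b-half))) g≈))) ⟩
      r ⊛ (const ℚ.½ ⊛ A ⊛ (const ℚ.½ ⊛ A) ⊖ const ℚ.½ ⊛ B ⊛ (const ℚ.½ ⊛ B) ⊛ ⟪ gₚ ⟫)
        ≈⟨ ⊛-solve 4 (λ r a b g → r :* (con ℚ.½ :* a :* (con ℚ.½ :* a) :- con ℚ.½ :* b :* (con ℚ.½ :* b) :* g)
             := con ((+ 1) ℚ./ 4) :* r :* (a :* a :- b :* b :* g)) S.refl r A B ⟪ gₚ ⟫ ⟩
      const ((+ 1) ℚ./ 4) ⊛ r ⊛ (A ⊛ A ⊖ B ⊛ B ⊛ ⟪ gₚ ⟫)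
        ≈⟨ S.*-congˡ {const ((+ 1) ℚ./ 4) ⊛ r} (fromDifference (vanishes-sound √g₀ (S.trans √g₀² g≈) (Data.relationE D) E≈0)) ⟩
      const ((+ 1) ℚ./ 4) ⊛ r ⊛ (const (ℕ→ℚ 4) ⊛ const ℓ² ⊛ ⟪ Kₚ ⟫)
        ≈⟨ ⊛-solve 3 (λ r l k → con ((+ 1) ℚ./ 4) :* r :* (con (ℕ→ℚ 4) :* l :* k) := r :* l :* k) S.refl r (const ℓ²) ⟪ Kₚ ⟫ ⟩
      r ⊛ const ℓ² ⊛ ⟪ Kₚ ⟫
        ≈⟨ S.*-cong (S.trans (S.sym (const-* (1/ℓ² ℓ) ℓ²)) (S.trans (S.reflexive (cong const 1/ℓ²-inverse)) const-one)) (S.sym (proj₂ K-int)) ⟩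
      𝟙 ⊛ K
        ≈⟨ S.*-identityˡ K ⟩
      K ∎

theorem7p1 : (ℓ : Level) →
    let open Polynomials (polynomials ℓ) in
    Branches ℓ ×
    ((B : Branches ℓ) →
    let open Branches B in
    (Convergent (F ℓ) × Convergent F₁ × Convergent √g ×
    Convergent y⁺ × Convergent y⁻ ×
    Convergent √[a+b√g] × Convergent √[a-b√g]) ×
    y⁺ ≈ x^ (toℕ ℓ) mod-x^ suc (toℕ ℓ) ×
    y⁻ ≈ x^ 1 mod-x^ 2 ×
    F ℓ ≈ ℕ→ℚ (toℕ ℓ) • F₁ ∘ y⁺ ÷ √[a+b√g] ×
    F ℓ ≈ F₁ ∘ y⁻ ÷ √[a-b√g]) ×
    K ^ 3 ≈ c ^ 2 ⊖ d ^ 2 ⊛ g ÷ ℕ→ℚ 4 • x^ (toℕ ℓ ∸ 1) ×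
    (1/ℓ² ℓ • (a ^ 2 ⊖ b ^ 2 ⊛ g)) ^ 3 ≈ K ^ 3
theorem7p1 ℓ = branches , Properties.properties , norm-c , norm-a
  where open AtLevel ℓ
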